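{- For every $n\ge1$, the poset $\mathcal{FL}yn_n^\bullet$ of pointed Lyndon forests is a Whitney dual of $\Pi_n^\bullet$. In particular, $\mathcal{FL}yn_n^\bullet\cong R_{\lambda_\bullet}(\Pi_n^\bullet)$.
   Context: Pointed partitions: a pointed set is $A^p$ with $A$ nonempty finite, $p\in A$; a pointed partition of $[n]$ is a collection of pointed sets whose underlying sets partition $[n]$. In $\Pi_n^\bullet$, $\pi\lessdot\pi'$ when $\pi'$ arises by replacing two blocks $A^p,B^q$ ($\min A<\min B$) by $(A\cup B)^p$ (1-merge) or $(A\cup B)^q$ (0-merge); $\hat0$ is the partition into singletons. $\lambda_\bullet$ labels a $u$-merge by $(\min A,\min B)^u\in\Lambda_n^\bullet$, where $\Lambda_n^\bullet$ has elements $(a,b)^u$ ($1\le a<b\le n$, $u\in\{0,1\}$), ordered as the ordinal sum $A_1\oplus C_1\oplus\cdots\oplus A_{n-1}\oplus C_{n-1}$, $A_a$ the antichain $\{(a,b)^0\}$, $C_a$ the chain $\{(a,b)^1\}$ with $(a,b)^1<(a,c)^1$ iff $b<c$. $R_\lambda(P)$: for a word $w$ over a poset of labels, $\mathrm{sort}(w)$ is obtained by repeatedly taking the smallest index $i$ with $w_i<w_{i+1}$ and swapping $w_i,w_{i+1}$ until no such index exists. For a poset $P$ with edge labeling $\lambda$, $R_\lambda(P)$ is the set of pairs $(x,w)$ with $x\in P$ and $w$ the label sequence of an ascent-free saturated chain from $\hat0$ to $x$ (ascent-free: no consecutive labels with $\ell_i<\ell_{i+1}$), with $(x,w)\lessdot(y,u)$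 iff $x\lessdot y$ in $P$ and $u=\mathrm{sort}(w\,\lambda(x\lessdot y))$. Trees: a bicolored binary forest on $[n]$ is a forest of rooted planar binary trees (internal vertices have left child $L(v)$ and right child $R(v)$) with leaves bijectively labeled by $[n]$ and each internal vertex colored $\mathrm{color}(v)\in\{0,1\}$. The valency $\nu(v)$ is the smallest leaf label below $v$; the forest is normalized if $\nu(v)=\nu(L(v))$ for all internal $v$; an internal $v$ is Lyndon if $L(v)$ is a leaf or $\nu(R(L(v)))>\nu(R(v))$. A normalized bicolored binary tree is a pointed Lyndon tree if every internal $v$ with internal left child satisfies $\mathrm{color}(L(v))\ge\mathrm{color}(v)$ and, when $\mathrm{color}(L(v))=\mathrm{color}(v)=1$, $v$ is Lyndon; a pointed Lyndon forest has all components pointed Lyndon trees. To $u$-merge two pointed Lyndon trees $T_1,T_2$ (minimum leaf of $T_1$ less than that of $T_2$), create a new vertex $r$ of color $u$ with left child the root of $T_1$ and right child the root of $T_2$; while the result is not a pointed Lyndon tree, slide $r$ past its left child: if $r$ has left child $x$ with subtrees $X_L,X_R$ and right subtree $Y$, replace the subtree $r(x(X_L,X_R),Y)$ by $x(r(X_L,Y),X_R)$ (colors kept). This terminates in a pointed Lyndon tree. $\mathcal{FL}yn_n^\bullet$ is the set of pointed Lyndon forests on $[n]$ with $F\lessdot F'$ iff $F'$ is obtained from $F$ by $u$-merging exactly two of its trees for some $u\in\{0,1\}$. Whitney numbers of a graded poset with $\hat0$: $w_k(P)=\sum_{\rho(x)=k}\mu(\hat0,x)$, $W_k(P)=\#\{x:\rho(x)=k\}$;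 $P,Q$ are Whitney duals if $|w_k(P)|=W_k(Q)$ and $|w_k(Q)|=W_k(P)$ for all $k$. -}

module Defs where

open import Data.Nat using (ℕ; zero; suc; _+_; _⊓_; _≤ᵇ_; _<ᵇ_; _≡ᵇ_)
open import Data.Nat.Properties using (≡⇒≡ᵇ; +-suc; n<1+n)
open import Data.Integer using (ℤ; ∣_∣) renaming (_+_ to _+ℤ_; 0ℤ to 0ℤ; 1ℤ to 1ℤ)
open import Data.Fin using (Fin; toℕ) renaming (_<_ to _<F_; _≤_ to _≤F_; _≟_ to _≟F_)
import Data.Fin as F
open import Data.Bool using (Bool; true; false; T; _∧_; if_then_else_)
open import Data.Bool.Properties using (T-∧)
open import Data.List using (List; []; _∷_; _++_; _∷ʳ_; map; foldr; length; concatMap; allFin; tabulate)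
open import Data.List.Properties using (length-tabulate)
open import Data.List.Membership.Propositional using (_∈_)
open import Data.List.Membership.Propositional.Properties using (∈-allFin)
open import Data.List.Relation.Unary.Any using (here; there)
open import Data.List.Relation.Unary.Unique.Propositional using (Unique)
open import Data.List.Relation.Binary.Permutation.Propositional using (_↭_)
open import Data.Vec using (Vec; lookup) renaming (tabulate to vtabulate)
open import Data.Vec.Properties using (lookup∘tabulate)
open import Data.Maybe using (Maybe; just; nothing) renaming (map to mmap)
open import Data.Product using (Σ; Σ-syntax; _×_; _,_; proj₁; proj₂)
open import Data.Sum using (_⊎_)
open import Relation.Nullary using (¬_)
import Data.Empty
open import Relation.Nullary.Decidable using (isYes; fromWitness)
open import Relation.Binary.PropositionalEquality using (_≡_; _≢_; refl; cong; sym; subst; trans)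
open import Relation.Binary.Construct.Closure.ReflexiveTransitive using (Star)
open import Function using (_∘_; id; _⇔_; Equivalence)

all : ∀ {A : Set} → (A → Bool) → List A → Bool
all p []       = true
all p (x ∷ xs) = p x ∧ all p xs

all-T : ∀ {A : Set} (p : A → Bool) → (∀ x → T (p x)) → ∀ xs → T (all p xs)
all-T p h []       = _
all-T p h (x ∷ xs) = Equivalence.from T-∧ (h x , all-T p h xs)

memB : ∀ {n} → Fin n → List (Fin n) → Bool
memB i []       = false
memB i (j ∷ js) = if isYes (i ≟F j) then true else memB i js

memB-∈ : ∀ {n} (i : Fin n) xs → i ∈ xs → T (memB i xs)
memB-∈ i (j ∷ js) (here refl) with i ≟F i
... | Relation.Nullary.yes _ = _
... | Relation.Nullary.no ¬p = Data.Empty.⊥-elim (¬p refl)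
memB-∈ i (j ∷ js) (there p) with isYes (i ≟F j)
... | true  = _
... | false = memB-∈ i js p

record CoverPoset : Set₁ where
  field
    Carrier : Set
    _⋖_     : Carrier → Carrier → Set
    𝟘       : Carrier

module _ (P : CoverPoset) where
  open CoverPoset P

  Leq : Carrier → Carrier → Set
  Leq = Star _⋖_

  IsGradedBy : (Carrier → ℕ) → Set
  IsGradedBy ρ = (∀ x → Leq 𝟘 x) × (ρ 𝟘 ≡ 0) × (∀ x y → x ⋖ y → ρ y ≡ suc (ρ x))

EnumOf : {A : Set} → (A → Set) → List A → Set
EnumOf {A} Q xs = Unique xs × (∀ x → x ∈ xs → Q x) × (∀ x → Q x → x ∈ xs)

sumℤ : List ℤ → ℤ
sumℤ = foldr _+ℤ_ 0ℤ

module _ (P : CoverPoset) where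
  open CoverPoset P

  IsMobius : (Carrier → ℤ) → Set
  IsMobius μ = (μ 𝟘 ≡ 1ℤ)
    × (∀ x → x ≢ 𝟘 → Σ[ ys ∈ List Carrier ]
         EnumOf (λ y → Leq P 𝟘 y × Leq P y x) ys × (sumℤ (map μ ys) ≡ 0ℤ))

WhitneyDual : CoverPoset → CoverPoset → Set
WhitneyDual P Q =
  Σ[ ρP ∈ (CoverPoset.Carrier P → ℕ) ] Σ[ ρQ ∈ (CoverPoset.Carrier Q → ℕ) ]
  Σ[ μP ∈ (CoverPoset.Carrier P → ℤ) ] Σ[ μQ ∈ (CoverPoset.Carrier Q → ℤ) ]
    IsGradedBy P ρP × IsGradedBy Q ρQ × IsMobius P μP × IsMobius Q μQ
  × (∀ k → Σ[ xs ∈ List (CoverPoset.Carrier P) ] Σ[ ys ∈ List (CoverPoset.Carrier Q) ]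
        EnumOf (λ x → ρP x ≡ k) xs × EnumOf (λ y → ρQ y ≡ k) ys
      × (∣ sumℤ (map μP xs) ∣ ≡ length ys) × (∣ sumℤ (map μQ ys) ∣ ≡ length xs))

-- Generic: the poset R_λ(P) for an edge-labelled poset.
-- X : elements of P, _<L_ : strict order on labels,
-- LC x y ℓ : "x ⋖ y in P and λ(x ⋖ y) = ℓ", 𝟘 : bottom of P.

module RLambda {X L : Set} (_<L_ : L → L → Set) (LC : X → X → L → Set) (𝟘 : X) where

  data AscentFree : List L → Set where
    af-[]  : AscentFree []
    af-[_] : ∀ a → AscentFree (a ∷ [])
    af-∷   : ∀ {a b w} → ¬ (a <L b) → AscentFree (b ∷ w) → AscentFree (a ∷ b ∷ w)

  -- one step of sort: swap at the smallest index i with wᵢ < wᵢ₊₁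
  -- (smallest: the prefix w₁ … wᵢ has no ascent)
  data SortStep : List L → List L → Set where
    swap : ∀ xs a b ys → AscentFree (xs ∷ʳ a) → a <L b →
           SortStep (xs ++ a ∷ b ∷ ys) (xs ++ b ∷ a ∷ ys)

  SortsTo : List L → List L → Set
  SortsTo w u = Star SortStep w u × AscentFree u

  data LChain : X → X → List L → Set where
    []  : ∀ {x} → LChain x x []
    _∷_ : ∀ {x y z ℓ w} → LC x y ℓ → LChain y z w → LChain x z (ℓ ∷ w)

  InR : X × List L → Set
  InR (x , w) = LChain 𝟘 x w × AscentFree w

  RCover : X × List L → X × List L → Set
  RCover (x , w) (y , u) = InR (x , w) × InR (y , u)
    × Σ[ ℓ ∈ L ] (LC x y ℓ × SortsTo (w ∷ʳ ℓ) u)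

  RLeq : X × List L → X × List L → Set
  RLeq = Star RCover

  IsoToR : (F : CoverPoset) → Set
  IsoToR F = Σ[ f ∈ (CoverPoset.Carrier F → X × List L) ]
      (∀ a → InR (f a))
    × (∀ a b → f a ≡ f b → a ≡ b)
    × (∀ p → InR p → Σ[ a ∈ CoverPoset.Carrier F ] f a ≡ p)
    × (∀ a b → (Leq F a b ⇔ RLeq (f a) (f b)))

-- Pointed partitions Π_n^•  (ground set [n] is represented by Fin n).
-- A pointed partition is encoded by the map pt sending each i to the point
-- of its block; pt is idempotent, the blocks are the fibres of pt and the
-- point of block {j | pt j ≡ pt i} is pt i.  This is a bijective encoding.

isIdem : ∀ {n} → Vec (Fin n) n → Bool
isIdem {n} v = all (λ i → isYes (lookup v (lookup v i) ≟F lookup v i)) (allFin n)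

record PointedPartition (n : ℕ) : Set where
  constructor mkPP
  field
    pt   : Vec (Fin n) n
    idem : T (isIdem pt)
open PointedPartition public

-- labels (a , b)^u of Λ_n^• : (a , b , u)
Lab : ℕ → Set
Lab n = Fin n × Fin n × Fin 2

-- order of Λ_n^• = A₁ ⊕ C₁ ⊕ ⋯ ⊕ A_{n-1} ⊕ C_{n-1}
data _<Λ_ {n : ℕ} : Lab n → Lab n → Set where
  lt-fst : ∀ {a b u a' b' u'} → a <F a' → (a , b , u) <Λ (a' , b' , u')
  lt-AC  : ∀ {a b b'} → (a , b , F.zero) <Λ (a , b' , F.suc F.zero)
  lt-C   : ∀ {a b b'} → b <F b' → (a , b , F.suc F.zero) <Λ (a , b' , F.suc F.zero)

IsBlockMin : ∀ {n} → PointedPartition n → Fin n → Set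
IsBlockMin π a = ∀ i → lookup (pt π) i ≡ lookup (pt π) a → a ≤F i

newPt : ∀ {n} → Fin 2 → Fin n → Fin n → Fin n
newPt F.zero       p q = q
newPt (F.suc _)    p q = p

-- π ⋖ π' by a u-merge of the blocks A^p, B^q with min A = a < b = min B;
-- λ•(π ⋖ π') = (a , b)^u
ΠLCover : ∀ {n} → PointedPartition n → PointedPartition n → Lab n → Set
ΠLCover π π' (a , b , u) =
  a <F b × IsBlockMin π a × IsBlockMin π b
  × (∀ i → (lookup (pt π) i ≡ p ⊎ lookup (pt π) i ≡ q → lookup (pt π') i ≡ newPt u p q)
         × (lookup (pt π) i ≢ p → lookup (pt π) i ≢ q → lookup (pt π') i ≡ lookup (pt π) i))
  where
    p = lookup (pt π) a
    q = lookup (pt π) b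

idem-id : ∀ n → T (isIdem {n} (vtabulate id))
idem-id n = all-T _ h (allFin n)
  where
    h : ∀ i → T (isYes (lookup (vtabulate id) (lookup (vtabulate id) i) ≟F lookup (vtabulate id) i))
    h i rewrite lookup∘tabulate {n = n} id i = fromWitness (lookup∘tabulate {n = n} id i)

Π•-bottom : ∀ n → PointedPartition n
Π•-bottom n = mkPP (vtabulate id) (idem-id n)

Π• : ℕ → CoverPoset
Π• n = record
  { Carrier = PointedPartition n
  ; _⋖_     = λ π π' → Σ[ ℓ ∈ Lab n ] ΠLCover π π' ℓ
  ; 𝟘       = Π•-bottom n
  }

data Tree (n : ℕ) : Set where
  leaf : Fin n → Tree n
  node : (color : Fin 2) → (left right : Tree n) → Tree n

ν : ∀ {n} → Tree n → ℕ
ν (leaf i)     = toℕ i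
ν (node _ l r) = ν l ⊓ ν r

leaves : ∀ {n} → Tree n → List (Fin n)
leaves (leaf i)     = i ∷ []
leaves (node _ l r) = leaves l ++ leaves r

isOne : Fin 2 → Bool
isOne F.zero    = false
isOne (F.suc _) = true

-- conditions at an internal vertex v = node c l r involving its left child:
-- color(L v) ≥ color(v), and if both are 1 then v is Lyndon
-- (L v internal here, so Lyndon means ν(R(L v)) > ν(R v))
leftCond : ∀ {n} → Fin 2 → Tree n → Tree n → Bool
leftCond c (leaf _)        r = true
leftCond c (node c' l' r') r =
  (toℕ c ≤ᵇ toℕ c') ∧ (if isOne c ∧ isOne c' then ν r <ᵇ ν r' else true)

-- pointed Lyndon tree (includes: normalized, ν(v) = ν(L v) at every internal v)
isPL : ∀ {n} → Tree n → Bool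
isPL (leaf _)     = true
isPL (node c l r) = (ν (node c l r) ≡ᵇ ν l) ∧ leftCond c l r ∧ isPL l ∧ isPL r

-- trees listed in strictly increasing order of their minimal leaf
-- (canonical representative of the set of trees)
increasingν : ∀ {n} → List (Tree n) → Bool
increasingν []           = true
increasingν (x ∷ [])     = true
increasingν (x ∷ y ∷ ts) = (ν x <ᵇ ν y) ∧ increasingν (y ∷ ts)

leavesBij : ∀ {n} → List (Tree n) → Bool
leavesBij {n} ts = leavesOK (concatMap leaves ts)
  where
    leavesOK : List (Fin n) → Bool
    leavesOK ls = (length ls ≡ᵇ n) ∧ all (λ i → memB i ls) (allFin n)

validForest : ∀ {n} → List (Tree n) → Bool
validForest ts = all isPL ts ∧ increasingν ts ∧ leavesBij ts

record PLForest (n : ℕ) : Set where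
  constructor mkForest
  field
    trees : List (Tree n)
    valid : T (validForest trees)
open PLForest public

-- the tree obtained from r = node u T₁ T₂ after sliding r past its left
-- child k times (nothing if this would slide past a leaf)
insertAt : ∀ {n} → ℕ → Fin 2 → Tree n → Tree n → Maybe (Tree n)
insertAt zero    u t₁           t₂ = just (node u t₁ t₂)
insertAt (suc k) u (leaf _)     t₂ = nothing
insertAt (suc k) u (node c l r) t₂ = mmap (λ l' → node c l' r) (insertAt k u l t₂)

-- the u-merge of T₁ and T₂ is t: slide until a pointed Lyndon tree is reached
MergeTo : ∀ {n} → Fin 2 → Tree n → Tree n → Tree n → Set
MergeTo u t₁ t₂ t = Σ[ k ∈ ℕ ] (insertAt k u t₁ t₂ ≡ just t) × T (isPL t)
  × (∀ j t' → j Data.Nat.< k → insertAt j u t₁ t₂ ≡ just t' → ¬ T (isPL t'))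

FCover : ∀ {n} → PLForest n → PLForest n → Set
FCover {n} F F' = Σ[ t₁ ∈ Tree n ] Σ[ t₂ ∈ Tree n ] Σ[ rest ∈ List (Tree n) ]
  Σ[ u ∈ Fin 2 ] Σ[ t ∈ Tree n ]
    (trees F ↭ t₁ ∷ t₂ ∷ rest) × (ν t₁ Data.Nat.< ν t₂) × MergeTo u t₁ t₂ t
  × (trees F' ↭ t ∷ rest)

private
  concat-leaf : ∀ {n} (xs : List (Fin n)) → concatMap leaves (map leaf xs) ≡ xs
  concat-leaf []       = refl
  concat-leaf (x ∷ xs) = cong (x ∷_) (concat-leaf xs)

  allPL-leaf : ∀ {n} (xs : List (Fin n)) → T (all isPL (map leaf xs))
  allPL-leaf []       = _
  allPL-leaf (x ∷ xs) = allPL-leaf xs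

  <ᵇ-suc : ∀ c → T (c <ᵇ suc c)
  <ᵇ-suc zero    = _
  <ᵇ-suc (suc c) = <ᵇ-suc c

  <ᵇ-c : ∀ c → T (c + 0 <ᵇ c + 1)
  <ᵇ-c zero    = _
  <ᵇ-c (suc c) = <ᵇ-c c

  inc-tab : ∀ {m} k c (g : Fin k → Fin m) → (∀ i → toℕ (g i) ≡ c + toℕ i) →
            T (increasingν (map leaf (tabulate g)))
  inc-tab zero          c g h = _
  inc-tab (suc zero)    c g h = _
  inc-tab (suc (suc k)) c g h = Equivalence.from T-∧ (lt ,
      inc-tab (suc k) (suc c) (g ∘ F.suc) (λ i → trans (h (F.suc i)) (+-suc c (toℕ i))))
    where
      lt : T (toℕ (g F.zero) <ᵇ toℕ (g (F.suc F.zero)))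
      lt rewrite h F.zero | h (F.suc F.zero) = <ᵇ-c c

  map-tab : ∀ {A B : Set} {k} (f : A → B) (g : Fin k → A) → map f (tabulate g) ≡ tabulate (f ∘ g)
  map-tab {k = zero}  f g = refl
  map-tab {k = suc k} f g = cong (f (g F.zero) ∷_) (map-tab f (g ∘ F.suc))

  bottom-valid : ∀ n → T (validForest (map leaf (allFin n)))
  bottom-valid n = Equivalence.from T-∧ (allPL-leaf (allFin n) , Equivalence.from T-∧
    (inc-tab n 0 id (λ i → refl) , Equivalence.from T-∧ (len , mem)))
    where
      eq : concatMap leaves (map leaf (allFin n)) ≡ allFin n
      eq = concat-leaf (allFin n)
      len : T (length (concatMap leaves (map leaf (allFin n))) ≡ᵇ n)
      len = subst (λ ls → T (length ls ≡ᵇ n)) (sym eq) (≡⇒≡ᵇ (length (allFin n)) n (length-tabulate {n = n} id))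
      memP : List (Fin n) → Set
      memP ls = T (all (λ i → memB i ls) (allFin n))
      each : ∀ i → T (memB i (allFin n))
      each i = memB-∈ i (allFin n) (∈-allFin i)
      mem0 : memP (allFin n)
      mem0 = all-T (λ i → memB i (allFin n)) each (allFin n)
      mem : memP (concatMap leaves (map leaf (allFin n)))
      mem = subst memP (sym eq) mem0

FLyn-bottom : ∀ n → PLForest n
FLyn-bottom n = mkForest (map leaf (allFin n)) (bottom-valid n)

FLyn• : ℕ → CoverPoset
FLyn• n = record
  { Carrier = PLForest n
  ; _⋖_     = FCover
  ; 𝟘       = FLyn-bottom n
  }

module RΠ (n : ℕ) = RLambda (_<Λ_ {n}) (ΠLCover {n}) (Π•-bottom n)

{-# OPTIONS --safe #-}
-- A word over Λ is valid if a < b in each of its letters (a , b)ᵘ, the targets b are distinct and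
-- the word has no ascent; these are exactly the label words of the ascent-free chains from 𝟘.
-- Reading a valid word as a sequence of merges produces both a pointed partition and a pointed
-- Lyndon forest.  The word of a forest is recovered from its end, since the last letter is the
-- root of the non-leaf tree with least minimum.  Sorting w ℓ and sliding a new root down a left
-- spine both insert ℓ in the same place, whence the isomorphism with R.
--
-- μ(𝟘 , x) for Π• is the sum of (-1)^|w| over the valid words w with image x.  Over the words with
-- image below x this cancels by toggling a suitable last letter.  In the forest poset the interval
-- below a forest consists of the order ideals of a poset of letters, so μ(𝟘 , F) is ±1 when the
-- letters of F form an antichain (F is then a forest of combs) and 0 otherwise.  Such forests
-- correspond bijectively to pointed partitions.
module Submission where

open import Defs
open import Data.Nat using (ℕ; zero; suc; _+_; _*_; _⊓_; _≤_; _<_; z≤n; s≤s; _<?_; _≤?_; _<ᵇ_; _≡ᵇ_)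
import Data.Nat.Properties
module ℕP = Data.Nat.Properties
open import Data.Integer using (ℤ; +_; -_; ∣_∣; 0ℤ; 1ℤ) renaming (_+_ to _+ℤ_; _*_ to _*ℤ_)
import Data.Integer.Properties
module ℤP = Data.Integer.Properties
open import Data.Fin using (Fin; toℕ; combine) renaming (zero to fz; suc to fs; _<_ to _<F_; _≤_ to _≤F_; _≟_ to _≟F_)
import Data.Fin.Properties
module FP = Data.Fin.Properties
open import Data.Bool using (Bool; T; if_then_else_)
open import Data.Bool.Properties using (T-∧; T-irrelevant)
open import Data.List using (List; []; _∷_; _++_; _∷ʳ_; map; foldl; filter; length; concatMap; allFin; cartesianProductWith; cartesianProduct; deduplicate; upTo)
open import Data.List.Properties using (length-tabulate; length-map; map-++; map-∘; foldl-∷ʳ; ++-assoc; ∷-injective; ∷-injectiveʳ; ∷ʳ-injective; length-filter; filter-none)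
open import Data.List.Reverse using (Reverse; reverseView; []; _∶_∶ʳ_)
open import Data.List.Membership.Propositional using (_∈_; _∉_)
open import Data.List.Membership.Propositional.Properties using (∈-allFin; ∈-map⁺; ∈-map⁻; ∈-++⁺ˡ; ∈-++⁺ʳ; ∈-++⁻; ∈-∃++; ∈-filter⁺; ∈-filter⁻; ∈-cartesianProductWith⁺; ∈-cartesianProductWith⁻; ∈-cartesianProduct⁺; ∈-deduplicate⁺; ∈-deduplicate⁻; ∈-upTo⁺)
open import Data.List.Membership.Propositional.Properties.WithK using (unique∧set⇒bag)
open import Data.List.Relation.Unary.Any using (here; there; any?)
open import Data.List.Relation.Unary.All using (All; []; _∷_; all?) renaming (lookup to all-lookup; tabulate to all-tabulate; map to all-map)
open import Data.List.Relation.Unary.All.Properties using (¬Any⇒All¬; All¬⇒¬Any) renaming (++⁻ˡ to All-++⁻ˡ; ∷ʳ⁻ to All-∷ʳ⁻; ∷ʳ⁺ to All-∷ʳ⁺; map⁺ to All-map⁺)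
open import Data.List.Relation.Unary.AllPairs using (AllPairs; []; _∷_; allPairs?) renaming (map to allPairs-map; zipWith to allPairs-zipWith)
import Data.List.Relation.Unary.AllPairs.Properties
module AP = Data.List.Relation.Unary.AllPairs.Properties
open import Data.List.Relation.Unary.Unique.Propositional using (Unique)
import Data.List.Relation.Unary.Unique.Propositional.Properties
module UP = Data.List.Relation.Unary.Unique.Propositional.Properties
open import Data.List.Relation.Unary.Unique.DecPropositional.Properties using (deduplicate-!)
open import Data.List.Relation.Binary.BagAndSetEquality using (∼bag⇒↭)
open import Data.List.Relation.Binary.Permutation.Propositional using (_↭_; ↭-refl; ↭-sym; ↭-trans; ↭-prep; ↭-reflexive; ↭-swap)
import Data.List.Relation.Binary.Permutation.Propositional
module PP = Data.List.Relation.Binary.Permutation.Propositional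
open import Data.List.Relation.Binary.Permutation.Propositional.Properties using (∈-resp-↭; All-resp-↭; ↭-length; drop-∷; shift; ↭-empty-inv; ↭-singleton-inv) renaming (map⁺ to ↭-map⁺; ++⁺ to ↭-++⁺; ++-comm to ↭-++-comm)
open import Data.List.Relation.Binary.Permutation.Setoid.Properties using () renaming (Unique-resp-↭ to Unique-resp-↭ₛ)
open import Data.Vec using (lookup) renaming (tabulate to vtabulate)
open import Data.Vec.Properties using (lookup∘tabulate; tabulate∘lookup; tabulate-cong) renaming (≡-dec to Vec-≡-dec)
open import Data.Maybe using (just) renaming (map to mmap)
open import Data.Maybe.Properties using (just-injective)
open import Data.Product using (Σ-syntax; ∃; _×_; _,_; proj₁; proj₂)
open import Data.Product.Properties using () renaming (≡-dec to ×-≡-dec)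
open import Data.Sum using (_⊎_; inj₁; inj₂; [_,_]′)
open import Data.Empty using (⊥-elim)
open import Data.Unit using (tt)
open import Relation.Nullary using (¬_; Dec; yes; no; does)
open import Relation.Nullary.Decidable using (isYes; map′; _×-dec_; ¬?; toWitness; fromWitness) renaming (_→-dec_ to _→?_)
open import Relation.Binary using (tri<; tri≈; tri>; DecidableEquality)
open import Relation.Binary.PropositionalEquality using (_≡_; _≢_; refl; cong; cong₂; sym; subst; trans; setoid)
open import Relation.Binary.Construct.Closure.ReflexiveTransitive using (Star; ε; _◅_; _◅◅_; gmap)
open import Algebra.Properties.CommutativeSemigroup Data.Integer.Properties.+-commutativeSemigroup using (interchange)
open import Function using (_∘_; id; _⇔_; Equivalence; mk⇔)
open Equivalence using (to; from)

-- An element `(x , w)` of R is determined by `w`, so both posets can be moved to words. This works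
-- because incomparability in Λ is transitive: an ascent-free word decreases weakly throughout, not
-- only between neighbours, and a new letter has one well-defined place. An ascent is a pair of
-- commuting merges: either the blocks involved are disjoint, or the larger label is a 1-merge,
-- which leaves the point of the left block alone. Hence sorting does not change the resulting
-- partition. On the tree side, the condition at a vertex with internal left child says exactly that
-- the labels of the left child and of the vertex do not form an ascent. Ties are the delicate case.
-- Labels of one antichain have equal keys, yet their merges do not commute, since the last 0-merge
-- decides the point. Independence of letters therefore demands different keys, and a comb has at
-- most one 0-letter for each source.

-- Lists up to permutation

set-↭ : {A : Set} {xs ys : List A} → Unique xs → Unique ys → (∀ {z} → z ∈ xs → z ∈ ys) →
    (∀ {z} → z ∈ ys → z ∈ xs) → xs ↭ ys
set-↭ ux uy f g = ∼bag⇒↭ (unique∧set⇒bag ux uy (mk⇔ f g))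

Unique-resp-↭ : {A : Set} {xs ys : List A} → xs ↭ ys → Unique xs → Unique ys
Unique-resp-↭ {A} p = Unique-resp-↭ₛ (setoid A) (PP.↭⇒↭ₛ p)

Unique-map : {A B : Set} {f : A → B} {xs : List A} → (∀ {x y} → x ∈ xs → y ∈ xs → f x ≡ f y → x ≡ y) →
             Unique xs → Unique (map f xs)
Unique-map inj [] = []
Unique-map {f = f} inj (x∉ ∷ u) =
  All-map⁺ (all-tabulate (λ y∈ fx≡fy → all-lookup x∉ y∈ (inj (here refl) (there y∈) fx≡fy)))
  ∷ Unique-map (λ p q → inj (there p) (there q)) u

AllPairs-∷ʳ⁻ : {A : Set} {R : A → A → Set} {y : A} → ∀ xs → AllPairs R (xs ∷ʳ y) → AllPairs R xs × All (λ x → R x y) xs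
AllPairs-∷ʳ⁻ [] _ = [] , []
AllPairs-∷ʳ⁻ (x ∷ xs) (r ∷ rs) with AllPairs-∷ʳ⁻ xs rs | All-∷ʳ⁻ r
... | p , q | r₁ , r₂ = (r₁ ∷ p) , (r₂ ∷ q)

AllPairs-∷ʳ⁺ : {A : Set} {R : A → A → Set} {y : A} {xs : List A} → AllPairs R xs → All (λ x → R x y) xs →
    AllPairs R (xs ∷ʳ y)
AllPairs-∷ʳ⁺ p q = AP.++⁺ p ([] ∷ []) (all-map (λ r → r ∷ []) q)

∈-∷ʳ⁻ : {A : Set} {y z : A} → ∀ xs → z ∈ xs ∷ʳ y → z ∈ xs ⊎ z ≡ y
∈-∷ʳ⁻ xs z∈ with ∈-++⁻ xs z∈
... | inj₁ p = inj₁ p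
... | inj₂ (here e) = inj₂ e

∈-∷ʳ⁺ʳ : {A : Set} {y : A} → ∀ xs → y ∈ xs ∷ʳ y
∈-∷ʳ⁺ʳ xs = ∈-++⁺ʳ xs (here refl)

-- Labels and the weak order on them

Word : ℕ → Set
Word n = List (Lab n)

fst snd : ∀ {n} → Lab n → Fin n
fst (a , _ , _) = a
snd (_ , b , _) = b

col : ∀ {n} → Lab n → Fin 2
col (_ , _ , u) = u

fsts snds : ∀ {n} → Word n → List (Fin n)
fsts = map fst
snds = map snd

_≟L_ : ∀ {n} → DecidableEquality (Lab n)
_≟L_ = ×-≡-dec _≟F_ (×-≡-dec _≟F_ _≟F_)

-- All labels of the antichain A_a share the value `fz`; the shift by `fs` puts the chain C_a
-- strictly above it.
subkey : ∀ {n} → Fin n → Fin 2 → Fin (suc n)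
subkey b fz     = fz
subkey b (fs _) = fs b

-- The order Λ is a strict weak order, given by x <Λ y iff key x < key y.
key : ∀ {n} → Lab n → ℕ
key (a , b , u) = toℕ (combine a (subkey b u))

combine-monoʳ-< : ∀ {m n} (i : Fin m) {j k : Fin n} → j <F k → combine i j <F combine i k
combine-monoʳ-< {m} {n} i {j} {k} j<k rewrite FP.toℕ-combine i j | FP.toℕ-combine i k = ℕP.+-monoʳ-< (n * toℕ i) j<k

<Λ⇒key< : ∀ {n} {x y : Lab n} → x <Λ y → key x < key y
<Λ⇒key< (lt-fst {b = b} {u = u} {b' = b'} {u' = u'} p) = FP.combine-monoˡ-< (subkey b u) (subkey b' u') p
<Λ⇒key< (lt-AC {a = a}) = combine-monoʳ-< a (s≤s z≤n)
<Λ⇒key< (lt-C {a = a} p) = combine-monoʳ-< a (s≤s p)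

key≤⇒fst≤ : ∀ {n} (x y : Lab n) → key x ≤ key y → fst x ≤F fst y
key≤⇒fst≤ (a , b , u) (a' , b' , u') le = ℕP.≮⇒≥ (λ p → ℕP.<⇒≱ (FP.combine-monoˡ-< (subkey b' u') (subkey b u) p) le)

key<⇒<Λ : ∀ {n} {x y : Lab n} → key x < key y → x <Λ y
key<⇒<Λ {x = x@(a , b , u)} {y@(a' , b' , u')} lt with FP.<-cmp a a'
... | tri< p _ _ = lt-fst p
... | tri> _ _ p = ⊥-elim (ℕP.<-asym lt (FP.combine-monoˡ-< (subkey b' u') (subkey b u) p))
key<⇒<Λ {x = a , b , fz} {_ , b' , fz} lt | tri≈ _ refl _ = ⊥-elim (ℕP.<-irrefl refl lt)
key<⇒<Λ {x = a , b , fz} {_ , b' , fs fz} lt | tri≈ _ refl _ = lt-AC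
key<⇒<Λ {x = a , b , fs fz} {_ , b' , fz} lt | tri≈ _ refl _ = ⊥-elim (ℕP.<-asym lt (combine-monoʳ-< a (s≤s z≤n)))
key<⇒<Λ {x = a , b , fs fz} {_ , b' , fs fz} lt | tri≈ _ refl _ with FP.<-cmp b b'
... | tri< p _ _ = lt-C p
... | tri≈ _ refl _ = ⊥-elim (ℕP.<-irrefl refl lt)
... | tri> _ _ p = ⊥-elim (ℕP.<-asym lt (combine-monoʳ-< a (s≤s p)))

-- The second alternative is a pair from one antichain A_a, whose labels the key cannot tell apart.
key-injective : ∀ {n} (x y : Lab n) → key x ≡ key y → x ≡ y ⊎ (fst x ≡ fst y × col x ≡ fz × col y ≡ fz)
key-injective (a , b , u) (a' , b' , u') e with FP.combine-injective a (subkey b u) a' (subkey b' u')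
    (FP.toℕ-injective e)
key-injective (a , b , fz) (a' , b' , fz) e | refl , _ = inj₂ (refl , refl , refl)
key-injective (a , b , fs fz) (a' , b' , fs fz) e | refl , refl = inj₁ refl

_≥Λ_ : ∀ {n} → Lab n → Lab n → Set
x ≥Λ y = key y ≤ key x

_<Λ?_ : ∀ {n} (x y : Lab n) → Dec (x <Λ y)
x <Λ? y = map′ key<⇒<Λ <Λ⇒key< (key x <? key y)

≮Λ⇒≥Λ : ∀ {n} {x y : Lab n} → ¬ (x <Λ y) → x ≥Λ y
≮Λ⇒≥Λ x≮y = ℕP.≮⇒≥ (x≮y ∘ key<⇒<Λ)

≥Λ⇒≮Λ : ∀ {n} {x y : Lab n} → x ≥Λ y → ¬ (x <Λ y)
≥Λ⇒≮Λ le lt = ℕP.<⇒≱ (<Λ⇒key< lt) le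

-- Descending words, and sorting as insertion

Desc : ∀ {n} → Word n → Set
Desc = AllPairs _≥Λ_

-- Not being below is a comparison of keys and hence transitive, so the condition on neighbours
-- spreads to all pairs.
AscentFree⇒Desc : ∀ {n} {w : Word n} → RΠ.AscentFree n w → Desc w
AscentFree⇒Desc RΠ.af-[] = []
AscentFree⇒Desc RΠ.af-[ a ] = [] ∷ []
AscentFree⇒Desc (RΠ.af-∷ a≮b p) with AscentFree⇒Desc p
... | q ∷ qs = (≮Λ⇒≥Λ a≮b ∷ all-map (λ le → ℕP.≤-trans le (≮Λ⇒≥Λ a≮b)) q) ∷ q ∷ qs

Desc⇒AscentFree : ∀ {n} {w : Word n} → Desc w → RΠ.AscentFree n w
Desc⇒AscentFree [] = RΠ.af-[]
Desc⇒AscentFree ([] ∷ []) = RΠ.af-[ _ ]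
Desc⇒AscentFree ((r ∷ _) ∷ ps@(_ ∷ _)) = RΠ.af-∷ (≥Λ⇒≮Λ r) (Desc⇒AscentFree ps)

-- In a descending word `ℓ` goes directly before the letters below it. A letter with the key of `ℓ`
-- stays to its left, because sorting never swaps incomparable letters.
data Ins {n} (ℓ : Lab n) : Word n → Word n → Set where
  here  : ∀ {v} → All (_<Λ ℓ) v → Ins ℓ v (ℓ ∷ v)
  there : ∀ {x v v'} → ¬ (x <Λ ℓ) → Ins ℓ v v' → Ins ℓ (x ∷ v) (x ∷ v')

insertion : ∀ {n} (ℓ : Lab n) {w} → Desc w → ∃ λ w' → Ins ℓ w w'
insertion ℓ [] = ℓ ∷ [] , here []
insertion ℓ {x ∷ w} (p ∷ ps) with x <Λ? ℓ
... | yes x<ℓ = ℓ ∷ x ∷ w , here (x<ℓ ∷ all-map (λ le → key<⇒<Λ (ℕP.≤-<-trans le (<Λ⇒key< x<ℓ))) p)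
... | no x≮ℓ with insertion ℓ ps
...   | w' , i = x ∷ w' , there x≮ℓ i

Ins-↭ : ∀ {n} {ℓ : Lab n} {w w'} → Ins ℓ w w' → w' ↭ ℓ ∷ w
Ins-↭ (here _) = ↭-refl
Ins-↭ (there _ i) = ↭-trans (↭-prep _ (Ins-↭ i)) (↭-swap _ _ ↭-refl)

Ins-Desc : ∀ {n} {ℓ : Lab n} {w w'} → Ins ℓ w w' → Desc w → Desc w'
Ins-Desc (here p) d = all-map (ℕP.<⇒≤ ∘ <Λ⇒key<) p ∷ d
Ins-Desc (there x≮ℓ i) (p ∷ d) = All-resp-↭ (↭-sym (Ins-↭ i)) (≮Λ⇒≥Λ x≮ℓ ∷ p) ∷ Ins-Desc i d

Ins-∷ʳ : ∀ {n} {ℓ : Lab n} {w} → Desc (w ∷ʳ ℓ) → Ins ℓ w (w ∷ʳ ℓ)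
Ins-∷ʳ {w = []} _ = here []
Ins-∷ʳ {w = x ∷ w} (p ∷ d) = there (≥Λ⇒≮Λ (proj₂ (All-∷ʳ⁻ p))) (Ins-∷ʳ d)

Desc-++⁻ˡ : ∀ {n} (xs : Word n) {ys} → Desc (xs ++ ys) → Desc xs
Desc-++⁻ˡ [] d = []
Desc-++⁻ˡ (x ∷ xs) (p ∷ d) = All-++⁻ˡ xs p ∷ Desc-++⁻ˡ xs d

-- The letter `ℓ` bubbles from the end to the left. The prefix `xs` is carried along because a sort
-- step requires everything to the left of its ascent to be ascent-free.
Ins⇒sorts : ∀ {n} {ℓ : Lab n} xs {v v'} → Desc (xs ++ v) → Ins ℓ v v' → Star (RΠ.SortStep n) (xs ++ v ∷ʳ ℓ) (xs ++ v')
Ins⇒sorts xs d (here []) = ε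
Ins⇒sorts {n} {ℓ} xs {y ∷ v} d (here (y<ℓ ∷ p)) =
  subst (λ z → Star (RΠ.SortStep n) z (xs ++ y ∷ ℓ ∷ v)) (++-assoc xs (y ∷ []) (v ∷ʳ ℓ))
    (subst (Star (RΠ.SortStep n) ((xs ∷ʳ y) ++ v ∷ʳ ℓ)) (++-assoc xs (y ∷ []) (ℓ ∷ v))
      (Ins⇒sorts (xs ∷ʳ y) d' (here p)))
  ◅◅ (RΠ.swap xs y ℓ v (Desc⇒AscentFree (Desc-++⁻ˡ (xs ∷ʳ y) d')) y<ℓ ◅ ε)
  where d' = subst Desc (sym (++-assoc xs (y ∷ []) v)) d
Ins⇒sorts {n} {ℓ} xs d (there {x} {v} {v'} _ i) =
  subst (λ z → Star (RΠ.SortStep n) z (xs ++ x ∷ v')) (++-assoc xs (x ∷ []) (v ∷ʳ ℓ))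
    (subst (Star (RΠ.SortStep n) ((xs ∷ʳ x) ++ v ∷ʳ ℓ)) (++-assoc xs (x ∷ []) v')
      (Ins⇒sorts (xs ∷ʳ x) (subst Desc (sym (++-assoc xs (x ∷ []) v)) d) i))

-- An ascent of v₁ ++ ℓ ∷ v₂ can only sit right before ℓ.
locate : ∀ {n} {ℓ : Lab n} v₁ {v₂} xs {a b ys} → Desc (v₁ ++ v₂) → All (_<Λ ℓ) v₂ → a <Λ b →
         v₁ ++ ℓ ∷ v₂ ≡ xs ++ a ∷ b ∷ ys → v₁ ≡ xs ∷ʳ a × ℓ ≡ b × v₂ ≡ ys
locate [] [] d (y<ℓ ∷ _) a<b refl = ⊥-elim (ℕP.<-asym (<Λ⇒key< y<ℓ) (<Λ⇒key< a<b))
locate [] (x ∷ xs) {a} {b} {ys} d p a<b refl = ⊥-elim (no-ascent xs d)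
  where
  no-ascent : ∀ xs → ¬ Desc (xs ++ a ∷ b ∷ ys)
  no-ascent [] ((r ∷ _) ∷ _) = ≥Λ⇒≮Λ r a<b
  no-ascent (_ ∷ xs) (_ ∷ d) = no-ascent xs d
locate (x ∷ []) [] d p a<b refl = refl , refl , refl
locate (x ∷ x' ∷ v₁) [] ((r ∷ _) ∷ _) p a<b refl = ⊥-elim (≥Λ⇒≮Λ r a<b)
locate (x ∷ v₁) (x' ∷ xs) (_ ∷ d) p a<b e with ∷-injective e
... | refl , e' with locate v₁ xs d p a<b e'
...   | refl , refl , refl = refl , refl , refl

-- Invariant of sorting: the other letters descend, and those behind `ℓ` are below it. By `locate` a
-- step can only move `ℓ` one place to the left; when no ascent is left, nothing in `v₁` is below
-- `ℓ`.
sorts⇒Ins′ : ∀ {n} {ℓ : Lab n} v₁ {v₂ z u} → Desc (v₁ ++ v₂) → All (_<Λ ℓ) v₂ → z ≡ v₁ ++ ℓ ∷ v₂ →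
             Star (RΠ.SortStep n) z u → RΠ.AscentFree n u → Ins ℓ (v₁ ++ v₂) u
sorts⇒Ins′ v₁ {v₂} d p refl ε af = prefix v₁ (AscentFree⇒Desc af)
  where
  prefix : ∀ v₁ → Desc (v₁ ++ _ ∷ v₂) → Ins _ (v₁ ++ v₂) (v₁ ++ _ ∷ v₂)
  prefix [] _ = here p
  prefix (x ∷ v₁) (q ∷ d) = there (≥Λ⇒≮Λ (all-lookup q (∈-++⁺ʳ v₁ (here refl)))) (prefix v₁ d)
sorts⇒Ins′ {ℓ = ℓ} v₁ {v₂} {u = u} d p e (st ◅ sts) af = step _ v₁ d e st sts
  where
  step : ∀ {y} z v₁ → Desc (v₁ ++ v₂) → z ≡ v₁ ++ ℓ ∷ v₂ → RΠ.SortStep _ z y → Star (RΠ.SortStep _) y u →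
      Ins ℓ (v₁ ++ v₂) u
  step z v₁ d e (RΠ.swap xs a b ys _ a<b) sts with locate v₁ xs d p a<b (sym e)
  ... | refl , refl , refl = subst (λ v → Ins ℓ v u) (sym (++-assoc xs (a ∷ []) v₂))
        (sorts⇒Ins′ xs (subst Desc (++-assoc xs (a ∷ []) v₂) d) (a<b ∷ p) refl sts af)

sorts⇒Ins : ∀ {n} {ℓ : Lab n} {w u} → Desc w → RΠ.SortsTo n (w ∷ʳ ℓ) u → Ins ℓ w u
sorts⇒Ins {w = w} d (sts , af) = subst (λ v → Ins _ v _) (++-identityʳ w)
  (sorts⇒Ins′ w (subst Desc (sym (++-identityʳ w)) d) [] refl sts af)
  where open import Data.List.Properties using (++-identityʳ)

-- Valid words

record Valid {n} (w : Word n) : Set where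
  constructor mkValid
  field
    proper : All (λ ℓ → fst ℓ <F snd ℓ) w
    unique : Unique (snds w)
    desc   : Desc w
open Valid

valid? : ∀ {n} (w : Word n) → Dec (Valid w)
valid? w = map′ (λ (p , u , d) → mkValid p u d) (λ (mkValid p u d) → p , u , d)
  (all? (λ ℓ → fst ℓ FP.<? snd ℓ) w ×-dec (allPairs? (λ a b →
      ¬? (a ≟F b)) (snds w) ×-dec allPairs? (λ x y → key y ≤? key x) w))

-- An element ceases to be the minimum of its block exactly when it becomes a target, so this says
-- that `a` and `b` are current block minima; see `Fresh⇔Mergeable`.
Fresh : ∀ {n} → Lab n → Word n → Set
Fresh (a , b , _) w = a <F b × a ∉ snds w × b ∉ snds w

-- The common form to which the covers of R and those of the forest poset are both reduced.
WCover : ∀ {n} → Word n → Word n → Set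
WCover {n} w w' = Σ[ ℓ ∈ Lab n ] (Valid w × Fresh ℓ w × Ins ℓ w w')

Ins-Valid : ∀ {n} {ℓ : Lab n} {w w'} → Valid w → Fresh ℓ w → Ins ℓ w w' → Valid w'
Ins-Valid (mkValid p u d) (a<b , _ , b∉) i = mkValid
  (All-resp-↭ (↭-sym (Ins-↭ i)) (a<b ∷ p))
  (Unique-resp-↭ (↭-sym (↭-map⁺ snd (Ins-↭ i))) (¬Any⇒All¬ _ b∉ ∷ u))
  (Ins-Desc i d)

Valid-[] : ∀ {n} → Valid {n} []
Valid-[] = mkValid [] [] []

Valid-∷⁻ : ∀ {n} {x : Lab n} {w} → Valid (x ∷ w) → Valid w
Valid-∷⁻ (mkValid (_ ∷ p) (_ ∷ u) (_ ∷ d)) = mkValid p u d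

-- The last source is not an earlier target: a target exceeds its own source, and that source is at
-- least the last one because sources decrease weakly.
Valid-∷ʳ⁻ : ∀ {n} (w : Word n) {x} → Valid (w ∷ʳ x) → Valid w × Fresh x w × All (_≥Λ x) w
Valid-∷ʳ⁻ w {x} (mkValid p u d) with All-∷ʳ⁻ p | AllPairs-∷ʳ⁻ (snds w) (subst Unique (map-++ snd w
    (x ∷ [])) u) | AllPairs-∷ʳ⁻ w d
... | p₁ , a<b | u₁ , b∉ | d₁ , ge = mkValid p₁ u₁ d₁ , (a<b , a∉ , λ b∈ → all-lookup b∉ b∈ refl) , ge
  where
  a∉ : fst x ∉ snds w
  a∉ a∈ with ∈-map⁻ snd a∈
  ... | y , y∈ , e = ℕP.<⇒≱ (subst (fst y <F_) (sym e) (all-lookup p₁ y∈)) (key≤⇒fst≤ x y (all-lookup ge y∈))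

Valid-∷ʳ⁺ : ∀ {n} {w : Word n} {x} → Valid w → Fresh x w → All (_≥Λ x) w → Valid (w ∷ʳ x)
Valid-∷ʳ⁺ {w = w} {x} v@(mkValid p u d) fr ge = Ins-Valid v fr (Ins-∷ʳ (AllPairs-∷ʳ⁺ d ge))

-- The sources of a valid word decrease weakly.
fst∉snds : ∀ {n} {x : Lab n} {w} → Valid (x ∷ w) → All (λ y → fst y ≢ snd x × snd y ≢ snd x) w
fst∉snds {x = x} {w} (mkValid (a<b ∷ p) (b∉ ∷ u) (ge ∷ d)) = all-tabulate λ {y} y∈ →
  (λ e → ℕP.<⇒≱ a<b (subst (_≤F fst x) e (key≤⇒fst≤ y x (all-lookup ge y∈)))) ,
  (λ e → all-lookup b∉ (∈-map⁺ snd y∈) (sym e))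

-- Pointed partitions and merges

all-T⁻ : {A : Set} (p : A → Bool) {x : A} → ∀ xs → T (all p xs) → x ∈ xs → T (p x)
all-T⁻ p (x ∷ xs) t (here refl) = proj₁ (to T-∧ t)
all-T⁻ p (y ∷ xs) t (there x∈) = all-T⁻ p xs (proj₂ (to (T-∧ {p y}) t)) x∈

infixl 9 _!_
_!_ : ∀ {n} → PointedPartition n → Fin n → Fin n
π ! i = lookup (pt π) i

!-idem : ∀ {n} (π : PointedPartition n) i → π ! (π ! i) ≡ π ! i
!-idem π i = toWitness (all-T⁻ (λ i → isYes (π ! (π ! i) ≟F π ! i)) (allFin _) (idem π) (∈-allFin i))

PP-ext : ∀ {n} {π π' : PointedPartition n} → (∀ i → π ! i ≡ π' ! i) → π ≡ π'
PP-ext {π = mkPP v h} {mkPP v' h'} e with trans (sym (tabulate∘lookup v)) (trans (tabulate-cong e) (tabulate∘lookup v'))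
... | refl = cong (mkPP v) (T-irrelevant h h')

fromIdem : ∀ {n} (f : Fin n → Fin n) → (∀ i → f (f i) ≡ f i) → PointedPartition n
fromIdem {n} f h = mkPP (vtabulate f) (all-T _ idem′ (allFin n))
  where
  idem′ : ∀ i → T (isYes (lookup (vtabulate f) (lookup (vtabulate f) i) ≟F lookup (vtabulate f) i))
  idem′ i rewrite lookup∘tabulate f i | lookup∘tabulate f (f i) = fromWitness (h i)

fromIdem-! : ∀ {n} (f : Fin n → Fin n) h i → fromIdem f h ! i ≡ f i
fromIdem-! f h i = lookup∘tabulate f i

𝟘-! : ∀ {n} i → Π•-bottom n ! i ≡ i
𝟘-! i = lookup∘tabulate id i

_≟Π_ : ∀ {n} → DecidableEquality (PointedPartition n)
π ≟Π π' = map′ (λ e → PP-ext (λ i → cong (λ v → lookup v i) e)) (cong pt) (Vec-≡-dec _≟F_ (pt π) (pt π'))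

Hit : ∀ {n} → Fin n → Fin n → Fin n → Set
Hit p q i = i ≡ p ⊎ i ≡ q

hit? : ∀ {n} (p q i : Fin n) → Dec (Hit p q i)
hit? p q i with i ≟F p | i ≟F q
... | yes e | _ = yes (inj₁ e)
... | no _ | yes e = yes (inj₂ e)
... | no p≢ | no q≢ = no [ p≢ , q≢ ]′

newPt-hit : ∀ {n} u (p q : Fin n) → Hit p q (newPt u p q)
newPt-hit fz p q = inj₂ refl
newPt-hit (fs _) p q = inj₁ refl

abstract
  relabel : ∀ {n} → Fin 2 → Fin n → Fin n → Fin n → Fin n
  relabel u p q i = if does (hit? p q i) then newPt u p q else i

  relabel-hit : ∀ {n} u {p q i : Fin n} → Hit p q i → relabel u p q i ≡ newPt u p q
  relabel-hit u {p} {q} {i} h with hit? p q i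
  ... | yes _ = refl
  ... | no ¬h = ⊥-elim (¬h h)

  relabel-miss : ∀ {n} u {p q i : Fin n} → ¬ Hit p q i → relabel u p q i ≡ i
  relabel-miss u {p} {q} {i} ¬h with hit? p q i
  ... | yes h = ⊥-elim (¬h h)
  ... | no _ = refl

  -- The new point is itself `p` or `q`, so an element that is neither is never identified with one
  -- that is.
  relabel-fibre : ∀ {n} u {p q i j : Fin n} → relabel u p q i ≡ relabel u p q j → i ≡ j ⊎ (Hit p q i × Hit p q j)
  relabel-fibre u {p} {q} {i} {j} e with hit? p q i | hit? p q j
  ... | yes h | yes h' = inj₂ (h , h')
  ... | yes h | no ¬h = ⊥-elim (¬h (subst (Hit p q) e (newPt-hit u p q)))
  ... | no ¬h | yes h = ⊥-elim (¬h (subst (Hit p q) (sym e) (newPt-hit u p q)))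
  ... | no _ | no _ = inj₁ e

module _ {n : ℕ} (π : PointedPartition n) (a b : Fin n) (u : Fin 2) where
  private
    p = π ! a
    q = π ! b
    f : Fin n → Fin n
    f i = relabel u p q (π ! i)

    hit-fix : ∀ {i} → Hit p q i → π ! i ≡ i
    hit-fix (inj₁ refl) = !-idem π a
    hit-fix (inj₂ refl) = !-idem π b

    f-idem : ∀ i → f (f i) ≡ f i
    f-idem i with hit? p q (π ! i)
    ... | yes h = trans (cong f (relabel-hit u h)) (trans (cong (relabel u p q) (hit-fix (newPt-hit u p q)))
                    (trans (relabel-hit u (newPt-hit u p q)) (sym (relabel-hit u h))))
    ... | no ¬h = trans (cong f (relabel-miss u ¬h)) (cong (relabel u p q) (!-idem π i))

  abstract
    mergeBlocks : PointedPartition n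
    mergeBlocks = fromIdem f f-idem

    mergeBlocks-! : ∀ i → mergeBlocks ! i ≡ relabel u p q (π ! i)
    mergeBlocks-! = fromIdem-! f f-idem

merge : ∀ {n} → PointedPartition n → Lab n → PointedPartition n
merge π (a , b , u) = mergeBlocks π a b u

merge-! : ∀ {n} (π : PointedPartition n) (ℓ : Lab n) i → merge π ℓ ! i ≡ relabel (col ℓ) (π ! fst ℓ) (π ! snd ℓ) (π ! i)
merge-! π (a , b , u) = mergeBlocks-! π a b u

Mergeable : ∀ {n} → PointedPartition n → Lab n → Set
Mergeable π (a , b , _) = a <F b × IsBlockMin π a × IsBlockMin π b

cover⇒Mergeable : ∀ {n} (π π' : PointedPartition n) ℓ → ΠLCover π π' ℓ → Mergeable π ℓ
cover⇒Mergeable π π' ℓ (a<b , ma , mb , _) = a<b , ma , mb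

cover⇒merge : ∀ {n} (π π' : PointedPartition n) ℓ → ΠLCover π π' ℓ → π' ≡ merge π ℓ
cover⇒merge π π' ℓ@(a , b , u) (_ , _ , _ , spec) = PP-ext λ i → trans (eq i) (sym (merge-! π ℓ i))
  where
  eq : ∀ i → π' ! i ≡ relabel u (π ! a) (π ! b) (π ! i)
  eq i with hit? (π ! a) (π ! b) (π ! i)
  ... | yes h = trans (proj₁ (spec i) h) (sym (relabel-hit u h))
  ... | no ¬h = trans (proj₂ (spec i) (¬h ∘ inj₁) (¬h ∘ inj₂)) (sym (relabel-miss u ¬h))

merge-cover : ∀ {n} (π : PointedPartition n) {ℓ} → Mergeable π ℓ → ΠLCover π (merge π ℓ) ℓ
merge-cover π {ℓ@(a , b , u)} (a<b , ma , mb) = a<b , ma , mb , λ i →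
  (λ h → trans (merge-! π ℓ i) (relabel-hit u h)) ,
  (λ p≢ q≢ → trans (merge-! π ℓ i) (relabel-miss u [ p≢ , q≢ ]′))

min-injective : ∀ {n} (π : PointedPartition n) {a b} → IsBlockMin π a → IsBlockMin π b → π ! a ≡ π ! b → a ≡ b
min-injective π ma mb e = FP.≤-antisym (ma _ (sym e)) (mb _ e)

merge-joins : ∀ {n} (π : PointedPartition n) (ℓ : Lab n) → merge π ℓ ! fst ℓ ≡ merge π ℓ ! snd ℓ
merge-joins π ℓ@(a , b , u) = trans (merge-! π ℓ a) (trans (relabel-hit u (inj₁ refl)) (sym (trans
    (merge-! π ℓ b) (relabel-hit u (inj₂ refl)))))

merge-coarsens : ∀ {n} (π : PointedPartition n) (ℓ : Lab n) {i j} → π ! i ≡ π ! j → merge π ℓ ! i ≡ merge π ℓ ! j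
merge-coarsens π ℓ {i} {j} e = trans (merge-! π ℓ i) (trans (cong (relabel _ _ _) e) (sym (merge-! π ℓ j)))

merge-mins : ∀ {n} (π : PointedPartition n) {ℓ} → Mergeable π ℓ → ∀ c →
             IsBlockMin (merge π ℓ) c ⇔ (IsBlockMin π c × c ≢ snd ℓ)
merge-mins π {ℓ@(a , b , u)} (a<b , ma , mb) c = mk⇔ fwd bwd
  where
  fwd : IsBlockMin (merge π ℓ) c → IsBlockMin π c × c ≢ b
  fwd m = (λ i e → m i (merge-coarsens π ℓ e)) , λ { refl → ℕP.<⇒≱ a<b (m a (merge-joins π ℓ)) }
  bwd : IsBlockMin π c × c ≢ b → IsBlockMin (merge π ℓ) c
  bwd (mc , c≢b) i e with relabel-fibre u (trans (sym (merge-! π ℓ i)) (trans e (merge-! π ℓ c)))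
  ... | inj₁ e' = mc i e'
  ... | inj₂ (_ , inj₂ e') = ⊥-elim (c≢b (min-injective π mc mb e'))
  ... | inj₂ (inj₁ i≡p , inj₁ e') = mc i (trans i≡p (sym e'))
  ... | inj₂ (inj₂ i≡q , inj₁ e') with min-injective π mc ma e'
  ...   | refl = ℕP.≤-trans (ℕP.<⇒≤ a<b) (mb i i≡q)

merge-Mergeable : ∀ {n} (π : PointedPartition n) ℓ ℓ' → Mergeable π ℓ →
    Mergeable π ℓ' → fst ℓ' ≢ snd ℓ → snd ℓ' ≢ snd ℓ → Mergeable (merge π ℓ) ℓ'
merge-Mergeable π ℓ ℓ' m (lt , ma , mb) a≢ b≢ = lt , from (merge-mins π m _) (ma , a≢) ,
    from (merge-mins π m _) (mb , b≢)

relabel-disjoint : ∀ {n} u u' {p q p' q' : Fin n} → ¬ Hit p' q' p → ¬ Hit p' q' q → ∀ i →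
                   relabel u p q (relabel u' p' q' i) ≡ relabel u' p' q' (relabel u p q i)
relabel-disjoint u u' {p} {q} {p'} {q'} ¬p ¬q i = go (hit? p q i) (hit? p' q' i)
  where
  miss : ∀ {i} → Hit p q i → ¬ Hit p' q' i
  miss (inj₁ refl) = ¬p
  miss (inj₂ refl) = ¬q
  go : Dec (Hit p q i) → Dec (Hit p' q' i) → relabel u p q (relabel u' p' q' i) ≡ relabel u' p' q' (relabel u p q i)
  go (yes h) _ = trans (cong (relabel u p q) (relabel-miss u' (miss h))) (trans (relabel-hit u h)
    (sym (trans (cong (relabel u' p' q') (relabel-hit u h)) (relabel-miss u' (miss (newPt-hit u p q))))))
  go (no ¬h) (yes h') = trans (cong (relabel u p q) (relabel-hit u' h')) (trans (relabel-miss u (λ h →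
      miss h (newPt-hit u' p' q')))
    (sym (trans (cong (relabel u' p' q') (relabel-miss u ¬h)) (relabel-hit u' h'))))
  go (no ¬h) (no ¬h') = trans (cong (relabel u p q) (relabel-miss u' ¬h')) (trans (relabel-miss u ¬h)
    (sym (trans (cong (relabel u' p' q') (relabel-miss u ¬h)) (relabel-miss u' ¬h'))))

-- A 1-merge keeps the point of the left block. Thus in either order the colour `u` alone decides
-- between `p` and `q'`.
relabel-shared : ∀ {n} u (v : Fin 1) {p q q' : Fin n} → p ≢ q → p ≢ q' → q ≢ q' → ∀ i →
                 relabel (fs v) (newPt u p q') q (relabel u p q' i) ≡ relabel u p q' (relabel (fs v) p q i)
relabel-shared u v {p} {q} {q'} p≢q p≢q' q≢q' i = go (hit? p q' i) (i ≟F q)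
  where
  r₁ = relabel (fs v) (newPt u p q') q
  r₂ = relabel u p q'
  r₃ = relabel (fs v) p q
  hit₃ : Hit p q' i → r₃ i ≡ i
  hit₃ (inj₁ refl) = relabel-hit (fs v) (inj₁ refl)
  hit₃ (inj₂ refl) = relabel-miss (fs v) [ p≢q' ∘ sym , q≢q' ∘ sym ]′
  go : Dec (Hit p q' i) → Dec (i ≡ q) → r₁ (r₂ i) ≡ r₂ (r₃ i)
  go (yes h) _ = trans (cong r₁ (relabel-hit u h)) (trans (relabel-hit (fs v) (inj₁ refl))
    (sym (trans (cong r₂ (hit₃ h)) (relabel-hit u h))))
  go (no ¬h) (yes refl) = trans (cong r₁ (relabel-miss u ¬h)) (trans (relabel-hit (fs v) (inj₂ refl))
    (sym (trans (cong r₂ (relabel-hit (fs v) (inj₂ refl))) (relabel-hit u (inj₁ refl)))))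
  go (no ¬h) (no i≢q) = trans (cong r₁ (relabel-miss u ¬h)) (trans (relabel-miss (fs v) [ (λ e →
      ¬h (subst (Hit p q') (sym e) (newPt-hit u p q'))) , i≢q ]′)
    (sym (trans (cong r₂ (relabel-miss (fs v) [ ¬h ∘ inj₁ , i≢q ]′)) (relabel-miss u ¬h))))

merge-merge-! : ∀ {n} (π : PointedPartition n) (x ℓ : Lab n) i → let r = relabel (col x) (π ! fst x) (π ! snd x) in
                merge (merge π x) ℓ ! i ≡ relabel (col ℓ) (r (π ! fst ℓ)) (r (π ! snd ℓ)) (r (π ! i))
merge-merge-! π x ℓ i rewrite merge-! (merge π x) ℓ i | merge-! π x (fst ℓ) | merge-! π x (snd ℓ) | merge-! π x i = refl

-- If the sources differ, the four minima are distinct and the two pairs of blocks are disjoint. If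
-- they agree, an ascent leaves only colour 1 for `ℓ`, and `relabel-shared` applies.
merge-comm : ∀ {n} (π : PointedPartition n) {x ℓ : Lab n} → x <Λ ℓ → Mergeable π x →
    Mergeable π ℓ → fst ℓ ≢ snd x → snd ℓ ≢ snd x →
             merge (merge π x) ℓ ≡ merge (merge π ℓ) x
merge-comm π {x@(a' , b' , u')} {ℓ@(a , b , u)} x<ℓ (a'<b' , ma' , mb') (a<b , ma , mb) a≢b' b≢b' = PP-ext λ i →
  trans (merge-merge-! π x ℓ i) (trans (comm x<ℓ (π ! i)) (sym (merge-merge-! π ℓ x i)))
  where
  r  = relabel u (π ! a) (π ! b)
  r' = relabel u' (π ! a') (π ! b')
  distinct : ∀ {c d} → IsBlockMin π c → IsBlockMin π d → c ≢ d → π ! c ≢ π ! d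
  distinct mc md c≢d e = c≢d (min-injective π mc md e)
  comm : x <Λ ℓ → ∀ i → relabel u (r' (π ! a)) (r' (π ! b)) (r' i) ≡ relabel u' (r (π ! a')) (r (π ! b')) (r i)
  comm (lt-fst a'<a) i
    rewrite relabel-miss u' {π ! a'} {π ! b'} {π ! a} [ distinct ma ma' (FP.<⇒≢ a'<a ∘ sym) , distinct ma mb' a≢b' ]′
          | relabel-miss u' {π ! a'} {π ! b'} {π ! b} [ distinct mb ma' (λ e →
              FP.<⇒≢ (FP.<-trans a'<a a<b) (sym e)) , distinct mb mb' b≢b' ]′
          | relabel-miss u {π ! a} {π ! b} {π ! a'} [ distinct ma' ma (FP.<⇒≢ a'<a) ,
              distinct ma' mb (FP.<⇒≢ (FP.<-trans a'<a a<b)) ]′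
          | relabel-miss u {π ! a} {π ! b} {π ! b'} [ distinct mb' ma (a≢b' ∘ sym) , distinct mb' mb (b≢b' ∘ sym) ]′
          = relabel-disjoint u u' [ distinct ma ma' (FP.<⇒≢ a'<a ∘ sym) , distinct ma mb' a≢b' ]′
              [ distinct mb ma' (λ e → FP.<⇒≢ (FP.<-trans a'<a a<b) (sym e)) , distinct mb mb' b≢b' ]′ i
  comm lt-AC i = shared i
    where
    shared : ∀ i → relabel (fs fz) (r' (π ! a)) (r' (π ! b)) (r' i) ≡ relabel u' (r (π ! a)) (r (π ! b')) (r i)
    shared i
      rewrite relabel-hit u' {π ! a} {π ! b'} {π ! a} (inj₁ refl)
            | relabel-miss u' {π ! a} {π ! b'} {π ! b} [ distinct mb ma (FP.<⇒≢ a<b ∘ sym) , distinct mb mb' b≢b' ]′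
            | relabel-hit u {π ! a} {π ! b} {π ! a} (inj₁ refl)
            | relabel-miss u {π ! a} {π ! b} {π ! b'} [ distinct mb' ma (a≢b' ∘ sym) , distinct mb' mb (b≢b' ∘ sym) ]′
            = relabel-shared u' fz (distinct ma mb (FP.<⇒≢ a<b)) (distinct ma mb' a≢b') (distinct mb mb' b≢b') i
  comm (lt-C _) i = shared i
    where
    shared : ∀ i → relabel (fs fz) (r' (π ! a)) (r' (π ! b)) (r' i) ≡ relabel u' (r (π ! a)) (r (π ! b')) (r i)
    shared i
      rewrite relabel-hit u' {π ! a} {π ! b'} {π ! a} (inj₁ refl)
            | relabel-miss u' {π ! a} {π ! b'} {π ! b} [ distinct mb ma (FP.<⇒≢ a<b ∘ sym) , distinct mb mb' b≢b' ]′
            | relabel-hit u {π ! a} {π ! b} {π ! a} (inj₁ refl)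
            | relabel-miss u {π ! a} {π ! b} {π ! b'} [ distinct mb' ma (a≢b' ∘ sym) , distinct mb' mb (b≢b' ∘ sym) ]′
            = relabel-shared u' fz (distinct ma mb (FP.<⇒≢ a<b)) (distinct ma mb' a≢b') (distinct mb mb' b≢b') i

-- Chains of merges and their words

runFrom : ∀ {n} → PointedPartition n → Word n → PointedPartition n
runFrom = foldl merge

run : ∀ {n} → Word n → PointedPartition n
run {n} = runFrom (Π•-bottom n)

run-∷ʳ : ∀ {n} (w : Word n) ℓ → run (w ∷ʳ ℓ) ≡ merge (run w) ℓ
run-∷ʳ w ℓ = foldl-∷ʳ merge _ ℓ w

LChain : ∀ {n} → PointedPartition n → PointedPartition n → Word n → Set
LChain {n} = RΠ.LChain n

chain-run : ∀ {n} {π x : PointedPartition n} {w} → LChain π x w → x ≡ runFrom π w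
chain-run RΠ.[] = refl
chain-run (RΠ._∷_ {x} {y} {ℓ = ℓ} c cs) with cover⇒merge x y ℓ c
... | refl = chain-run cs

chain-mins : ∀ {n} {π x : PointedPartition n} {w} → LChain π x w → ∀ c → IsBlockMin x c ⇔ (IsBlockMin π c × c ∉ snds w)
chain-mins RΠ.[] c = mk⇔ (λ m → m , λ ()) proj₁
chain-mins {n} {π = π} {x} (RΠ._∷_ {y = y} {ℓ = ℓ} {w = w} cv cs) c with cover⇒merge π y ℓ cv
... | refl = mk⇔ fwd bwd
  where
  m₀ : Mergeable π ℓ
  m₀ = cover⇒Mergeable π y ℓ cv
  fwd : IsBlockMin x c → IsBlockMin π c × c ∉ snd ℓ ∷ snds w
  fwd m with to (chain-mins cs c) m
  ... | m' , c∉ with to (merge-mins π m₀ c) m'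
  ...   | m'' , c≢ = m'' , λ { (here e) → c≢ e ; (there c∈) → c∉ c∈ }
  bwd : IsBlockMin π c × c ∉ snd ℓ ∷ snds w → IsBlockMin x c
  bwd (m , c∉) = from (chain-mins cs c) (from (merge-mins π m₀ c) (m , c∉ ∘ here) , c∉ ∘ there)

-- Merging only removes block minima, so a letter used later joins two minima of `π` already;
-- targets are distinct because each one stops being a minimum.
chain-letters : ∀ {n} {π x : PointedPartition n} {w} → LChain π x w → All (Mergeable π) w × Unique (snds w)
chain-letters RΠ.[] = [] , []
chain-letters {π = π} (RΠ._∷_ {y = y} {ℓ = ℓ} cv cs) with cover⇒merge π y ℓ cv | chain-letters cs
... | refl | ms , u = (m ∷ all-map (λ (lt , ma , mb) → lt , proj₁ (to (mins _) ma) , proj₁ (to (mins _) mb)) ms) ,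
    (All-map⁺ (all-map (λ (_ , _ , mb) e → proj₂ (to (mins _) mb) (sym e)) ms) ∷ u)
  where
  m : Mergeable π ℓ
  m = cover⇒Mergeable π y ℓ cv
  mins = merge-mins π m

valid-chain : ∀ {n} {π : PointedPartition n} {w} → Valid w → All (Mergeable π) w → LChain π (runFrom π w) w
valid-chain {w = []} _ _ = RΠ.[]
valid-chain {π = π} {x ∷ w} v (m ∷ ms) = merge-cover π m RΠ.∷ valid-chain (Valid-∷⁻ v)
  (all-tabulate λ {y} y∈ → let a≢ , b≢ = all-lookup (fst∉snds v) y∈ in merge-Mergeable π x y m (all-lookup ms y∈) a≢ b≢)

𝟘-min : ∀ {n} c → IsBlockMin (Π•-bottom n) c
𝟘-min c i e = ℕP.≤-reflexive (cong toℕ (trans (sym (𝟘-! c)) (trans (sym e) (𝟘-! i))))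

Valid⇒InR : ∀ {n} {w : Word n} → Valid w → RΠ.InR n (run w , w)
Valid⇒InR v = valid-chain v (all-map (λ lt → lt , 𝟘-min _ , 𝟘-min _) (proper v)) , Desc⇒AscentFree (desc v)

InR⇒Valid : ∀ {n} {x} {w : Word n} → RΠ.InR n (x , w) → Valid w × x ≡ run w
InR⇒Valid (c , af) with chain-letters c
... | ms , u = mkValid (all-map proj₁ ms) u (AscentFree⇒Desc af) , chain-run c

run-mins : ∀ {n} {w : Word n} → Valid w → ∀ c → IsBlockMin (run w) c ⇔ c ∉ snds w
run-mins v c = mk⇔ (λ m → proj₂ (to (chain-mins (proj₁ (Valid⇒InR v)) c) m))
                   (λ c∉ → from (chain-mins (proj₁ (Valid⇒InR v)) c) (𝟘-min c , c∉))

Fresh⇔Mergeable : ∀ {n} {w : Word n} → Valid w → ∀ {ℓ} → Fresh ℓ w ⇔ Mergeable (run w) ℓ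
Fresh⇔Mergeable v = mk⇔ (λ (lt , a∉ , b∉) → lt , from (run-mins v _) a∉ , from (run-mins v _) b∉)
                        (λ (lt , ma , mb) → lt , to (run-mins v _) ma , to (run-mins v _) mb)

-- Every letter of `v` forms an ascent with `ℓ`, so `merge-comm` carries `ℓ` past them one at a
-- time.
runFrom-slide : ∀ {n} (π : PointedPartition n) {ℓ} v → Valid v → Fresh ℓ v → All (_<Λ ℓ) v →
    All (Mergeable π) v → Mergeable π ℓ →
                runFrom π (ℓ ∷ v) ≡ runFrom π (v ∷ʳ ℓ)
runFrom-slide π [] _ _ _ _ _ = refl
runFrom-slide π {ℓ} (x ∷ v) vv (lt , a∉ , b∉) (x<ℓ ∷ lts) (m ∷ ms) mℓ =
  trans (cong (λ z → runFrom z v) (sym (merge-comm π x<ℓ m mℓ (a∉ ∘ here) (b∉ ∘ here))))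
    (runFrom-slide (merge π x) v (Valid-∷⁻ vv) (lt , a∉ ∘ there , b∉ ∘ there) lts
      (all-tabulate λ {y} y∈ → let a≢ , b≢ = all-lookup (fst∉snds vv) y∈ in merge-Mergeable π x y m (all-lookup ms y∈) a≢ b≢)
      (merge-Mergeable π x ℓ m mℓ (a∉ ∘ here) (b∉ ∘ here)))

runFrom-Ins : ∀ {n} (π : PointedPartition n) {ℓ v v'} → Valid v → Fresh ℓ v → All (Mergeable π) v → Mergeable π ℓ →
              Ins ℓ v v' → runFrom π v' ≡ merge (runFrom π v) ℓ
runFrom-Ins π {ℓ} {v} vv fr ms mℓ (here lts) = trans (runFrom-slide π v vv fr lts ms mℓ) (foldl-∷ʳ merge π ℓ v)
runFrom-Ins π {ℓ} {v = x ∷ v} vv (lt , a∉ , b∉) (m ∷ ms) mℓ (there _ i) =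
  runFrom-Ins (merge π x) (Valid-∷⁻ vv) (lt , a∉ ∘ there , b∉ ∘ there)
      (all-tabulate λ {y} y∈ → let a≢ , b≢ = all-lookup (fst∉snds vv) y∈ in merge-Mergeable π x y m (all-lookup ms y∈) a≢ b≢)
      (merge-Mergeable π x ℓ m mℓ (a∉ ∘ here) (b∉ ∘ here)) i

run-Ins : ∀ {n} {ℓ : Lab n} {w w'} → Valid w → Fresh ℓ w → Ins ℓ w w' → run w' ≡ merge (run w) ℓ
run-Ins v fr@(lt , _ , _) = runFrom-Ins _ v fr (all-map (λ lt → lt , 𝟘-min _ , 𝟘-min _) (proper v)) (lt ,
    𝟘-min _ , 𝟘-min _)

-- Covers of R as insertions

WCover⇒Valid : ∀ {n} {w w' : Word n} → WCover w w' → Valid w × Valid w'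
WCover⇒Valid (_ , v , fr , i) = v , Ins-Valid v fr i

WCover⇒RCover : ∀ {n} {w w' : Word n} → WCover w w' → RΠ.RCover n (run w , w) (run w' , w')
WCover⇒RCover {w = w} {w'} wc@(ℓ , v , fr , i) = Valid⇒InR v , Valid⇒InR v' , ℓ ,
  subst (λ z → ΠLCover (run w) z ℓ) (sym (run-Ins v fr i)) (merge-cover (run w) (to (Fresh⇔Mergeable v {ℓ}) fr)) ,
  Ins⇒sorts [] (desc v) i , Desc⇒AscentFree (desc v')
  where v' = proj₂ (WCover⇒Valid wc)

RCover⇒WCover : ∀ {n} {x y} {w w' : Word n} → RΠ.RCover n (x , w) (y , w') → WCover w w'
RCover⇒WCover {x = x} {y} (r , _ , ℓ , c , s) with InR⇒Valid r
... | v , refl = ℓ , v , from (Fresh⇔Mergeable v {ℓ}) (cover⇒Mergeable x y ℓ c) , sorts⇒Ins (desc v) s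

-- Trees grown from words, with list lemmas for forests

all-∈⁺ : {A : Set} (p : A → Bool) → ∀ xs → (∀ {x} → x ∈ xs → T (p x)) → T (all p xs)
all-∈⁺ p [] h = tt
all-∈⁺ p (x ∷ xs) h = from T-∧ (h (here refl) , all-∈⁺ p xs (h ∘ there))

↭-concatMap : {A B : Set} (f : A → List B) {xs ys : List A} → xs ↭ ys → concatMap f xs ↭ concatMap f ys
↭-concatMap f PP.refl = ↭-refl
↭-concatMap f (PP.prep x p) = ↭-++⁺ (↭-refl {x = f x}) (↭-concatMap f p)
↭-concatMap f (PP.swap {xs} {ys} x y p) =
  ↭-trans (↭-reflexive (sym (++-assoc (f x) (f y) _)))
    (↭-trans (↭-++⁺ (↭-++-comm (f x) (f y)) (↭-concatMap f p)) (↭-reflexive (++-assoc (f y) (f x) _)))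
↭-concatMap f (PP.trans p q) = ↭-trans (↭-concatMap f p) (↭-concatMap f q)

sorted-unique : {A : Set} {R : A → A → Set} → (∀ {x y} → R x y → ¬ R y x) → {xs ys : List A} →
                AllPairs R xs → AllPairs R ys → xs ↭ ys → xs ≡ ys
sorted-unique as {[]} {ys} _ _ p = sym (↭-empty-inv (↭-sym p))
sorted-unique as {_ ∷ _} {[]} _ _ p with ↭-empty-inv p
... | ()
sorted-unique as {x ∷ xs} {y ∷ ys} (rx ∷ sx) (ry ∷ sy) p = go (∈-resp-↭ p (here refl)) (∈-resp-↭ (↭-sym p) (here refl))
  where
  same : x ≡ y → x ∷ xs ≡ y ∷ ys
  same refl = cong (x ∷_) (sorted-unique as sx sy (drop-∷ p))
  go : x ∈ y ∷ ys → y ∈ x ∷ xs → x ∷ xs ≡ y ∷ ys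
  go (here e) _ = same e
  go (there _) (here e) = same (sym e)
  go (there x∈) (there y∈) = ⊥-elim (as (all-lookup rx y∈) (all-lookup ry x∈))

module _ {n : ℕ} (τ : Fin n → Tree n) (ℓ : Lab n) where
  abstract
    -- The tree at `snd ℓ` is left in place although it is now a subtree; `live` later discards it.
    growStep : Fin n → Tree n
    growStep c = if does (c ≟F fst ℓ) then node (col ℓ) (τ (fst ℓ)) (τ (snd ℓ)) else τ c

    growStep-root : growStep (fst ℓ) ≡ node (col ℓ) (τ (fst ℓ)) (τ (snd ℓ))
    growStep-root with fst ℓ ≟F fst ℓ
    ... | yes _ = refl
    ... | no a≢a = ⊥-elim (a≢a refl)

    growStep-other : ∀ {c} → c ≢ fst ℓ → growStep c ≡ τ c
    growStep-other {c} c≢a with c ≟F fst ℓ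
    ... | yes e = ⊥-elim (c≢a e)
    ... | no _ = refl

grow : ∀ {n} → (Fin n → Tree n) → Word n → Fin n → Tree n
grow = foldl growStep

-- For c not among the targets of w, treeAt w c is the tree with minimum c of the forest built by w.
treeAt : ∀ {n} → Word n → Fin n → Tree n
treeAt = grow leaf

treeAt-∷ʳ : ∀ {n} (w : Word n) ℓ c → treeAt (w ∷ʳ ℓ) c ≡ growStep (treeAt w) ℓ c
treeAt-∷ʳ w ℓ c = cong (λ f → f c) (foldl-∷ʳ growStep leaf ℓ w)

treeAt-∷ʳ-root : ∀ {n} (w : Word n) ℓ → treeAt (w ∷ʳ ℓ) (fst ℓ) ≡ node (col ℓ) (treeAt w (fst ℓ)) (treeAt w (snd ℓ))
treeAt-∷ʳ-root w ℓ = trans (treeAt-∷ʳ w ℓ (fst ℓ)) (growStep-root (treeAt w) ℓ)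

treeAt-∷ʳ-other : ∀ {n} (w : Word n) ℓ {c} → c ≢ fst ℓ → treeAt (w ∷ʳ ℓ) c ≡ treeAt w c
treeAt-∷ʳ-other w ℓ {c} c≢ = trans (treeAt-∷ʳ w ℓ c) (growStep-other (treeAt w) ℓ c≢)

Proper : ∀ {n} → Lab n → Set
Proper ℓ = fst ℓ <F snd ℓ

Normal : ∀ {n} → (Fin n → Tree n) → Set
Normal τ = ∀ c → ν (τ c) ≡ toℕ c

growStep-Normal : ∀ {n} {τ : Fin n → Tree n} {ℓ} → Normal τ → Proper ℓ → Normal (growStep τ ℓ)
growStep-Normal {τ = τ} {ℓ} N a<b c with c ≟F fst ℓ
... | no c≢ = trans (cong ν (growStep-other τ ℓ c≢)) (N c)
... | yes refl = trans (cong ν (growStep-root τ ℓ)) (trans (cong₂ _⊓_ (N (fst ℓ)) (N (snd ℓ))) (ℕP.m≤n⇒m⊓n≡m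
    (ℕP.<⇒≤ a<b)))

grow-Normal : ∀ {n} {τ : Fin n → Tree n} {w} → Normal τ → All Proper w → Normal (grow τ w)
grow-Normal N [] = N
grow-Normal {τ = τ} {x ∷ w} N (p ∷ ps) = grow-Normal {w = w} (growStep-Normal {τ = τ} {x} N p) ps

treeAt-ν : ∀ {n} {w : Word n} → Valid w → ∀ c → ν (treeAt w c) ≡ toℕ c
treeAt-ν {w = w} v = grow-Normal {w = w} (λ _ → refl) (proper v)

treeAt-injective : ∀ {n} {w w' : Word n} → Valid w → Valid w' → ∀ {c d} → treeAt w c ≡ treeAt w' d → c ≡ d
treeAt-injective v v' {c} {d} e = FP.toℕ-injective (trans (sym (treeAt-ν v c)) (trans (cong ν e) (treeAt-ν v' d)))

-- The letters of a vertex and of its left child have the same source. An ascent between them is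
-- either a step from A_a to C_a, excluded by the colours, or a step inside C_a, excluded by the
-- Lyndon condition. The latter is strict, whence `b' ≢ b`.
leftCond-≥ : ∀ {n} (a b b' : Fin n) u u' {l r t : Tree n} → ν r ≡ toℕ b' → ν t ≡ toℕ b → b' ≢ b →
             (a , b' , u') ≥Λ (a , b , u) → T (leftCond u (node u' l r) t)
leftCond-≥ a b b' fz u' _ _ _ _ = tt
leftCond-≥ a b b' (fs fz) fz _ _ _ ge = ⊥-elim (≥Λ⇒≮Λ {x = a , b' , fz} {a , b , fs fz} ge lt-AC)
leftCond-≥ a b b' (fs fz) (fs fz) er et b'≢b ge rewrite er | et =
  ℕP.<⇒<ᵇ (ℕP.≤∧≢⇒< (ℕP.≮⇒≥ (≥Λ⇒≮Λ {x = a , b' , fs fz} {a , b , fs fz} ge ∘ lt-C)) (b'≢b ∘ sym ∘ FP.toℕ-injective))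

leftCond⇒≥ : ∀ {n} (a b b' : Fin n) u u' {l r t : Tree n} → ν r ≡ toℕ b' → ν t ≡ toℕ b →
             T (leftCond u (node u' l r) t) → (a , b' , u') ≥Λ (a , b , u)
leftCond⇒≥ a b b' u u' {l} {r} {t} er et c = ≮Λ⇒≥Λ (λ lt → go lt er et c)
  where
  go : ∀ {u u'} → (a , b' , u') <Λ (a , b , u) → ν r ≡ toℕ b' → ν t ≡ toℕ b → ¬ T (leftCond u (node u' l r) t)
  go (lt-fst a<a) _ _ _ = ℕP.<-irrefl refl a<a
  go (lt-C b'<b) er et c rewrite er | et = ℕP.<-asym b'<b (ℕP.<ᵇ⇒< _ _ c)

isPL-node⁻ : ∀ {n} u (l r : Tree n) → T (isPL (node u l r)) → ν l ⊓ ν r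
    ≡ ν l × T (leftCond u l r) × T (isPL l) × T (isPL r)
isPL-node⁻ u l r t with to (T-∧ {ν l ⊓ ν r ≡ᵇ ν l}) t
... | e , t₁ with to (T-∧ {leftCond u l r}) t₁
...   | c , t₂ with to (T-∧ {isPL l}) t₂
...     | pl , pr = ℕP.≡ᵇ⇒≡ _ _ e , c , pl , pr

isPL-node⁺ : ∀ {n} u (l r : Tree n) → ν l ⊓ ν r ≡ ν l → T (leftCond u l r) → T (isPL l) → T (isPL r) →
    T (isPL (node u l r))
isPL-node⁺ u l r e c pl pr = from T-∧ (ℕP.≡⇒≡ᵇ _ _ e , from T-∧ (c , from T-∧ (pl , pr)))

-- The root was made by the last letter with source `c`. Growing preserves `ν`, so the minimum of
-- the right child names the target.
grow-node : ∀ {n} {τ : Fin n → Tree n} w {c u l r} → Normal τ → All Proper w → grow τ w c ≡ node u l r →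
            τ c ≡ node u l r ⊎ ∃ λ b → (c , b , u) ∈ w × ν r ≡ toℕ b
grow-node [] N ps e = inj₁ e
grow-node {τ = τ} (x ∷ w) {c} N (p ∷ ps) e with grow-node w (growStep-Normal {τ = τ} {x} N p) ps e
... | inj₂ (b , ∈w , eν) = inj₂ (b , there ∈w , eν)
... | inj₁ e' with c ≟F fst x
...   | no c≢ = inj₁ (trans (sym (growStep-other τ x c≢)) e')
...   | yes refl with trans (sym (growStep-root τ x)) e'
...     | refl = inj₂ (snd x , here refl , N (snd x))

treeAt-node : ∀ {n} {w : Word n} {c u l r} → Valid w → treeAt w c ≡ node u l r → ∃ λ b → (c , b , u) ∈ w × ν r ≡ toℕ b
treeAt-node {w = w} v e with grow-node w (λ _ → refl) (proper v) e
... | inj₂ r = r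

-- Only the newest root needs checking. An internal left child of it comes from an earlier letter
-- with the same source, and descent of the word is the required left condition.
treeAt-PL : ∀ {n} {w : Word n} → Valid w → ∀ c → T (isPL (treeAt w c))
treeAt-PL {w = w} = go (reverseView w)
  where
  go : ∀ {w} → Reverse w → Valid w → ∀ c → T (isPL (treeAt w c))
  go [] v c = tt
  go (w ∶ rs ∶ʳ ℓ@(a , b , u)) v c with Valid-∷ʳ⁻ w v
  ... | v₁ , (a<b , _ , b∉) , ge with c ≟F a
  ...   | no c≢ = subst (T ∘ isPL) (sym (treeAt-∷ʳ-other w ℓ c≢)) (go rs v₁ c)
  ...   | yes refl = subst (T ∘ isPL) (sym (treeAt-∷ʳ-root w ℓ))
            (isPL-node⁺ u (treeAt w a) (treeAt w b) (trans (cong₂ _⊓_ (treeAt-ν v₁ a) (treeAt-ν v₁ b))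
                (trans (ℕP.m≤n⇒m⊓n≡m (ℕP.<⇒≤ a<b)) (sym (treeAt-ν v₁ a))))
              (cond (treeAt w a) refl) (go rs v₁ a) (go rs v₁ b))
    where
    cond : ∀ t → treeAt w a ≡ t → T (leftCond u t (treeAt w b))
    cond (leaf _) _ = tt
    cond (node u' l r) e with treeAt-node v₁ e
    ... | b' , ∈w , eν = leftCond-≥ a b b' u u' {l} {r} {treeAt w b} eν (treeAt-ν v₁ b) (λ { refl → b∉
        (∈-map⁺ snd ∈w) }) (all-lookup ge ∈w)

-- Sliding a new root

-- This is `MergeTo` without the demand that the result be pointed Lyndon; `treeAt-PL` supplies that
-- at the end.
Slid : ∀ {n} → ℕ → Fin 2 → Tree n → Tree n → Tree n → Set
Slid k u t tb t* = insertAt k u t tb ≡ just t* × (∀ j t' → j < k → insertAt j u t tb ≡ just t' → ¬ T (isPL t'))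

-- Under one more vertex, whose letter is below that of the new root, the new root cannot stay on
-- top: the left condition there would contradict the ascent. The deeper positions fail because the
-- left subtree failed already.
slid-node : ∀ {n} {k u t tb t*} a b (u' : Fin 2) {b' : Fin n} {tb'} → ν tb ≡ toℕ b → ν tb' ≡ toℕ b' → (a ,
    b' , u') <Λ (a , b , u) →
            Slid k u t tb t* → Slid (suc k) u (node u' t tb') tb (node u' t* tb')
slid-node {n} {k} {u} {t} {tb} {t*} a b u' {b'} {tb'} eb eb' lt (e , early) =
    cong (mmap (λ l → node u' l tb')) e , early'
  where
  early' : ∀ j t' → j < suc k → insertAt j u (node u' t tb') tb ≡ just t' → ¬ T (isPL t')
  early' zero _ _ refl pl = ≥Λ⇒≮Λ (leftCond⇒≥ a b b' u u' {t} {tb'} {tb} eb' eb (proj₁ (proj₂ (isPL-node⁻ u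
      (node u' t tb') tb pl)))) lt
  early' (suc j) t' (s≤s j<k) e' pl with insertAt j u t tb in ej
  early' (suc j) t' (s≤s j<k) refl pl | just l = early j l j<k ej (proj₁ (proj₂ (proj₂ (isPL-node⁻ u' l tb' pl))))

-- The letters behind `ℓ` are replayed on two families, `τ*` with `ℓ` already merged and `τ` without
-- it. A letter with source `fst ℓ` puts the same kind of vertex on top of both trees and costs one
-- more slide. Any other letter has a smaller source and changes the trees of neither `fst ℓ` nor
-- `snd ℓ`.
grow-slide : ∀ {n} v (τ τ* : Fin n → Tree n) (ℓ : Lab n) {k} → Proper ℓ → Normal τ → All Proper v → All (_<Λ ℓ) v →
             fst ℓ ∉ snds v → (∀ {c} → c ≢ fst ℓ → τ* c ≡ τ c) → Slid k (col ℓ) (τ (fst ℓ)) (τ (snd ℓ)) (τ* (fst ℓ)) →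
             (∀ {c} → c ≢ fst ℓ → grow τ* v c ≡ grow τ v c) ×
             (∃ λ k' → Slid k' (col ℓ) (grow τ v (fst ℓ)) (grow τ v (snd ℓ)) (grow τ* v (fst ℓ)))
grow-slide [] τ τ* ℓ a<b N ps lts a∉ agree sl = agree , _ , sl
grow-slide (x@(a' , b' , u') ∷ v) τ τ* ℓ@(a , b , u) {k} a<b N (p ∷ ps) (lt ∷ lts) a∉ agree sl =
  grow-slide v τ₁ τ₁* ℓ a<b (growStep-Normal {τ = τ} {x} N p) ps lts (a∉ ∘ there) agree' (proj₂ slid')
  where
  τ₁ = growStep τ x
  τ₁* = growStep τ* x
  a'≤a : a' ≤F a
  a'≤a = key≤⇒fst≤ x ℓ (ℕP.<⇒≤ (<Λ⇒key< lt))
  b≢a' : b ≢ a'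
  b≢a' refl = ℕP.<⇒≱ a<b a'≤a
  b'≢a : b' ≢ a
  b'≢a e = a∉ (here (sym e))
  agree' : ∀ {c} → c ≢ a → τ₁* c ≡ τ₁ c
  agree' {c} c≢a with c ≟F a'
  ... | yes refl = trans (growStep-root τ* x) (trans (cong₂ (node u') (agree c≢a) (agree b'≢a)) (sym
      (growStep-root τ x)))
  ... | no c≢a' = trans (growStep-other τ* x c≢a') (trans (agree c≢a) (sym (growStep-other τ x c≢a')))
  slid' : ∃ λ k' → Slid k' u (τ₁ a) (τ₁ b) (τ₁* a)
  slid' with a ≟F a'
  ... | no a≢a' rewrite growStep-other τ x a≢a' | growStep-other τ x b≢a' | growStep-other τ* x a≢a' = k , sl
  ... | yes refl rewrite growStep-root τ x | growStep-other τ x b≢a' | growStep-root τ* x | agree b'≢a =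
        suc k , slid-node a b u' {b'} (N b) (N b') lt sl

grow-Ins : ∀ {n} {v v'} (τ : Fin n → Tree n) (ℓ : Lab n) → Proper ℓ → Normal τ → All Proper v →
           fst ℓ ∉ snds v → Ins ℓ v v' →
           (∀ {c} → c ≢ fst ℓ → grow τ v' c ≡ grow τ v c) ×
           (∃ λ k' → Slid k' (col ℓ) (grow τ v (fst ℓ)) (grow τ v (snd ℓ)) (grow τ v' (fst ℓ)))
grow-Ins {v = v} τ ℓ a<b N ps a∉ (here lts) =
  grow-slide v τ (growStep τ ℓ) ℓ {0} a<b N ps lts a∉ (growStep-other τ ℓ) (cong just (sym
      (growStep-root τ ℓ)) , λ _ _ ())
grow-Ins {v = x ∷ v} τ ℓ a<b N (p ∷ ps) a∉ (there _ i) =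
  grow-Ins (growStep τ x) ℓ a<b (growStep-Normal {τ = τ} {x} N p) ps (a∉ ∘ there) i

-- Sorting agrees with sliding: the number of slides is the number of letters with source `fst ℓ`
-- behind the place of `ℓ`.
treeAt-Ins : ∀ {n} {ℓ : Lab n} {w w'} → Valid w → Fresh ℓ w → Ins ℓ w w' →
             (∀ {c} → c ≢ fst ℓ → treeAt w' c ≡ treeAt w c) × MergeTo (col ℓ) (treeAt w (fst ℓ)) (treeAt w
                 (snd ℓ)) (treeAt w' (fst ℓ))
treeAt-Ins {ℓ = ℓ} v fr@(a<b , a∉ , _) i with grow-Ins leaf ℓ a<b (λ _ → refl) (proper v) a∉ i
... | agree , k , e , early = agree , k , e , treeAt-PL (Ins-Valid v fr i) (fst ℓ) , early

MergeTo-functional : ∀ {n} {u} {t₁ t₂ t t' : Tree n} → MergeTo u t₁ t₂ t → MergeTo u t₁ t₂ t' → t ≡ t'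
MergeTo-functional (k , e , pl , early) (k' , e' , pl' , early') with ℕP.<-cmp k k'
... | tri< k<k' _ _ = ⊥-elim (early' k _ k<k' e pl)
... | tri≈ _ refl _ = just-injective (trans (sym e) e')
... | tri> _ _ k'<k = ⊥-elim (early k' _ k'<k e' pl')

-- The forest of a valid word

_∈?_ : ∀ {n} (c : Fin n) (cs : List (Fin n)) → Dec (c ∈ cs)
c ∈? cs = any? (c ≟F_) cs

live : ∀ {n} → Word n → List (Fin n)
live w = filter (λ c → ¬? (c ∈? snds w)) (allFin _)

∈-live⁺ : ∀ {n} {w : Word n} {c} → c ∉ snds w → c ∈ live w
∈-live⁺ {w = w} = ∈-filter⁺ (λ c → ¬? (c ∈? snds w)) (∈-allFin _)

∈-live⁻ : ∀ {n} {w : Word n} {c} → c ∈ live w → c ∉ snds w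
∈-live⁻ {w = w} c∈ = proj₂ (∈-filter⁻ (λ c → ¬? (c ∈? snds w)) {xs = allFin _} c∈)

live-unique : ∀ {n} (w : Word n) → Unique (live w)
live-unique w = UP.filter⁺ (λ c → ¬? (c ∈? snds w)) (UP.allFin⁺ _)

forest : ∀ {n} → Word n → List (Tree n)
forest w = map (treeAt w) (live w)

∈-forest⁻ : ∀ {n} {w : Word n} {t} → t ∈ forest w → ∃ λ c → c ∉ snds w × t ≡ treeAt w c
∈-forest⁻ {w = w} t∈ with ∈-map⁻ (treeAt w) t∈
... | c , c∈ , e = c , ∈-live⁻ {w = w} c∈ , e

∈-forest⁺ : ∀ {n} {w : Word n} {c} → c ∉ snds w → treeAt w c ∈ forest w
∈-forest⁺ {w = w} c∉ = ∈-map⁺ (treeAt w) (∈-live⁺ {w = w} c∉)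

forest-unique : ∀ {n} {w : Word n} → Valid w → Unique (forest w)
forest-unique {w = w} v = UP.map⁺ (treeAt-injective v v) (live-unique w)

live-split : ∀ {n} {w w' : Word n} {a b} → a ∉ snds w → b ∉ snds w → a ≢ b → snds w' ↭ b ∷ snds w →
             ∃ λ L → live w ↭ a ∷ b ∷ L × live w' ↭ a ∷ L × a ∉ L
live-split {w = w} {w'} {a} {b} a∉ b∉ a≢b p = L ,
  set-↭ (live-unique w) ((a≢b ∷ a∉L) ∷ b∉L ∷ uL) f₁ g₁ ,
  set-↭ (live-unique w') (a∉L ∷ uL) f₂ g₂ , All¬⇒¬Any a∉L
  where
  P? = λ c → ¬? (c ≟F a)
  L = filter P? (live w')
  uL : Unique L
  uL = UP.filter⁺ P? (live-unique w')
  snds-w' : ∀ {c} → c ∉ snds w' → c ∉ snds w × c ≢ b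
  snds-w' c∉ = (λ c∈ → c∉ (∈-resp-↭ (↭-sym p) (there c∈))) , (λ e → c∉ (∈-resp-↭ (↭-sym p) (here e)))
  snds-w : ∀ {c} → c ∉ snds w → c ≢ b → c ∉ snds w'
  snds-w c∉ c≢b c∈ with ∈-resp-↭ p c∈
  ... | here e = c≢b e
  ... | there c∈' = c∉ c∈'
  L⁻ : ∀ {c} → c ∈ L → c ∉ snds w' × c ≢ a
  L⁻ c∈ with ∈-filter⁻ P? {xs = live w'} c∈
  ... | c∈' , c≢a = ∈-live⁻ {w = w'} c∈' , c≢a
  L⁺ : ∀ {c} → c ∉ snds w' → c ≢ a → c ∈ L
  L⁺ c∉ c≢a = ∈-filter⁺ P? (∈-live⁺ {w = w'} c∉) c≢a
  a∉L : All (a ≢_) L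
  a∉L = all-tabulate λ c∈ e → proj₂ (L⁻ c∈) (sym e)
  b∉L : All (b ≢_) L
  b∉L = all-tabulate λ c∈ e → proj₂ (snds-w' (proj₁ (L⁻ c∈))) (sym e)
  f₁ : ∀ {c} → c ∈ live w → c ∈ a ∷ b ∷ L
  f₁ {c} c∈ with c ≟F a | c ≟F b
  ... | yes e | _ = here e
  ... | no _ | yes e = there (here e)
  ... | no c≢a | no c≢b = there (there (L⁺ (snds-w (∈-live⁻ {w = w} c∈) c≢b) c≢a))
  g₁ : ∀ {c} → c ∈ a ∷ b ∷ L → c ∈ live w
  g₁ (here refl) = ∈-live⁺ {w = w} a∉
  g₁ (there (here refl)) = ∈-live⁺ {w = w} b∉
  g₁ (there (there c∈)) = ∈-live⁺ {w = w} (proj₁ (snds-w' (proj₁ (L⁻ c∈))))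
  f₂ : ∀ {c} → c ∈ live w' → c ∈ a ∷ L
  f₂ {c} c∈ with c ≟F a
  ... | yes e = here e
  ... | no c≢a = there (L⁺ (∈-live⁻ {w = w'} c∈) c≢a)
  g₂ : ∀ {c} → c ∈ a ∷ L → c ∈ live w'
  g₂ (here refl) = ∈-live⁺ {w = w'} (snds-w a∉ a≢b)
  g₂ (there c∈) = ∈-live⁺ {w = w'} (proj₁ (L⁻ c∈))

record ForestSplit {n} (w w' : Word n) (a b : Fin n) : Set where
  constructor mkSplit
  field
    rest   : List (Tree n)
    before : forest w ↭ treeAt w a ∷ treeAt w b ∷ rest
    after  : forest w' ↭ treeAt w' a ∷ rest

map-cong-∉ : ∀ {n} {B : Set} {f g : Fin n → B} {a} → (∀ {c} → c ≢ a → f c ≡ g c) → ∀ L → a ∉ L → map f L ≡ map g L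
map-cong-∉ h [] _ = refl
map-cong-∉ h (c ∷ L) a∉ = cong₂ _∷_ (h (λ e → a∉ (here (sym e)))) (map-cong-∉ h L (a∉ ∘ there))

forest-split : ∀ {n} {w w' : Word n} ℓ → Fresh ℓ w → snds w' ↭ snd ℓ ∷ snds w →
               (∀ {c} → c ≢ fst ℓ → treeAt w' c ≡ treeAt w c) → ForestSplit w w' (fst ℓ) (snd ℓ)
forest-split {w = w} {w'} ℓ (a<b , a∉ , b∉) p agree with live-split {w = w} {w'} a∉ b∉ (FP.<⇒≢ a<b) p
... | L , e , e' , a∉L = mkSplit (map (treeAt w) L) (↭-map⁺ (treeAt w) e)
      (↭-trans (↭-map⁺ (treeAt w') e') (↭-reflexive (cong (treeAt w' (fst ℓ) ∷_) (map-cong-∉ agree L a∉L))))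

forest-Ins : ∀ {n} {w w' : Word n} {ℓ} → Valid w → Fresh ℓ w → Ins ℓ w w' → ForestSplit w w' (fst ℓ) (snd ℓ)
forest-Ins {ℓ = ℓ} v fr i = forest-split ℓ fr (↭-map⁺ snd (Ins-↭ i)) (proj₁ (treeAt-Ins v fr i))

forest-∷ʳ : ∀ {n} {w : Word n} ℓ → Fresh ℓ w → ForestSplit w (w ∷ʳ ℓ) (fst ℓ) (snd ℓ)
forest-∷ʳ {w = w} ℓ fr = forest-split ℓ fr (↭-map⁺ snd (↭-++-comm w (ℓ ∷ []))) (treeAt-∷ʳ-other w ℓ)

forest-∷ʳ-node : ∀ {n} {w : Word n} ℓ → Fresh ℓ w → ∃ λ rest →
  forest w ↭ treeAt w (fst ℓ) ∷ treeAt w (snd ℓ) ∷ rest ×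
  forest (w ∷ʳ ℓ) ↭ node (col ℓ) (treeAt w (fst ℓ)) (treeAt w (snd ℓ)) ∷ rest
forest-∷ʳ-node {w = w} ℓ fr with forest-∷ʳ {w = w} ℓ fr
... | mkSplit rest e e' = rest , e , subst (λ t → forest (w ∷ʳ ℓ) ↭ t ∷ rest) (treeAt-∷ʳ-root w ℓ) e'

live-[] : ∀ {n} → live {n} [] ↭ allFin n
live-[] = set-↭ (live-unique []) (UP.allFin⁺ _) (λ _ → ∈-allFin _) (λ _ → ∈-live⁺ {w = []} (λ ()))

leaves-leaf : ∀ {n} (cs : List (Fin n)) → concatMap leaves (map leaf cs) ≡ cs
leaves-leaf [] = refl
leaves-leaf (c ∷ cs) = cong (c ∷_) (leaves-leaf cs)

forest-leaves : ∀ {n} {w : Word n} → Valid w → concatMap leaves (forest w) ↭ allFin n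
forest-leaves {n} {w} = go (reverseView w)
  where
  go : ∀ {w} → Reverse w → Valid w → concatMap leaves (forest w) ↭ allFin n
  go [] v = ↭-trans (↭-reflexive (leaves-leaf (live []))) live-[]
  go (w ∶ rs ∶ʳ ℓ) v with Valid-∷ʳ⁻ w v
  ... | v₁ , fr , _ with forest-∷ʳ-node {w = w} ℓ fr
  ...   | rest , e , e' = ↭-trans (↭-concatMap leaves e')
          (↭-trans (↭-reflexive (++-assoc (leaves (treeAt w (fst ℓ))) (leaves (treeAt w (snd ℓ)))
              (concatMap leaves rest)))
            (↭-trans (↭-sym (↭-concatMap leaves e)) (go rs v₁)))

increasing⁺ : ∀ {n} {ts : List (Tree n)} → AllPairs (λ t t' → ν t < ν t') ts → T (increasingν ts)
increasing⁺ [] = tt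
increasing⁺ ([] ∷ []) = tt
increasing⁺ ((lt ∷ _) ∷ ps@(_ ∷ _)) = from T-∧ (ℕP.<⇒<ᵇ lt , increasing⁺ ps)

increasing-∷⁻ : ∀ {n} (t : Tree n) ts → T (increasingν (t ∷ ts)) → AllPairs (λ t t' → ν t < ν t') (t ∷ ts)
increasing-∷⁻ t [] _ = [] ∷ []
increasing-∷⁻ t (y ∷ ts) h with to (T-∧ {ν t <ᵇ ν y}) h
... | t<y , h' with increasing-∷⁻ y ts h'
...   | q ∷ qs = (ℕP.<ᵇ⇒< _ _ t<y ∷ all-map (ℕP.<-trans (ℕP.<ᵇ⇒< _ _ t<y)) q) ∷ q ∷ qs

increasing⁻ : ∀ {n} (ts : List (Tree n)) → T (increasingν ts) → AllPairs (λ t t' → ν t < ν t') ts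
increasing⁻ [] _ = []
increasing⁻ (t ∷ ts) h = increasing-∷⁻ t ts h

allFin-increasing : ∀ n → AllPairs _<F_ (allFin n)
allFin-increasing n = AP.tabulate⁺-< id

forest-increasing : ∀ {n} {w : Word n} → Valid w → T (increasingν (forest w))
forest-increasing {n} {w} v = increasing⁺ (AP.map⁺ (allPairs-map lt (AP.filter⁺ _ (allFin-increasing n))))
  where
  lt : ∀ {c d} → c <F d → ν (treeAt w c) < ν (treeAt w d)
  lt {c} {d} c<d rewrite treeAt-ν v c | treeAt-ν v d = c<d

forest-valid : ∀ {n} {w : Word n} → Valid w → T (validForest (forest w))
forest-valid {n} {w} v = from T-∧ (pl , from T-∧ (forest-increasing v , from T-∧ (len , mem)))
  where
  ls = concatMap leaves (forest w)
  pl : T (all isPL (forest w))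
  pl = all-∈⁺ isPL (forest w) λ t∈ → let c , _ , e = ∈-forest⁻ {w = w} t∈ in subst (T ∘ isPL) (sym e) (treeAt-PL v c)
  len : T (length ls ≡ᵇ n)
  len = ℕP.≡⇒≡ᵇ _ _ (trans (↭-length (forest-leaves v)) (length-tabulate {n = n} id))
  mem : T (all (λ i → memB i ls) (allFin n))
  mem = all-∈⁺ (λ i → memB i ls) (allFin n) λ {i} _ → memB-∈ i ls (∈-resp-↭ (↭-sym (forest-leaves v)) (∈-allFin i))

toForest : ∀ {n} {w : Word n} → Valid w → PLForest n
toForest {w = w} v = mkForest (forest w) (forest-valid v)

-- Both lists increase strictly in `ν`, so a permutation between them is an equality, and validity
-- is a proposition.
PLForest-≡ : ∀ {n} {F G : PLForest n} → trees F ↭ trees G → F ≡ G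
PLForest-≡ {F = mkForest ts h} {mkForest us h'} p
  with sorted-unique ℕP.<-asym (increasing⁻ ts (proj₁ (to (T-∧ {increasingν ts}) (proj₂ (to (T-∧ {all isPL ts}) h)))))
                               (increasing⁻ us (proj₁ (to (T-∧ {increasingν us}) (proj₂ (to
                                   (T-∧ {all isPL us}) h'))))) p
... | refl = cong (mkForest ts) (T-irrelevant h h')

-- Recovering the word of a forest

-- Stated for variable subtrees so that the equation between the roots can be matched with `refl`.
unnode : ∀ {n} {u u'} {l l' r r' : Tree n} {ts ts' us us' rest rest'} → node u l r ≡ node u' l' r' →
         ts ↭ node u l r ∷ rest → ts' ↭ node u' l' r' ∷ rest' → us ↭ l ∷ r ∷ rest → us' ↭ l' ∷ r' ∷ rest' →
         ts ↭ ts' → us ↭ us'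
unnode refl f f' e e' p =
  ↭-trans e (↭-trans (↭-prep _ (↭-prep _ (drop-∷ (↭-trans (↭-sym f) (↭-trans p f'))))) (↭-sym e'))

node-injective : ∀ {n} {u u'} {l l' r r' : Tree n} → node u l r ≡ node u' l' r' → u ≡ u' × r ≡ r'
node-injective refl = refl , refl

forest-node-≥ : ∀ {n} {w : Word n} {u l r} → Valid w → ∀ ℓ →
    All (_≥Λ ℓ) w → node u l r ∈ forest w → toℕ (fst ℓ) ≤ ν (node u l r)
forest-node-≥ {w = w} {u} v ℓ ge t∈ with ∈-forest⁻ {w = w} t∈
... | c , _ , e with treeAt-node v (sym e)
...   | b , ∈w , _ = subst (toℕ (fst ℓ) ≤_) (sym (trans (cong ν e) (treeAt-ν v c))) (key≤⇒fst≤ ℓ (c , b ,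
    u) (all-lookup ge ∈w))

forest-no-nodes : ∀ {n} {w : Word n} {ℓ} → Valid (w ∷ʳ ℓ) → ¬ (forest (w ∷ʳ ℓ) ↭ forest [])
forest-no-nodes {w = w} {ℓ} v p with Valid-∷ʳ⁻ w v
... | v₁ , fr , _ with forest-∷ʳ-node {w = w} ℓ fr
...   | _ , _ , e' with ∈-forest⁻ {w = []} (∈-resp-↭ p (∈-resp-↭ (↭-sym e') (here refl)))
...     | _ , _ , ()

∉-snds-∷ʳ : ∀ {n} {w : Word n} {ℓ} → Fresh ℓ w → fst ℓ ∉ snds (w ∷ʳ ℓ)
∉-snds-∷ʳ {w = w} {ℓ} (a<b , a∉ , _) a∈ with ∈-∷ʳ⁻ (snds w) (subst (fst ℓ ∈_) (map-++ snd w (ℓ ∷ [])) a∈)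
... | inj₁ a∈' = a∉ a∈'
... | inj₂ a≡b = FP.<⇒≢ a<b a≡b

-- The last letter of a word is read off the non-leaf tree with least minimum.
last-source-≤ : ∀ {n} {w w' : Word n} {ℓ ℓ'} → Valid (w ∷ʳ ℓ) →
    Valid (w' ∷ʳ ℓ') → forest (w ∷ʳ ℓ) ↭ forest (w' ∷ʳ ℓ') → fst ℓ ≤F fst ℓ'
last-source-≤ {w = w} {w'} {ℓ} {ℓ'} v v' p with Valid-∷ʳ⁻ w v | Valid-∷ʳ⁻ w' v'
... | _ , _ , ge | v₁' , fr'@(a<b , _) , _ with forest-∷ʳ-node {w = w'} ℓ' fr'
...   | _ , _ , f' = subst (toℕ (fst ℓ) ≤_) ν-new
        (forest-node-≥ v ℓ (All-∷ʳ⁺ ge ℕP.≤-refl) (∈-resp-↭ (↭-sym p) (∈-resp-↭ (↭-sym f') (here refl))))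
  where
  ν-new : ν (node (col ℓ') (treeAt w' (fst ℓ')) (treeAt w' (snd ℓ'))) ≡ toℕ (fst ℓ')
  ν-new = trans (cong₂ _⊓_ (treeAt-ν v₁' (fst ℓ')) (treeAt-ν v₁' (snd ℓ'))) (ℕP.m≤n⇒m⊓n≡m (ℕP.<⇒≤ a<b))

-- Trees with equal minimum in the two forests coincide. The root shows the colour, and the minimum
-- of its right child is the target; removing the root from both sides leaves the shorter forests.
last-unique : ∀ {n} {w w' : Word n} {ℓ ℓ'} → Valid (w ∷ʳ ℓ) → Valid (w' ∷ʳ ℓ') → forest (w ∷ʳ ℓ) ↭ forest (w' ∷ʳ ℓ') →
              fst ℓ ≡ fst ℓ' → ℓ ≡ ℓ' × forest w ↭ forest w'
last-unique {w = w} {w'} {ℓ@(a , b , u)} {ℓ'@(_ , b' , u')} v v' p refl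
  with Valid-∷ʳ⁻ w v | Valid-∷ʳ⁻ w' v'
... | v₁ , fr , _ | v₁' , fr' , _
  with ∈-forest⁻ {w = w' ∷ʳ ℓ'} (∈-resp-↭ p (∈-forest⁺ {w = w ∷ʳ ℓ} {a} (∉-snds-∷ʳ {w = w} fr)))
... | c , _ , e₁ with treeAt-injective v v' e₁
... | refl with trans (sym (treeAt-∷ʳ-root w ℓ)) (trans e₁ (treeAt-∷ʳ-root w' ℓ'))
... | e with node-injective e | forest-∷ʳ-node {w = w} ℓ fr | forest-∷ʳ-node {w = w'} ℓ' fr'
... | refl , er | rest , g , f | rest' , g' , f' with treeAt-injective v₁ v₁' er
... | refl = refl , unnode e f f' g g' p

forest-injective : ∀ {n} {w w' : Word n} → Valid w → Valid w' → forest w ↭ forest w' → w ≡ w'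
forest-injective {n} {w} {w'} = go (reverseView w) (reverseView w')
  where
  go : ∀ {w w'} → Reverse w → Reverse w' → Valid w → Valid w' → forest w ↭ forest w' → w ≡ w'
  go [] [] _ _ _ = refl
  go [] (_ ∶ _ ∶ʳ _) _ v' p = ⊥-elim (forest-no-nodes v' (↭-sym p))
  go (_ ∶ _ ∶ʳ _) [] v _ p = ⊥-elim (forest-no-nodes v p)
  go (w ∶ rs ∶ʳ ℓ) (w' ∶ rs' ∶ʳ ℓ') v v' p =
    cong₂ _∷ʳ_ (go rs rs' (proj₁ (Valid-∷ʳ⁻ w v)) (proj₁ (Valid-∷ʳ⁻ w' v')) (proj₂ same)) (proj₁ same)
    where
    same : ℓ ≡ ℓ' × forest w ↭ forest w'
    same = last-unique {w = w} {w'} v v' p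
      (FP.≤-antisym (last-source-≤ {w = w} {w'} {ℓ} {ℓ'} v v' p) (last-source-≤ {w = w'} {w} {ℓ'} {ℓ} v' v (↭-sym p)))

data IsLeaf {n} : Tree n → Set where
  isLeaf : ∀ c → IsLeaf (leaf c)

least-node : ∀ {n} (ts : List (Tree n)) → (∃ λ cs → ts ≡ map leaf cs) ⊎
  (Σ[ u ∈ Fin 2 ] ∃ λ l → ∃ λ r → ∃ λ rest → ts ↭ node u l r ∷ rest × All (λ t → IsLeaf t ⊎ ν (node u l r) ≤ ν t) rest)
least-node [] = inj₁ ([] , refl)
least-node (t ∷ ts) with least-node ts
least-node (leaf c ∷ ts) | inj₁ (cs , refl) = inj₁ (c ∷ cs , refl)
least-node (node u l r ∷ ts) | inj₁ (cs , refl) = inj₂ (u , l , r , _ , ↭-refl ,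
    All-map⁺ (all-tabulate λ _ → inj₁ (isLeaf _)))
least-node (leaf c ∷ ts) | inj₂ (u , l , r , rest , p , h) =
  inj₂ (u , l , r , leaf c ∷ rest , ↭-trans (↭-prep _ p) (↭-swap _ _ ↭-refl) , inj₁ (isLeaf c) ∷ h)
least-node (t@(node u' l' r') ∷ ts) | inj₂ (u , l , r , rest , p , h) with ℕP.≤-total (ν (node u l r)) (ν t)
... | inj₁ le = inj₂ (u , l , r , t ∷ rest , ↭-trans (↭-prep _ p) (↭-swap _ _ ↭-refl) , inj₂ le ∷ h)
... | inj₂ le = inj₂ (u' , l' , r' , ts , ↭-refl ,
      All-resp-↭ (↭-sym p) (inj₂ le ∷ all-map [ inj₁ , (λ le' → inj₂ (ℕP.≤-trans le le')) ]′ h))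

-- Serves as a measure: only the length, the number of internal vertices, matters. A list lets the
-- permutation lemmas for `concatMap` apply.
colours : ∀ {n} → Tree n → List (Fin 2)
colours (leaf _) = []
colours (node u l r) = u ∷ colours l ++ colours r

Desc-last-≥ : ∀ {n} {ℓ : Lab n} w → Desc w → (∀ w₁ y → w ≡ w₁ ∷ʳ y → y ≥Λ ℓ) → All (_≥Λ ℓ) w
Desc-last-≥ {ℓ = ℓ} w = go (reverseView w)
  where
  go : ∀ {w} → Reverse w → Desc w → (∀ w₁ y → w ≡ w₁ ∷ʳ y → y ≥Λ ℓ) → All (_≥Λ ℓ) w
  go [] _ _ = []
  go (w ∶ _ ∶ʳ y) d h = All-∷ʳ⁺ (all-map (ℕP.≤-trans (h w y refl)) (proj₂ (AllPairs-∷ʳ⁻ w d))) (h w y refl)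

-- It suffices to compare the last letter `y` of `w` with the new one. Its tree is still present
-- after the split. If that tree is `l`, the left condition at the root gives the comparison; if it
-- is `r` or lies in `rest`, its minimum exceeds `a`, by normalization or by the choice of the least
-- tree.
forest-extend : ∀ {n} {ts rest : List (Tree n)} {u l r w} → ts ↭ node u l r ∷ rest →
                All (λ t → IsLeaf t ⊎ ν (node u l r) ≤ ν t) rest → T (isPL (node u l r)) →
                Valid w → l ∷ r ∷ rest ↭ forest w → ∃ λ w → Valid w × ts ↭ forest w
forest-extend {u = u} {l} {r} {w} p least plt v q
  with isPL-node⁻ u l r plt
... | norm , cond , _ , _
  with ∈-forest⁻ {w = w} (∈-resp-↭ q (here refl)) | ∈-forest⁻ {w = w} (∈-resp-↭ q (there (here refl)))
                   | Unique-resp-↭ (↭-sym q) (forest-unique v)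
... | a , a∉ , refl | b , b∉ , refl | (l≢r ∷ l∉) ∷ _ = w ∷ʳ ℓ , Valid-∷ʳ⁺ v fr ge ,
    ↭-trans p (↭-trans (↭-prep _ (drop-∷ (drop-∷ (↭-trans q (proj₁ (proj₂ new)))))) (↭-sym (proj₂ (proj₂ new))))
  where
  ℓ = a , b , u
  ν-root : ν (treeAt w a) ⊓ ν (treeAt w b) ≡ toℕ a
  ν-root = trans norm (treeAt-ν v a)
  a≢b : a ≢ b
  a≢b e = l≢r (cong (treeAt w) e)
  a≤b : toℕ a ≤ toℕ b
  a≤b = subst (_≤ toℕ b) ν-root (ℕP.≤-trans (ℕP.m⊓n≤n (ν (treeAt w a)) (ν (treeAt w b))) (ℕP.≤-reflexive
      (treeAt-ν v b)))
  fr : Fresh ℓ w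
  fr = FP.≤∧≢⇒< a≤b a≢b , a∉ , b∉
  new = forest-∷ʳ-node {w = w} ℓ fr
  >⇒≥Λ : ∀ y → a <F fst y → y ≥Λ ℓ
  >⇒≥Λ (a' , b' , u') lt = ℕP.<⇒≤ (<Λ⇒key< {x = ℓ} {a' , b' , u'} (lt-fst lt))
  last-≥ : ∀ w₁ y → w ≡ w₁ ∷ʳ y → y ≥Λ ℓ
  last-≥ w₁ y@(a' , b' , u') refl with Valid-∷ʳ⁻ w₁ v
  ... | v₁ , fr₁ , _ with ∈-resp-↭ (↭-sym q) (∈-forest⁺ {w = w₁ ∷ʳ y} {a'} (∉-snds-∷ʳ {w = w₁} {y} fr₁))
  ... | here e with treeAt-injective v v e
  ...   | refl = leftCond⇒≥ a b b' u u' {treeAt w₁ a} {treeAt w₁ b'} {treeAt (w₁ ∷ʳ y) b} (treeAt-ν v₁ b')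
      (treeAt-ν v b)
                   (subst (λ t → T (leftCond u t (treeAt (w₁ ∷ʳ y) b))) (treeAt-∷ʳ-root w₁ y) cond)
  last-≥ w₁ y@(a' , b' , u') refl | v₁ , fr₁ , _ | there (here e) with treeAt-injective v v e
  ...   | refl = >⇒≥Λ y (proj₁ fr)
  last-≥ w₁ y@(a' , b' , u') refl | v₁ , fr₁ , _ | there (there y∈) with all-lookup least y∈
  ...   | inj₁ lf with subst IsLeaf (treeAt-∷ʳ-root w₁ y) lf
  ...     | ()
  last-≥ w₁ y@(a' , b' , u') refl | v₁ , fr₁ , _ | there (there y∈) | inj₂ le =
    >⇒≥Λ y (FP.≤∧≢⇒< (subst (_≤ toℕ a') ν-root (subst (ν (treeAt w a) ⊓ ν (treeAt w b) ≤_) (treeAt-ν v a') le))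
      (λ { refl → all-lookup l∉ y∈ refl }))
  ge : All (_≥Λ ℓ) w
  ge = Desc-last-≥ w (desc v) last-≥

-- Undoing the last merge: the non-leaf tree with least minimum is split at its root.
forest-surjective : ∀ {n} k (ts : List (Tree n)) → length (concatMap colours ts) ≤ k → All (T ∘ isPL) ts →
                    concatMap leaves ts ↭ allFin n → ∃ λ w → Valid w × ts ↭ forest w
forest-surjective k ts le pl lv with least-node ts
... | inj₁ (cs , refl) = [] , Valid-[] , ↭-map⁺ leaf (↭-trans (↭-trans (↭-reflexive (sym
    (leaves-leaf cs))) lv) (↭-sym live-[]))
forest-surjective zero ts le pl lv | inj₂ (u , l , r , rest , p , least)
  with subst (_≤ 0) (↭-length (↭-concatMap colours p)) le
... | ()
forest-surjective (suc k) ts le pl lv | inj₂ (u , l , r , rest , p , least)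
  with All-resp-↭ p pl
... | plt ∷ pls = let w , v , q = forest-surjective k (l ∷ r ∷ rest) le' (pll ∷ plr ∷ pls) lv' in forest-extend p least plt v q
  where
  pll = proj₁ (proj₂ (proj₂ (isPL-node⁻ u l r plt)))
  plr = proj₂ (proj₂ (proj₂ (isPL-node⁻ u l r plt)))
  le' : length (concatMap colours (l ∷ r ∷ rest)) ≤ k
  le' = subst (λ cs → length cs ≤ k) (++-assoc (colours l) (colours r) (concatMap colours rest))
          (ℕP.≤-pred (subst (_≤ suc k) (↭-length (↭-concatMap colours p)) le))
  lv' : concatMap leaves (l ∷ r ∷ rest) ↭ allFin _
  lv' = ↭-trans (↭-sym (↭-trans (↭-concatMap leaves p) (↭-reflexive (++-assoc (leaves l) (leaves r) _)))) lv

unique⊆⇒↭ : {A : Set} {xs ys : List A} → Unique xs → (∀ {z} → z ∈ xs → z ∈ ys) → length ys ≤ length xs → xs ↭ ys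
unique⊆⇒↭ {xs = []} {[]} _ _ _ = ↭-refl
unique⊆⇒↭ {xs = x ∷ xs} (x∉ ∷ u) sub le with ∈-∃++ (sub (here refl))
... | ys₁ , ys₂ , refl = ↭-trans (↭-prep x (unique⊆⇒↭ u sub' le')) (↭-sym (shift x ys₁ ys₂))
  where
  sub' : ∀ {z} → z ∈ xs → z ∈ ys₁ ++ ys₂
  sub' z∈ with ∈-resp-↭ (shift x ys₁ ys₂) (sub (there z∈))
  ... | here e = ⊥-elim (all-lookup x∉ z∈ (sym e))
  ... | there z∈' = z∈'
  le' : length (ys₁ ++ ys₂) ≤ length xs
  le' = ℕP.≤-pred (ℕP.≤-trans (ℕP.≤-reflexive (sym (↭-length (shift x ys₁ ys₂)))) le)

memB⇒∈ : ∀ {n} {i : Fin n} is → T (memB i is) → i ∈ is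
memB⇒∈ {i = i} (j ∷ js) t with i ≟F j
... | yes e = here e
... | no _ = there (memB⇒∈ js t)

validForest-leaves : ∀ {n} (ts : List (Tree n)) → T (validForest ts) →
    All (T ∘ isPL) ts × concatMap leaves ts ↭ allFin n
validForest-leaves {n} ts h with to (T-∧ {all isPL ts}) h
... | pl , h₁ with to (T-∧ {length (concatMap leaves ts) ≡ᵇ n}) (proj₂ (to (T-∧ {increasingν ts}) h₁))
...   | len , mem = all-tabulate (all-T⁻ isPL ts pl) ,
        ↭-sym (unique⊆⇒↭ (UP.allFin⁺ n) (λ {i} i∈ → memB⇒∈ _ (all-T⁻ (λ i → memB i (concatMap leaves ts))
            (allFin n) mem i∈))
          (ℕP.≤-reflexive (trans (ℕP.≡ᵇ⇒≡ _ _ len) (sym (length-tabulate {n = n} id)))))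

abstract
  private
    word′ : ∀ {n} (F : PLForest n) → ∃ λ w → Valid w × trees F ↭ forest w
    word′ F with validForest-leaves (trees F) (valid F)
    ... | pl , lv = forest-surjective _ (trees F) ℕP.≤-refl pl lv

  -- Kept opaque: validity and `word-forest` determine it by `forest-injective`, and the recursion
  -- that finds it should not unfold.
  word : ∀ {n} → PLForest n → Word n
  word F = proj₁ (word′ F)

  word-valid : ∀ {n} (F : PLForest n) → Valid (word F)
  word-valid F = proj₁ (proj₂ (word′ F))

  word-forest : ∀ {n} (F : PLForest n) → trees F ↭ forest (word F)
  word-forest F = proj₂ (proj₂ (word′ F))

word-toForest : ∀ {n} {w : Word n} (v : Valid w) → word (toForest v) ≡ w
word-toForest v = sym (forest-injective v (word-valid _) (word-forest (toForest v)))

word-injective : ∀ {n} {F G : PLForest n} → word F ≡ word G → F ≡ G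
word-injective {F = F} {G} e = PLForest-≡ (↭-trans (word-forest F) (↭-trans (↭-reflexive (cong forest e))
    (↭-sym (word-forest G))))

word-𝟘 : ∀ {n} → word (FLyn-bottom n) ≡ []
word-𝟘 {n} = sym (forest-injective Valid-[] (word-valid _)
  (↭-trans (↭-map⁺ leaf live-[]) (word-forest (FLyn-bottom n))))

-- Covers of forests and the isomorphism with R

WCover⇒FCover : ∀ {n} (F G : PLForest n) → WCover (word F) (word G) → FCover F G
WCover⇒FCover F G (ℓ@(a , b , u) , v , fr@(a<b , _) , i) with forest-Ins v fr i
... | mkSplit rest e e' = treeAt (word F) a , treeAt (word F) b , rest , u , treeAt (word G) a ,
  ↭-trans (word-forest F) e ,
  ℕP.≤-trans (s≤s (ℕP.≤-reflexive (treeAt-ν v a))) (ℕP.≤-trans a<b (ℕP.≤-reflexive (sym (treeAt-ν v b)))) ,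
  proj₂ (treeAt-Ins v fr i) , ↭-trans (word-forest G) e'

-- The minima of the two trees and the colour form the letter. Inserting it into the word of `F`
-- performs a merge of the same two trees, and a merge has only one result, so the new forest is
-- `G`.
FCover⇒WCover : ∀ {n} (F G : PLForest n) → FCover F G → WCover (word F) (word G)
FCover⇒WCover F G (t₁ , t₂ , rest , u , t , e , lt , mt , e')
  with ∈-forest⁻ {w = word F} (∈-resp-↭ (↭-trans (↭-sym e) (word-forest F)) (here refl))
     | ∈-forest⁻ {w = word F} (∈-resp-↭ (↭-trans (↭-sym e) (word-forest F)) (there (here refl)))
... | a , a∉ , refl | b , b∉ , refl = ℓ , v , fr , subst (Ins ℓ (word F)) (sym same) ins
  where
  ℓ = a , b , u
  v = word-valid F
  a<b : a <F b
  a<b = ℕP.≤-trans (s≤s (ℕP.≤-reflexive (sym (treeAt-ν v a)))) (ℕP.≤-trans lt (ℕP.≤-reflexive (treeAt-ν v b)))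
  fr : Fresh ℓ (word F)
  fr = a<b , a∉ , b∉
  w' = proj₁ (insertion ℓ (desc v))
  ins = proj₂ (insertion ℓ (desc v))
  open ForestSplit (forest-Ins v fr ins) renaming (rest to rest′)
  rest↭ : rest ↭ rest′
  rest↭ = drop-∷ (drop-∷ (↭-trans (↭-sym e) (↭-trans (word-forest F) before)))
  same : word G ≡ w'
  same = forest-injective (word-valid G) (Ins-Valid v fr ins)
    (↭-trans (↭-sym (word-forest G)) (↭-trans e' (↭-trans (↭-reflexive (cong (_∷ rest)
        (MergeTo-functional mt (proj₂ (treeAt-Ins v fr ins)))))
      (↭-trans (↭-prep _ rest↭) (↭-sym after)))))

toR : ∀ {n} → PLForest n → PointedPartition n × Word n
toR F = run (word F) , word F

Leq⇒Star : ∀ {n} {F G : PLForest n} → Leq (FLyn• n) F G → Star WCover (word F) (word G)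
Leq⇒Star = gmap word (λ {F} {G} → FCover⇒WCover F G)

-- The equations are there for the induction: an intermediate word becomes the word of a forest only
-- through `toForest`.
Star⇒Leq : ∀ {n} {w w'} {F G : PLForest n} → word F ≡ w → word G ≡ w' → Star WCover w w' → Leq (FLyn• n) F G
Star⇒Leq {n} {F = F} e e' ε = subst (Leq (FLyn• n) F) (word-injective (trans e (sym e'))) ε
Star⇒Leq {F = F} refl e' (c ◅ cs) =
  WCover⇒FCover F (toForest v) (subst (WCover (word F)) (sym (word-toForest v)) c) ◅ Star⇒Leq (word-toForest v) e' cs
  where v = proj₂ (WCover⇒Valid c)

FLyn≅R : ∀ n → RΠ.IsoToR n (FLyn• n)
FLyn≅R n = toR , (λ F → Valid⇒InR (word-valid F)) , (λ F G e → word-injective (cong proj₂ e)) , onto ,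
  (λ F G → mk⇔ (gmap (λ w → run w , w) WCover⇒RCover ∘ Leq⇒Star) (Star⇒Leq refl refl ∘ gmap proj₂ RCover⇒WCover))
  where
  onto : ∀ p → RΠ.InR n p → Σ[ F ∈ PLForest n ] toR F ≡ p
  onto (x , w) r with InR⇒Valid r
  ... | v , refl = toForest v , cong (λ w → run w , w) (word-toForest v)

-- Intervals of forests as order ideals

-- For e before ℓ in a valid word: the two merges can be made in either order.
Indep : ∀ {n} → Lab n → Lab n → Set
Indep e ℓ = snd ℓ ≢ fst e × key ℓ ≢ key e

indep? : ∀ {n} (e : Lab n) v → Dec (All (Indep e) v)
indep? e = all? (λ ℓ → ¬? (snd ℓ ≟F fst e) ×-dec ¬? (key ℓ ℕP.≟ key e))

-- The order ideals of the set of letters of w, where a letter lies above those it depends on.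
-- The first letter is a minimal element.
lower : ∀ {n} → Word n → List (Word n)
lower [] = [] ∷ []
lower (e ∷ w) = map (e ∷_) (lower w) ++ filter (indep? e) (lower w)

data Ideal {n} : Word n → Word n → Set where
  []   : Ideal [] []
  keep : ∀ {e v w} → Ideal v w → Ideal (e ∷ v) (e ∷ w)
  drop : ∀ {e v w} → All (Indep e) v → Ideal v w → Ideal v (e ∷ w)

∈-lower⁺ : ∀ {n} {v w : Word n} → Ideal v w → v ∈ lower w
∈-lower⁺ [] = here refl
∈-lower⁺ (keep i) = ∈-++⁺ˡ (∈-map⁺ _ (∈-lower⁺ i))
∈-lower⁺ {w = e ∷ w} (drop h i) = ∈-++⁺ʳ (map (e ∷_) (lower w)) (∈-filter⁺ (indep? e) (∈-lower⁺ i) h)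

∈-lower⁻ : ∀ {n} {v} (w : Word n) → v ∈ lower w → Ideal v w
∈-lower⁻ [] (here refl) = []
∈-lower⁻ (e ∷ w) v∈ with ∈-++⁻ (map (e ∷_) (lower w)) v∈
... | inj₁ v∈' with ∈-map⁻ (e ∷_) v∈'
...   | v' , v'∈ , refl = keep (∈-lower⁻ w v'∈)
∈-lower⁻ (e ∷ w) v∈ | inj₂ v∈' with ∈-filter⁻ (indep? e) {xs = lower w} v∈'
...   | v∈'' , h = drop h (∈-lower⁻ w v∈'')

Ideal-⊆ : ∀ {n} {v w : Word n} → Ideal v w → ∀ {x} → x ∈ v → x ∈ w
Ideal-⊆ (keep i) (here e) = here e
Ideal-⊆ (keep i) (there x∈) = there (Ideal-⊆ i x∈)
Ideal-⊆ (drop _ i) x∈ = there (Ideal-⊆ i x∈)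

lower-unique : ∀ {n} {w : Word n} → Unique w → Unique (lower w)
lower-unique {w = []} _ = [] ∷ []
lower-unique {w = e ∷ w} (e∉ ∷ u) = UP.++⁺ (UP.map⁺ ∷-injectiveʳ (lower-unique u)) (UP.filter⁺ (indep? e)
    (lower-unique u)) disj
  where
  disj : ∀ {v} → ¬ (v ∈ map (e ∷_) (lower w) × v ∈ filter (indep? e) (lower w))
  disj (p , q) with ∈-map⁻ (e ∷_) p
  ... | v' , _ , refl = all-lookup e∉ (Ideal-⊆ (∈-lower⁻ w (proj₁ (∈-filter⁻ (indep? e) {xs =
      lower w} q))) (here refl)) refl

Valid-∷-⊆ : ∀ {n} {e : Lab n} {v w} → Valid (e ∷ w) → Valid v → (∀ {x} → x ∈ v → x ∈ w) → Valid (e ∷ v)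
Valid-∷-⊆ (mkValid (p ∷ _) (b∉ ∷ _) (ge ∷ _)) (mkValid ps us ds) sub = mkValid (p ∷ ps)
  (All-map⁺ (all-tabulate λ x∈ → all-lookup b∉ (∈-map⁺ snd (sub x∈))) ∷ us) (all-tabulate (all-lookup ge ∘ sub) ∷ ds)

Ideal-Valid : ∀ {n} {v w : Word n} → Valid w → Ideal v w → Valid v
Ideal-Valid vw [] = vw
Ideal-Valid vw (keep i) = Valid-∷-⊆ vw (Ideal-Valid (Valid-∷⁻ vw) i) (Ideal-⊆ i)
Ideal-Valid vw (drop _ i) = Ideal-Valid (Valid-∷⁻ vw) i

WStar-⊆ : ∀ {n} {v w : Word n} → Star WCover v w → ∀ {x} → x ∈ v → x ∈ w
WStar-⊆ ε x∈ = x∈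
WStar-⊆ ((_ , _ , _ , i) ◅ cs) x∈ = WStar-⊆ cs (∈-resp-↭ (↭-sym (Ins-↭ i)) (there x∈))

-- The letter `e` is maximal and its target occurs nowhere in `w`, so keeping it in front disturbs
-- neither the freshness nor the place of any inserted letter.
WStar-∷ : ∀ {n} {e : Lab n} {v w} → Valid (e ∷ w) → Star WCover v w → Star WCover (e ∷ v) (e ∷ w)
WStar-∷ vw ε = ε
WStar-∷ {e = e} {v} {w} vw@(mkValid _ _ (ge ∷ _)) (c@(ℓ , vv , (a<b , a∉ , b∉) , i) ◅ cs) =
  (ℓ , Valid-∷-⊆ vw vv (WStar-⊆ (c ◅ cs)) ,
    (a<b , (λ { (here e) → proj₁ ≢e e ; (there p) → a∉ p }) , (λ { (here e) → proj₂ ≢e e ; (there p) → b∉ p })) ,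
    there (≥Λ⇒≮Λ (all-lookup ge ℓ∈)) i)
  ◅ WStar-∷ vw cs
  where
  ℓ∈ : ℓ ∈ w
  ℓ∈ = WStar-⊆ cs (∈-resp-↭ (↭-sym (Ins-↭ i)) (here refl))
  ≢e = all-lookup (fst∉snds vw) ℓ∈

-- A missing letter `e` is inserted at once: independence puts every letter of `v` strictly below
-- it, so it lands in front, and the remaining insertions take place behind it.
Ideal⇒WStar : ∀ {n} {v w : Word n} → Valid w → Ideal v w → Star WCover v w
Ideal⇒WStar vw [] = ε
Ideal⇒WStar vw (keep i) = WStar-∷ vw (Ideal⇒WStar (Valid-∷⁻ vw) i)
Ideal⇒WStar {v = v} {e ∷ w} vw@(mkValid (p ∷ _) (b∉ ∷ _) (ge ∷ _)) (drop h i) =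
  (e , Ideal-Valid vw (drop h i) , (p , fst∉ , snd∉) ,
    here (all-tabulate λ x∈ → key<⇒<Λ (ℕP.≤∧≢⇒< (all-lookup ge (Ideal-⊆ i x∈)) (proj₂ (all-lookup h x∈)))))
  ◅ WStar-∷ vw (Ideal⇒WStar (Valid-∷⁻ vw) i)
  where
  fst∉ : fst e ∉ snds v
  fst∉ a∈ with ∈-map⁻ snd a∈
  ... | x , x∈ , eq = proj₁ (all-lookup h x∈) (sym eq)
  snd∉ : snd e ∉ snds v
  snd∉ b∈ with ∈-map⁻ snd b∈
  ... | x , x∈ , eq = all-lookup b∉ (∈-map⁺ snd (Ideal-⊆ i x∈)) eq

Ins-⊆ : ∀ {n} {ℓ : Lab n} {v v'} → Ins ℓ v v' → ∀ {x} → x ∈ v → x ∈ v'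
Ins-⊆ i x∈ = ∈-resp-↭ (↭-sym (Ins-↭ i)) (there x∈)

-- An inserted letter is a maximal element of the ideal: those behind it have strictly smaller keys
-- and do not have `fst ℓ` as target, so none depends on it and it may be removed.
Ins-Ideal : ∀ {n} {ℓ : Lab n} {v v' w} → fst ℓ ∉ snds v → Ins ℓ v v' → Ideal v' w → Ideal v w
Ins-Ideal a∉ (here lts) (keep i) =
  drop (all-tabulate λ x∈ → (λ e → a∉ (subst (_∈ _) e (∈-map⁺ snd x∈))) , ℕP.<⇒≢ (<Λ⇒key< (all-lookup lts x∈))) i
Ins-Ideal a∉ (there _ ins) (keep i) = keep (Ins-Ideal (a∉ ∘ there) ins i)
Ins-Ideal a∉ ins (drop h i) = drop (all-tabulate (all-lookup h ∘ Ins-⊆ ins)) (Ins-Ideal a∉ ins i)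

Ideal-refl : ∀ {n} (w : Word n) → Ideal w w
Ideal-refl [] = []
Ideal-refl (e ∷ w) = keep (Ideal-refl w)

WStar⇒Ideal : ∀ {n} {v w : Word n} → Star WCover v w → Ideal v w
WStar⇒Ideal ε = Ideal-refl _
WStar⇒Ideal ((_ , _ , (_ , a∉ , _) , ins) ◅ cs) = Ins-Ideal a∉ ins (WStar⇒Ideal cs)

Ideal-[] : ∀ {n} (w : Word n) → Ideal [] w
Ideal-[] [] = []
Ideal-[] (e ∷ w) = drop [] (Ideal-[] w)

-- Rank and Möbius function of the forest poset

combSign : ∀ {n} → Word n → ℤ
combSign [] = 1ℤ
combSign (e ∷ v) = if does (indep? e v) then - combSign v else 0ℤ

sumℤ-++ : ∀ xs ys → sumℤ (xs ++ ys) ≡ sumℤ xs +ℤ sumℤ ys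
sumℤ-++ [] ys = sym (ℤP.+-identityˡ _)
sumℤ-++ (x ∷ xs) ys = trans (cong (x +ℤ_) (sumℤ-++ xs ys)) (sym (ℤP.+-assoc x (sumℤ xs) (sumℤ ys)))

-- An antichain of letters either contains the minimal letter e or can be extended by it.
combSign-cancel : ∀ {n} (e : Lab n) vs → sumℤ (map combSign (map (e ∷_) vs))
    +ℤ sumℤ (map combSign (filter (indep? e) vs)) ≡ 0ℤ
combSign-cancel e [] = refl
combSign-cancel e (v ∷ vs) with indep? e v
... | yes _ = trans (interchange (- combSign v) _ (combSign v) _) (cong₂ _+ℤ_ (ℤP.+-inverseˡ (combSign v))
    (combSign-cancel e vs))
... | no _ = trans (cong (_+ℤ sumℤ (map combSign (filter (indep? e) vs))) (ℤP.+-identityˡ (sumℤ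
    (map combSign (map (e ∷_) vs)))))
                   (combSign-cancel e vs)

lower-sum : ∀ {n} {w : Word n} → w ≢ [] → sumℤ (map combSign (lower w)) ≡ 0ℤ
lower-sum {w = []} w≢ = ⊥-elim (w≢ refl)
lower-sum {w = e ∷ w} _ = trans (cong sumℤ (map-++ combSign (map (e ∷_) (lower w)) _))
  (trans (sumℤ-++ (map combSign (map (e ∷_) (lower w))) _) (combSign-cancel e (lower w)))

forestsOf : ∀ {n} {ws : List (Word n)} → All Valid ws → List (PLForest n)
forestsOf [] = []
forestsOf (v ∷ vs) = toForest v ∷ forestsOf vs

word-forestsOf : ∀ {n} {ws : List (Word n)} (vs : All Valid ws) → map word (forestsOf vs) ≡ ws
word-forestsOf [] = refl
word-forestsOf (v ∷ vs) = cong₂ _∷_ (word-toForest v) (word-forestsOf vs)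

forests-enum : ∀ {n} {Q : Word n → Set} {ws} → EnumOf Q ws → (∀ {w} → Q w → Valid w) →
               ∃ λ Fs → map word Fs ≡ ws × EnumOf (Q ∘ word) Fs
forests-enum {Q = Q} {ws} (u , sound , complete) QV = forestsOf vs , word-forestsOf vs ,
  UP.map⁻ (subst Unique (sym (word-forestsOf vs)) u) ,
  (λ F F∈ → sound _ (subst (word F ∈_) (word-forestsOf vs) (∈-map⁺ word F∈))) ,
  complete'
  where
  vs : All Valid ws
  vs = all-tabulate (λ w∈ → QV (sound _ w∈))
  complete' : ∀ F → Q (word F) → F ∈ forestsOf vs
  complete' F q with ∈-map⁻ word (subst (word F ∈_) (sym (word-forestsOf vs)) (complete _ q))
  ... | G , G∈ , e = subst (_∈ forestsOf vs) (sym (word-injective e)) G∈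

ρFLyn : ∀ {n} → PLForest n → ℕ
ρFLyn F = length (word F)

μFLyn : ∀ {n} → PLForest n → ℤ
μFLyn F = combSign (word F)

Leq-𝟘 : ∀ {n} (F : PLForest n) → Leq (FLyn• n) (FLyn-bottom n) F
Leq-𝟘 F = Star⇒Leq word-𝟘 refl (Ideal⇒WStar (word-valid F) (Ideal-[] (word F)))

FLyn-graded : ∀ n → IsGradedBy (FLyn• n) ρFLyn
FLyn-graded n = Leq-𝟘 , cong length word-𝟘 , step
  where
  step : ∀ F G → FCover F G → ρFLyn G ≡ suc (ρFLyn F)
  step F G c with FCover⇒WCover F G c
  ... | _ , _ , _ , i = ↭-length (Ins-↭ i)

Valid⇒Unique : ∀ {n} {w : Word n} → Valid w → Unique w
Valid⇒Unique v = UP.map⁻ (unique v)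

FLyn-Möbius : ∀ n → IsMobius (FLyn• n) μFLyn
FLyn-Möbius n = cong combSign word-𝟘 , λ F F≢𝟘 → interval F F≢𝟘
  where
  interval : ∀ F → F ≢ FLyn-bottom n → Σ[ Gs ∈ List (PLForest n) ]
             EnumOf (λ G → Leq (FLyn• n) (FLyn-bottom n) G × Leq (FLyn• n) G F) Gs × sumℤ (map μFLyn Gs) ≡ 0ℤ
  interval F F≢𝟘 with forests-enum {ws = lower (word F)}
      (lower-unique (Valid⇒Unique (word-valid F)) , (λ w → ∈-lower⁻ (word F)) ,
          (λ w → ∈-lower⁺)) (Ideal-Valid (word-valid F))
  ... | Gs , e , (u , sound , complete) = Gs ,
    (u , (λ G G∈ → Leq-𝟘 G , Star⇒Leq refl refl (Ideal⇒WStar (word-valid F) (sound G G∈))) ,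
         (λ G (_ , le) → complete G (WStar⇒Ideal (Leq⇒Star le)))) ,
    trans (cong sumℤ (trans (map-∘ Gs) (cong (map combSign) e))) (lower-sum (λ eq →
        F≢𝟘 (word-injective (trans eq (sym word-𝟘)))))

-- The order of pointed partitions

least : ∀ {n} {P : Fin n → Set} → (∀ i → Dec (P i)) → ∃ P → ∃ λ i → P i × (∀ j → P j → i ≤F j)
least {suc n} {P} P? (k , pk) with P? fz
... | yes p0 = fz , p0 , λ _ _ → z≤n
... | no ¬p0 with least {n} {P ∘ fs} (P? ∘ fs) (shifted k pk)
  where
  shifted : ∀ k → P k → ∃ (P ∘ fs)
  shifted fz pk = ⊥-elim (¬p0 pk)
  shifted (fs k) pk = k , pk
...   | i , pi , lb = fs i , pi , λ { fz p0 → ⊥-elim (¬p0 p0) ; (fs j) pj → s≤s (lb j pj) }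

abstract
  minOf : ∀ {n} → PointedPartition n → Fin n → Fin n
  minOf π i = proj₁ (least (λ j → π ! j ≟F π ! i) (i , refl))

  minOf-! : ∀ {n} (π : PointedPartition n) i → π ! minOf π i ≡ π ! i
  minOf-! π i = proj₁ (proj₂ (least (λ j → π ! j ≟F π ! i) (i , refl)))

  minOf-≤ : ∀ {n} (π : PointedPartition n) i j → π ! j ≡ π ! i → minOf π i ≤F j
  minOf-≤ π i = proj₂ (proj₂ (least (λ j → π ! j ≟F π ! i) (i , refl)))

minOf-min : ∀ {n} (π : PointedPartition n) i → IsBlockMin π (minOf π i)
minOf-min π i j e = minOf-≤ π i j (trans e (minOf-! π i))

-- Pointed partitions are ordered like the idempotent maps encoding them.
record _⊑_ {n : ℕ} (y x : PointedPartition n) : Set where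
  constructor mk⊑
  field
    blocks : ∀ i → x ! (y ! i) ≡ x ! i
    points : ∀ i → y ! (x ! i) ≡ x ! i
open _⊑_

_⊑?_ : ∀ {n} (y x : PointedPartition n) → Dec (y ⊑ x)
y ⊑? x = map′ (λ (p , q) → mk⊑ p q) (λ (mk⊑ p q) → p ,
    q) (FP.all? (λ i → x ! (y ! i) ≟F x ! i) ×-dec FP.all? (λ i → y ! (x ! i) ≟F x ! i))

⊑-refl : ∀ {n} (x : PointedPartition n) → x ⊑ x
⊑-refl x = mk⊑ (!-idem x) (!-idem x)

⊑-trans : ∀ {n} {z y x : PointedPartition n} → z ⊑ y → y ⊑ x → z ⊑ x
⊑-trans {z = z} {y} {x} (mk⊑ zy zy') (mk⊑ yx yx') = mk⊑
  (λ i → trans (sym (yx (z ! i))) (trans (cong (x !_) (zy i)) (yx i)))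
  (λ i → trans (cong (z !_) (sym (yx' i))) (trans (zy' (x ! i)) (yx' i)))

⊑-coarsens : ∀ {n} {y x : PointedPartition n} → y ⊑ x → ∀ {i j} → y ! i ≡ y ! j → x ! i ≡ x ! j
⊑-coarsens {x = x} (mk⊑ yx _) {i} {j} e = trans (sym (yx i)) (trans (cong (x !_) e) (yx j))

⊑-fixed : ∀ {n} {y x : PointedPartition n} → y ⊑ x → ∀ {i} → x ! i ≡ i → y ! i ≡ i
⊑-fixed {y = y} (mk⊑ _ yx) {i} e = trans (cong (y !_) (sym e)) (trans (yx i) e)

𝟘-⊑ : ∀ {n} (x : PointedPartition n) → Π•-bottom n ⊑ x
𝟘-⊑ x = mk⊑ (λ i → cong (x !_) (𝟘-! i)) (λ i → 𝟘-! (x ! i))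

hit-fixed : ∀ {n} (π : PointedPartition n) {a b i} → Hit (π ! a) (π ! b) i → π ! i ≡ i
hit-fixed π (inj₁ refl) = !-idem π _
hit-fixed π (inj₂ refl) = !-idem π _

⊑-merge : ∀ {n} (π : PointedPartition n) ℓ → π ⊑ merge π ℓ
⊑-merge π ℓ = mk⊑ (λ i → merge-coarsens π ℓ (!-idem π i)) fixed
  where
  fixed : ∀ i → π ! (merge π ℓ ! i) ≡ merge π ℓ ! i
  fixed i with hit? (π ! fst ℓ) (π ! snd ℓ) (π ! i)
  ... | yes h rewrite merge-! π ℓ i | relabel-hit (col ℓ) h = hit-fixed π (newPt-hit (col ℓ) _ _)
  ... | no ¬h rewrite merge-! π ℓ i | relabel-miss (col ℓ) ¬h = !-idem π i

-- If the point of the `x`-block is one of the two points being merged, it has to win, for below `x`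
-- it must remain a point. If it is neither, the colour is irrelevant.
merge-⊑ : ∀ {n} {y x : PointedPartition n} ℓ → y ⊑ x → x ! fst ℓ ≡ x ! snd ℓ → x ! fst ℓ
    ≡ newPt (col ℓ) (y ! fst ℓ) (y ! snd ℓ) ⊎ ¬ Hit (y ! fst ℓ) (y ! snd ℓ) (x ! fst ℓ) → merge y ℓ ⊑ x
merge-⊑ {y = y} {x} ℓ@(a , b , u) (mk⊑ yx yx') e pt≡ = mk⊑ coarse fixed
  where
  p = y ! a
  q = y ! b
  x-hit : ∀ {i} → Hit p q i → x ! i ≡ x ! a
  x-hit (inj₁ refl) = yx a
  x-hit (inj₂ refl) = trans (yx b) (sym e)
  coarse : ∀ i → x ! (merge y ℓ ! i) ≡ x ! i
  coarse i with hit? p q (y ! i)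
  ... | no ¬h rewrite merge-! y ℓ i | relabel-miss u ¬h = yx i
  ... | yes h rewrite merge-! y ℓ i | relabel-hit u h = trans (x-hit (newPt-hit u p q)) (trans (sym (x-hit h)) (yx i))
  fixed : ∀ i → merge y ℓ ! (x ! i) ≡ x ! i
  fixed i with hit? p q (x ! i)
  ... | no ¬h rewrite merge-! y ℓ (x ! i) | yx' i = relabel-miss u ¬h
  ... | yes h rewrite merge-! y ℓ (x ! i) | yx' i = trans (relabel-hit u h) (sym (trans x≡ (winner pt≡)))
    where
    x≡ : x ! i ≡ x ! a
    x≡ = trans (sym (!-idem x i)) (x-hit h)
    winner : x ! a ≡ newPt u p q ⊎ ¬ Hit p q (x ! a) → x ! a ≡ newPt u p q
    winner (inj₁ e) = e
    winner (inj₂ ¬h) = ⊥-elim (¬h (subst (Hit p q) x≡ h))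

-- The smaller block minimum has to be the source, so the colour is chosen to make `p` survive: 1 if
-- the block of `p` has the smaller minimum, and 0 otherwise.
mergeInto : ∀ {n} (π : PointedPartition n) {p q} → π ! p ≡ p → π ! q ≡ q → p ≢ q →
            Σ[ ℓ ∈ Lab n ] Mergeable π ℓ × Hit p q (π ! fst ℓ) × Hit p q (π ! snd ℓ) ×
              newPt (col ℓ) (π ! fst ℓ) (π ! snd ℓ) ≡ p × (∀ {i} → Hit p q i → Hit (π ! fst ℓ) (π ! snd ℓ) i)
mergeInto π {p} {q} ep eq p≢q with FP.<-cmp (minOf π p) (minOf π q)
... | tri< lt _ _ = (minOf π p , minOf π q , fs fz) , (lt , minOf-min π p , minOf-min π q) ,
      inj₁ mp , inj₂ mq , mp , [ (λ e → inj₁ (trans e (sym mp))) , (λ e → inj₂ (trans e (sym mq))) ]′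
  where
  mp = trans (minOf-! π p) ep
  mq = trans (minOf-! π q) eq
... | tri≈ _ e _ = ⊥-elim (p≢q (trans (sym ep) (trans (sym (minOf-! π p)) (trans (cong (π !_) e) (trans
    (minOf-! π q) eq)))))
... | tri> _ _ gt = (minOf π q , minOf π p , fz) , (gt , minOf-min π q , minOf-min π p) ,
      inj₂ mq , inj₁ mp , mp , [ (λ e → inj₂ (trans e (sym mp))) , (λ e → inj₁ (trans e (sym mq))) ]′
  where
  mp = trans (minOf-! π p) ep
  mq = trans (minOf-! π q) eq

-- The list contains every place where `y` and `x` may still differ. At such an `i`, the block of
-- `i` in `y` is merged with the block of `x ! i`, whose point is `x ! i` and which keeps it; this
-- settles `i` and stays below `x`.
⊑⇒Leq′ : ∀ {n} (is : List (Fin n)) {y x : PointedPartition n} → y ⊑ x → (∀ j → j ∉ is → y ! j ≡ x ! j) → Leq (Π• n) y x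
⊑⇒Leq′ {n} [] {y} le agree = subst (Leq (Π• n) y) (PP-ext (λ j → agree j (λ ()))) ε
⊑⇒Leq′ (i ∷ is) {y} {x} le@(mk⊑ yx yx') agree with y ! i ≟F x ! i
... | yes e = ⊑⇒Leq′ is le agree'
  where
  agree' : ∀ j → j ∉ is → y ! j ≡ x ! j
  agree' j j∉ with j ≟F i
  ... | yes refl = e
  ... | no j≢i = agree j (λ { (here e) → j≢i e ; (there p) → j∉ p })
... | no y≢x with mergeInto y {x ! i} {y ! i} (yx' i) (!-idem y i) (y≢x ∘ sym)
...   | ℓ , m , ha , hb , np , hit = (ℓ , merge-cover y m) ◅ ⊑⇒Leq′ is (merge-⊑ ℓ le (trans (x-of ha) (sym
    (x-of hb))) (inj₁ (trans (x-of ha) (sym np)))) agree'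
  where
  x-hit : ∀ {j} → Hit (x ! i) (y ! i) j → x ! j ≡ x ! i
  x-hit (inj₁ refl) = !-idem x i
  x-hit (inj₂ refl) = yx i
  x-of : ∀ {j} → Hit (x ! i) (y ! i) (y ! j) → x ! j ≡ x ! i
  x-of h = trans (sym (yx _)) (x-hit h)
  new-hit : ∀ {j} → Hit (y ! fst ℓ) (y ! snd ℓ) (y ! j) → merge y ℓ ! j ≡ x ! i
  new-hit {j} h = trans (merge-! y ℓ j) (trans (relabel-hit (col ℓ) h) np)
  old-hit : ∀ {j} → Hit (y ! fst ℓ) (y ! snd ℓ) j → Hit (x ! i) (y ! i) j
  old-hit (inj₁ refl) = ha
  old-hit (inj₂ refl) = hb
  agree' : ∀ j → j ∉ is → merge y ℓ ! j ≡ x ! j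
  agree' j j∉ with hit? (y ! fst ℓ) (y ! snd ℓ) (y ! j)
  ... | yes h = trans (new-hit h) (sym (x-of (old-hit h)))
  ... | no ¬h with j ≟F i
  ...   | yes refl = ⊥-elim (¬h (hit (inj₂ refl)))
  ...   | no j≢i = trans (trans (merge-! y ℓ j) (relabel-miss (col ℓ) ¬h)) (agree j (λ { (here e) → j≢i e ;
      (there p) → j∉ p }))

⊑⇒Leq : ∀ {n} {y x : PointedPartition n} → y ⊑ x → Leq (Π• n) y x
⊑⇒Leq {n} le = ⊑⇒Leq′ (allFin n) le (λ j j∉ → ⊥-elim (j∉ (∈-allFin j)))

Leq⇒⊑ : ∀ {n} {y x : PointedPartition n} → Leq (Π• n) y x → y ⊑ x
Leq⇒⊑ ε = ⊑-refl _
Leq⇒⊑ {y = y} (_◅_ {j = z} (ℓ , c) cs) with cover⇒merge y z ℓ c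
... | refl = ⊑-trans (⊑-merge y ℓ) (Leq⇒⊑ cs)

-- The rank of pointed partitions

-- The number of elements that are not points, that is, `n` minus the number of blocks.
ρΠ : ∀ {n} → PointedPartition n → ℕ
ρΠ x = length (filter (λ i → ¬? (x ! i ≟F i)) (allFin _))

lost : ∀ {n} → Fin 2 → Fin n → Fin n → Fin n
lost fz     p q = p
lost (fs _) p q = q

hit-cases : ∀ {n} u {p q i : Fin n} → Hit p q i → i ≡ newPt u p q ⊎ i ≡ lost u p q
hit-cases fz (inj₁ e) = inj₂ e
hit-cases fz (inj₂ e) = inj₁ e
hit-cases (fs _) (inj₁ e) = inj₁ e
hit-cases (fs _) (inj₂ e) = inj₂ e

lost-hit : ∀ {n} u (p q : Fin n) → Hit p q (lost u p q)
lost-hit fz p q = inj₁ refl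
lost-hit (fs _) p q = inj₂ refl

lost≢newPt : ∀ {n} u {p q : Fin n} → p ≢ q → lost u p q ≢ newPt u p q
lost≢newPt fz p≢q = p≢q
lost≢newPt (fs _) p≢q = p≢q ∘ sym

merge-fixed⁺ : ∀ {n} (π : PointedPartition n) ℓ {i} → π ! i
    ≡ i → i ≢ lost (col ℓ) (π ! fst ℓ) (π ! snd ℓ) → merge π ℓ ! i ≡ i
merge-fixed⁺ π ℓ {i} e i≢ with hit? (π ! fst ℓ) (π ! snd ℓ) (π ! i)
... | no ¬h = trans (merge-! π ℓ i) (trans (relabel-miss (col ℓ) ¬h) e)
... | yes h with hit-cases (col ℓ) h
...   | inj₁ e' = trans (merge-! π ℓ i) (trans (relabel-hit (col ℓ) h) (trans (sym e') e))
...   | inj₂ e' = ⊥-elim (i≢ (trans (sym e) e'))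

merge-lost : ∀ {n} (π : PointedPartition n) ℓ → Mergeable π ℓ → let l = lost (col ℓ) (π ! fst ℓ) (π ! snd ℓ) in
             π ! l ≡ l × merge π ℓ ! l ≢ l
merge-lost π ℓ@(a , b , u) (a<b , ma , mb) = fixed , λ e →
  lost≢newPt u (λ e' → FP.<⇒≢ a<b (min-injective π ma mb e'))
    (trans (sym e) (trans (merge-! π ℓ (lost u _ _)) (relabel-hit u (subst (Hit _ _) (sym fixed) (lost-hit u _ _)))))
  where
  fixed = hit-fixed π (lost-hit u (π ! a) (π ! b))

ρΠ-merge : ∀ {n} (π : PointedPartition n) ℓ → Mergeable π ℓ → ρΠ (merge π ℓ) ≡ suc (ρΠ π)
ρΠ-merge {n} π ℓ m = ↭-length (set-↭ (UP.filter⁺ (moved? (merge π ℓ)) (UP.allFin⁺ n)) (l∉ ∷ UP.filter⁺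
    (moved? π) (UP.allFin⁺ n)) f g)
  where
  moved? : (x : PointedPartition n) → ∀ i → Dec (x ! i ≢ i)
  moved? x i = ¬? (x ! i ≟F i)
  l = lost (col ℓ) (π ! fst ℓ) (π ! snd ℓ)
  ∈⁻ : ∀ x {i} → i ∈ filter (moved? x) (allFin n) → x ! i ≢ i
  ∈⁻ x i∈ = proj₂ (∈-filter⁻ (moved? x) {xs = allFin n} i∈)
  l∉ : All (l ≢_) (filter (moved? π) (allFin n))
  l∉ = all-tabulate λ { i∈ refl → ∈⁻ π i∈ (proj₁ (merge-lost π ℓ m)) }
  f : ∀ {i} → i ∈ filter (moved? (merge π ℓ)) (allFin n) → i ∈ l ∷ filter (moved? π) (allFin n)
  f {i} i∈ with i ≟F l
  ... | yes e = here e
  ... | no i≢l = there (∈-filter⁺ (moved? π) (∈-allFin i) (λ e → ∈⁻ (merge π ℓ) i∈ (merge-fixed⁺ π ℓ e i≢l)))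
  g : ∀ {i} → i ∈ l ∷ filter (moved? π) (allFin n) → i ∈ filter (moved? (merge π ℓ)) (allFin n)
  g (here refl) = ∈-filter⁺ (moved? (merge π ℓ)) (∈-allFin _) (proj₂ (merge-lost π ℓ m))
  g (there i∈) = ∈-filter⁺ (moved? (merge π ℓ)) (∈-allFin _) (λ e → ∈⁻ π i∈ (⊑-fixed (⊑-merge π ℓ) e))

ρΠ-𝟘 : ∀ {n} → ρΠ (Π•-bottom n) ≡ 0
ρΠ-𝟘 {n} = cong length (filter-none (λ i → ¬? (Π•-bottom n ! i ≟F i)) {xs =
    allFin n} (all-tabulate λ _ ne → ne (𝟘-! _)))

Π-graded : ∀ n → IsGradedBy (Π• n) ρΠ
Π-graded n = (λ x → ⊑⇒Leq (𝟘-⊑ x)) , ρΠ-𝟘 {n} , step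
  where
  step : ∀ x y → CoverPoset._⋖_ (Π• n) x y → ρΠ y ≡ suc (ρΠ x)
  step x y (ℓ , c) with cover⇒merge x y ℓ c
  ... | refl = ρΠ-merge x ℓ (cover⇒Mergeable x y ℓ c)

ρΠ-run : ∀ {n} {w : Word n} → Valid w → ρΠ (run w) ≡ length w
ρΠ-run {n} {w} = go (reverseView w)
  where
  go : ∀ {w} → Reverse w → Valid w → ρΠ (run w) ≡ length w
  go [] _ = ρΠ-𝟘 {n}
  go (w ∶ rs ∶ʳ ℓ) v with Valid-∷ʳ⁻ w v
  ... | v₁ , fr , _ = trans (cong ρΠ (run-∷ʳ w ℓ)) (trans (ρΠ-merge (run w) ℓ (to (Fresh⇔Mergeable v₁ {ℓ}) fr))
        (trans (cong suc (go rs v₁)) (sym (↭-length (↭-++-comm w (ℓ ∷ []))))))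

-- Comb words and pointed partitions

Comb : ∀ {n} → Word n → Set
Comb = AllPairs Indep

-- In a comb the elements of a block are merged one by one, as singletons, into its minimum; a
-- target has colour 0 exactly when it is to become the point.
colour : ∀ {n} → PointedPartition n → Fin n → Fin 2
colour x b = if does (x ! b ≟F b) then fz else fs fz

colour-fixed : ∀ {n} (x : PointedPartition n) {b} → x ! b ≡ b → colour x b ≡ fz
colour-fixed x {b} e with x ! b ≟F b
... | yes _ = refl
... | no ne = ⊥-elim (ne e)

colour-moved : ∀ {n} (x : PointedPartition n) {b} → x ! b ≢ b → colour x b ≡ fs fz
colour-moved x {b} ne with x ! b ≟F b
... | yes e = ⊥-elim (ne e)
... | no _ = refl

colour≡0 : ∀ {n} (x : PointedPartition n) {b} → colour x b ≡ fz → x ! b ≡ b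
colour≡0 x {b} e with x ! b ≟F b
... | yes e' = e'
colour≡0 x {b} () | no _

-- The letters of the unique comb word with image x.
record Letter {n : ℕ} (x : PointedPartition n) (ℓ : Lab n) : Set where
  constructor mkLetter
  field
    source-min : IsBlockMin x (fst ℓ)
    lt         : fst ℓ <F snd ℓ
    same-block : x ! fst ℓ ≡ x ! snd ℓ
    colour≡    : col ℓ ≡ colour x (snd ℓ)
open Letter

letter? : ∀ {n} (x : PointedPartition n) ℓ → Dec (Letter x ℓ)
letter? x ℓ = map′ (λ (p , q , r , s) → mkLetter p q r s) (λ (mkLetter p q r s) → p , q , r , s)
  (FP.all? (λ i → (x ! i ≟F x ! fst ℓ) →? (fst ℓ FP.≤? i)) ×-dec (fst ℓ FP.<? snd ℓ ×-dec
      (x ! fst ℓ ≟F x ! snd ℓ ×-dec col ℓ ≟F colour x (snd ℓ))))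

merge-colour : ∀ {n} (π : PointedPartition n) ℓ {d} → d ≢ lost (col ℓ) (π ! fst ℓ) (π ! snd ℓ) → colour
    (merge π ℓ) d ≡ colour π d
merge-colour π ℓ {d} d≢ with π ! d ≟F d
... | yes e = colour-fixed (merge π ℓ) (merge-fixed⁺ π ℓ e d≢)
... | no ne = colour-moved (merge π ℓ) (λ e → ne (⊑-fixed (⊑-merge π ℓ) e))

-- Independence of the last letter from the earlier ones, read through the induction hypothesis,
-- constrains the two blocks it merges. Then only `a` and `b` can change colour, and only the letter
-- with target `b` is new.
Comb-letters : ∀ {n} {w : Word n} → Valid w → Comb w → ∀ e → e ∈ w ⇔ Letter (run w) e
Comb-letters {n} {w} = go (reverseView w)
  where
  go : ∀ {w} → Reverse w → Valid w → Comb w → ∀ e → e ∈ w ⇔ Letter (run w) e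
  go [] v c e = mk⇔ (λ ()) (λ l → ⊥-elim (FP.<⇒≢ (lt l) (trans (sym (𝟘-! (fst e))) (trans (same-block l)
      (𝟘-! (snd e))))))
  go (w ∶ rs ∶ʳ ℓ@(a , b , u)) v c e₀ with Valid-∷ʳ⁻ w v | AllPairs-∷ʳ⁻ w c
  ... | v₁ , fr@(a<b , a∉ , b∉) , ge | c₁ , ind = subst (λ z → e₀ ∈ w ∷ʳ ℓ ⇔ Letter z e₀) (sym (run-∷ʳ w ℓ))
      (mk⇔ (fwd e₀) (bwd e₀))
    where
    x  = run w
    x' = merge x ℓ
    IH = go rs v₁ c₁
    m : Mergeable x ℓ
    m = to (Fresh⇔Mergeable v₁ {ℓ}) fr
    ma = proj₁ (proj₂ m)
    mb = proj₂ (proj₂ m)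
    -- A second element `i` of the block of `b` would give an earlier letter with source `b`, on
    -- which `ℓ` depends.
    b-single : ∀ i → x ! i ≡ x ! b → i ≡ b
    b-single i e with i ≟F b
    ... | yes e' = e'
    ... | no i≢b = ⊥-elim (proj₁ (all-lookup ind (from (IH (b , i , colour x i))
          (mkLetter mb (FP.≤∧≢⇒< (mb i e) (i≢b ∘ sym)) (sym e) refl))) refl)
    xb : x ! b ≡ b
    xb = b-single (x ! b) (!-idem x b)
    -- If `a` were not its own point, the point would be the target of an earlier 0-letter with
    -- source `a`, which has the key of `ℓ`.
    xa : u ≡ fz → x ! a ≡ a
    xa refl with x ! a ≟F a
    ... | yes e = e
    ... | no ne = ⊥-elim (proj₂ (all-lookup ind (from (IH (a , x ! a , fz))
          (mkLetter ma (FP.≤∧≢⇒< (ma (x ! a) (!-idem x a)) (ne ∘ sym)) (sym (!-idem x a)) (sym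
              (colour-fixed x (!-idem x a)))))) refl)
    lost-ab : Hit a b (lost u (x ! a) (x ! b))
    lost-ab = l u refl
      where
      l : ∀ u' → u ≡ u' → Hit a b (lost u' (x ! a) (x ! b))
      l fz e = inj₁ (xa e)
      l (fs _) _ = inj₂ xb
    colour-same : ∀ {d} → d ≢ a → d ≢ b → colour x' d ≡ colour x d
    colour-same d≢a d≢b = merge-colour x ℓ (λ { refl → [ d≢a , d≢b ]′ lost-ab })
    x≢ : x ! a ≢ x ! b
    x≢ e = FP.<⇒≢ a<b (min-injective x ma mb e)
    colour-b : u ≡ colour x' b
    colour-b = cb u refl
      where
      cb : ∀ u' → u ≡ u' → u' ≡ colour x' b
      cb fz refl = sym (colour-fixed x' (trans (merge-! x ℓ b) (trans (relabel-hit fz (inj₂ refl)) xb)))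
      cb (fs fz) refl = sym (colour-moved x' (λ e → x≢ (trans (sym (trans (merge-! x ℓ b) (relabel-hit
          (fs fz) (inj₂ refl)))) (trans e (sym xb)))))
    fwd : ∀ e → e ∈ w ∷ʳ ℓ → Letter x' e
    fwd e@(c , d , t) e∈ with ∈-∷ʳ⁻ w e∈
    ... | inj₂ refl = mkLetter (from (merge-mins x {ℓ} m a) (ma , FP.<⇒≢ a<b)) a<b (merge-joins x ℓ) colour-b
    ... | inj₁ e∈w with to (IH e) e∈w
    ...   | mkLetter mc c<d same col≡ = mkLetter (from (merge-mins x {ℓ} m c) (mc ,
        (λ c≡b → proj₁ (all-lookup ind e∈w) (sym c≡b)))) c<d
            (merge-coarsens x ℓ same)
            (trans col≡ (sym (colour-same (λ { refl → a∉ (∈-map⁺ snd e∈w) }) (λ { refl → b∉ (∈-map⁺ snd e∈w) }))))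
    bwd : ∀ e → Letter x' e → e ∈ w ∷ʳ ℓ
    bwd e@(c , d , t) (mkLetter mc' c<d same col≡) with to (merge-mins x {ℓ} m c) mc'
    ... | mc , c≢b = cases (relabel-fibre u (trans (sym (merge-! x ℓ c)) (trans same (merge-! x ℓ d))))
      where
      old : x ! c ≡ x ! d → e ∈ w ∷ʳ ℓ
      old e' = ∈-++⁺ˡ (from (IH e) (mkLetter mc c<d e' (trans col≡ (colour-same d≢a d≢b))))
        where
        d≢a : d ≢ a
        d≢a refl = FP.<⇒≢ c<d (min-injective x mc ma e')
        d≢b : d ≢ b
        d≢b refl = FP.<⇒≢ c<d (min-injective x mc mb e')
      cases : x ! c ≡ x ! d ⊎ (Hit (x ! a) (x ! b) (x ! c) × Hit (x ! a) (x ! b) (x ! d)) → e ∈ w ∷ʳ ℓ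
      cases (inj₁ e') = old e'
      cases (inj₂ (inj₂ e' , _)) = ⊥-elim (c≢b (min-injective x mc mb e'))
      cases (inj₂ (inj₁ e' , inj₁ e'')) = old (trans e' (sym e''))
      cases (inj₂ (inj₁ e' , inj₂ e'')) with min-injective x mc ma e' | b-single d e''
      ... | refl | refl = subst (λ t → (a , b , t) ∈ w ∷ʳ ℓ) (trans colour-b (sym col≡)) (∈-∷ʳ⁺ʳ w)

-- The letters show the minimum of each block and its other elements. The point is the target of
-- colour 0, or the minimum if there is no such target.
letters-determine : ∀ {n} {x x' : PointedPartition n} → (∀ {e} → Letter x e → Letter x' e) → (∀ {e} →
    Letter x' e → Letter x e) → x ≡ x'
letters-determine {n} {x} {x'} f g = PP-ext λ i → sym (at i)
  where
  module _ (i : Fin n) where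
    a = minOf x i
    ma : IsBlockMin x a
    ma = minOf-min x i
    xa : x ! a ≡ x ! i
    xa = minOf-! x i
    p = x ! a
    p-fixed : x ! p ≡ p
    p-fixed = !-idem x a
    -- A smaller minimum in `x'` would give a letter with target `a`; transported to `x` it
    -- contradicts the minimality of `a` there.
    a-min' : IsBlockMin x' a
    a-min' j e with minOf x' a ≟F a
    ... | yes e' = subst (_≤F j) e' (minOf-≤ x' a j e)
    ... | no ne = ⊥-elim (ne (FP.≤-antisym (minOf-≤ x' a a refl) (ma _ (same-block l))))
      where
      l : Letter x (minOf x' a , a , colour x' a)
      l = g (mkLetter (minOf-min x' a) (FP.≤∧≢⇒< (minOf-≤ x' a a refl) ne) (minOf-! x' a) refl)
    root : x' ! a ≡ p
    root with p ≟F a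
    ... | no p≢a with f {a , p , fz} (mkLetter ma (FP.≤∧≢⇒< (ma p p-fixed) (p≢a ∘ sym)) (sym p-fixed) (sym
        (colour-fixed x p-fixed)))
    ...   | mkLetter _ _ same col≡ = trans same (colour≡0 x' (sym col≡))
    root | yes p≡a with x' ! a ≟F a
    ...   | yes e = trans e (sym p≡a)
    ...   | no ne with g {a , x' ! a , fz} (mkLetter a-min' (FP.≤∧≢⇒< (a-min' _ (!-idem x' a)) (ne ∘ sym))
                        (sym (!-idem x' a)) (sym (colour-fixed x' (!-idem x' a))))
    ...     | mkLetter _ _ same col≡ = trans (sym (colour≡0 x (sym col≡))) (sym same)
    at : x' ! i ≡ x ! i
    at with a ≟F i
    ... | yes e = trans (cong (x' !_) (sym e)) (trans root xa)
    ... | no a≢i = trans (sym (same-block (f {a , i ,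
        colour x i} (mkLetter ma (FP.≤∧≢⇒< (minOf-≤ x i i refl) a≢i) xa refl)))) (trans root xa)

labels : ∀ n → List (Lab n)
labels n = cartesianProduct (allFin n) (cartesianProduct (allFin n) (allFin 2))

labels-unique : ∀ n → Unique (labels n)
labels-unique n = UP.cartesianProduct⁺ (UP.allFin⁺ n) (UP.cartesianProduct⁺ (UP.allFin⁺ n) (UP.allFin⁺ 2))

∈-labels : ∀ {n} (ℓ : Lab n) → ℓ ∈ labels n
∈-labels (a , b , u) = ∈-cartesianProduct⁺ (∈-allFin a) (∈-cartesianProduct⁺ (∈-allFin b) (∈-allFin u))

sortDesc : ∀ {n} (ls : List (Lab n)) → ∃ λ w → w ↭ ls × Desc w
sortDesc [] = [] , ↭-refl , []
sortDesc (ℓ ∷ ls) with sortDesc ls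
... | w , p , d with insertion ℓ d
...   | w' , i = w' , ↭-trans (Ins-↭ i) (↭-prep ℓ p) , Ins-Desc i d

Unique⇒AllPairs : {A : Set} {R : A → A → Set} {xs : List A} → (∀ {x y} → x ∈ xs → y ∈ xs → x ≢ y → R x y) →
    Unique xs → AllPairs R xs
Unique⇒AllPairs h [] = []
Unique⇒AllPairs h (x∉ ∷ u) = all-tabulate (λ y∈ → h (here refl) (there y∈)
    (all-lookup x∉ y∈)) ∷ Unique⇒AllPairs (λ p q → h (there p) (there q)) u

Letter-snd-injective : ∀ {n} {x : PointedPartition n} {e e'} → Letter x e → Letter x e' → snd e ≡ snd e' → e ≡ e'
Letter-snd-injective {x = x} (mkLetter m _ s c) (mkLetter m' _ s' c') refl with min-injective x m m' (trans s (sym s'))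
... | refl = cong (λ u → _ , _ , u) (trans c (sym c'))

-- A target is never a block minimum, hence never a source. Distinct letters with equal keys would
-- be two 0-letters with one source, but a block has only one point.
Letter-Indep : ∀ {n} {x : PointedPartition n} {e e'} → Letter x e → Letter x e' → e ≢ e' → Indep e e'
Letter-Indep {x = x} {e} {e'} l@(mkLetter m _ s c) l'@(mkLetter m' a<b s' c') e≢e' = src , keys
  where
  src : snd e' ≢ fst e
  src refl = ℕP.<⇒≱ a<b (m _ s')
  keys : key e' ≢ key e
  keys k with key-injective e' e k
  ... | inj₁ e'≡e = e≢e' (sym e'≡e)
  ... | inj₂ (refl , u' , u) = e≢e' (Letter-snd-injective l l' (trans (sym (colour≡0 x (trans (sym c) u)))
          (trans (sym s) (trans s' (colour≡0 x (trans (sym c') u'))))))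

Comb-word : ∀ {n} (x : PointedPartition n) → ∃ λ w → Valid w × Comb w × run w ≡ x
Comb-word {n} x with sortDesc (filter (letter? x) (labels n))
... | w , p , d = w , v , c , letters-determine (λ {e} l → letter⁻ (from (Comb-letters v c e) l)) (λ {e} l →
    to (Comb-letters v c e) (letter⁺ l))
  where
  letter⁻ : ∀ {e} → e ∈ w → Letter x e
  letter⁻ e∈ = proj₂ (∈-filter⁻ (letter? x) {xs = labels n} (∈-resp-↭ p e∈))
  letter⁺ : ∀ {e} → Letter x e → e ∈ w
  letter⁺ l = ∈-resp-↭ (↭-sym p) (∈-filter⁺ (letter? x) (∈-labels _) l)
  u : Unique w
  u = Unique-resp-↭ (↭-sym p) (UP.filter⁺ (letter? x) (labels-unique n))
  v : Valid w
  v = mkValid (all-tabulate (λ e∈ → lt (letter⁻ e∈))) (Unique-map (λ p q →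
      Letter-snd-injective (letter⁻ p) (letter⁻ q)) u) d
  c : Comb w
  c = Unique⇒AllPairs (λ p q → Letter-Indep (letter⁻ p) (letter⁻ q)) u

-- Independent letters have distinct keys, so a comb word is the strictly decreasing list of its
-- letters, and these are determined by the image.
Comb-injective : ∀ {n} {w w' : Word n} → Valid w → Comb w → Valid w' → Comb w' → run w ≡ run w' → w ≡ w'
Comb-injective v c v' c' e = sorted-unique ℕP.<-asym (strict v c) (strict v' c') (set-↭ (Valid⇒Unique v)
    (Valid⇒Unique v')
  (λ {ℓ} ℓ∈ → from (Comb-letters v' c' ℓ) (subst (λ x → Letter x ℓ) e (to (Comb-letters v c ℓ) ℓ∈)))
  (λ {ℓ} ℓ∈ → from (Comb-letters v c ℓ) (subst (λ x → Letter x ℓ) (sym e) (to (Comb-letters v' c' ℓ) ℓ∈))))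
  where
  strict : ∀ {w} → Valid w → Comb w → AllPairs (λ x y → key y < key x) w
  strict v c = allPairs-zipWith (λ (ge , (_ , k≢)) → ℕP.≤∧≢⇒< ge k≢) (desc v , c)

-- Signed counts and enumerations

sgn : ℕ → ℤ
sgn zero = 1ℤ
sgn (suc k) = - sgn k

sign : ∀ {n} → Word n → ℤ
sign w = sgn (length w)

∣sgn∣ : ∀ k → ∣ sgn k ∣ ≡ 1
∣sgn∣ zero = refl
∣sgn∣ (suc k) = trans (ℤP.∣-i∣≡∣i∣ (sgn k)) (∣sgn∣ k)

sign-∷ʳ : ∀ {n} (w : Word n) ℓ → sign (w ∷ʳ ℓ) ≡ - sign w
sign-∷ʳ w ℓ = cong sgn (↭-length (↭-++-comm w (ℓ ∷ [])))

sumℤ-↭ : ∀ {xs ys} → xs ↭ ys → sumℤ xs ≡ sumℤ ys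
sumℤ-↭ PP.refl = refl
sumℤ-↭ (PP.prep x p) = cong (x +ℤ_) (sumℤ-↭ p)
sumℤ-↭ (PP.swap {xs} {ys} x y p) = trans (sym (ℤP.+-assoc x y (sumℤ xs)))
  (trans (cong₂ _+ℤ_ (ℤP.+-comm x y) (sumℤ-↭ p)) (ℤP.+-assoc y x (sumℤ ys)))
sumℤ-↭ (PP.trans p q) = trans (sumℤ-↭ p) (sumℤ-↭ q)

sum-sign : ∀ {n} k (ws : List (Word n)) → (∀ {w} → w ∈ ws → length w ≡ k) → sumℤ (map sign ws) ≡ sgn k *ℤ + length ws
sum-sign k [] h = sym (ℤP.*-zeroʳ (sgn k))
sum-sign k (w ∷ ws) h = trans (cong₂ _+ℤ_ (cong sgn (h (here refl))) (sum-sign k ws (h ∘ there))) (sym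
    (ℤP.*-suc (sgn k) (+ length ws)))

∣sum-sign∣ : ∀ {n} k (ws : List (Word n)) → (∀ {w} → w ∈ ws → length w ≡ k) → ∣ sumℤ (map sign ws) ∣ ≡ length ws
∣sum-sign∣ k ws h = trans (cong ∣_∣ (sum-sign k ws h)) (trans (ℤP.abs-* (sgn k) (+ length ws))
  (trans (cong (_* length ws) (∣sgn∣ k)) (ℕP.*-identityˡ (length ws))))

comb? : ∀ {n} (w : Word n) → Dec (Comb w)
comb? [] = yes []
comb? (e ∷ w) = map′ (λ (p , q) → p ∷ q) (λ { (p ∷ q) → p , q }) (indep? e w ×-dec comb? w)

combSign-Comb : ∀ {n} {w : Word n} → Comb w → combSign w ≡ sign w
combSign-Comb [] = refl
combSign-Comb {w = e ∷ w} (h ∷ c) with indep? e w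
... | yes _ = cong -_ (combSign-Comb c)
... | no ¬h = ⊥-elim (¬h h)

combSign-¬Comb : ∀ {n} (w : Word n) → ¬ Comb w → combSign w ≡ 0ℤ
combSign-¬Comb [] ¬c = ⊥-elim (¬c [])
combSign-¬Comb (e ∷ w) ¬c with indep? e w
... | yes h = cong -_ (combSign-¬Comb w (λ c → ¬c (h ∷ c)))
... | no _ = refl

sum-combSign : ∀ {n} (ws : List (Word n)) → sumℤ (map combSign ws) ≡ sumℤ (map sign (filter comb? ws))
sum-combSign [] = refl
sum-combSign (w ∷ ws) with comb? w
... | yes c = cong₂ _+ℤ_ (combSign-Comb c) (sum-combSign ws)
... | no ¬c = trans (cong₂ _+ℤ_ (combSign-¬Comb w ¬c) (sum-combSign ws)) (ℤP.+-identityˡ _)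

wordsOver : ∀ n → ℕ → List (Word n)
wordsOver n zero = [] ∷ []
wordsOver n (suc k) = cartesianProductWith _∷_ (labels n) (wordsOver n k)

wordsOver-unique : ∀ n k → Unique (wordsOver n k)
wordsOver-unique n zero = [] ∷ []
wordsOver-unique n (suc k) = UP.cartesianProductWith⁺ _∷_ ∷-injective (labels-unique n) (wordsOver-unique n k)

∈-wordsOver⁺ : ∀ {n} (w : Word n) → w ∈ wordsOver n (length w)
∈-wordsOver⁺ [] = here refl
∈-wordsOver⁺ (ℓ ∷ w) = ∈-cartesianProductWith⁺ _∷_ (∈-labels ℓ) (∈-wordsOver⁺ w)

∈-wordsOver⁻ : ∀ {n} k {w : Word n} → w ∈ wordsOver n k → length w ≡ k
∈-wordsOver⁻ zero (here refl) = refl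
∈-wordsOver⁻ {n} (suc k) w∈ with ∈-cartesianProductWith⁻ _∷_ (labels n) (wordsOver n k) w∈
... | _ , _ , _ , w'∈ , refl = cong suc (∈-wordsOver⁻ k w'∈)

words : ∀ n → ℕ → List (Word n)
words n k = filter valid? (wordsOver n k)

words-enum : ∀ n k → EnumOf (λ w → Valid w × length w ≡ k) (words n k)
words-enum n k = UP.filter⁺ valid? (wordsOver-unique n k) , sound , complete
  where
  sound : ∀ w → w ∈ words n k → Valid w × length w ≡ k
  sound w w∈ with ∈-filter⁻ valid? {xs = wordsOver n k} w∈
  ... | w∈' , v = v , ∈-wordsOver⁻ k w∈'
  complete : ∀ w → Valid w × length w ≡ k → w ∈ words n k
  complete w (v , refl) = ∈-filter⁺ valid? (∈-wordsOver⁺ w) v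

fibre : ∀ {n} → PointedPartition n → List (Word n)
fibre {n} x = filter (λ w → run w ≟Π x) (words n (ρΠ x))

∈-fibre⁻ : ∀ {n} {x : PointedPartition n} {w} → w ∈ fibre x → Valid w × run w ≡ x
∈-fibre⁻ {n} {x} {w} w∈ with ∈-filter⁻ (λ w → run w ≟Π x) {xs = words n (ρΠ x)} w∈
... | w∈' , e = proj₁ (proj₁ (proj₂ (words-enum n (ρΠ x))) w w∈') , e

∈-fibre⁺ : ∀ {n} {w : Word n} → Valid w → w ∈ fibre (run w)
∈-fibre⁺ {n} {w} v = ∈-filter⁺ (λ z → run z ≟Π run w) (proj₂ (proj₂ (words-enum n (ρΠ (run w)))) w (v ,
    sym (ρΠ-run v))) refl

fibre-unique : ∀ {n} (x : PointedPartition n) → Unique (fibre x)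
fibre-unique {n} x = UP.filter⁺ (λ w → run w ≟Π x) (proj₁ (words-enum n (ρΠ x)))

μΠ : ∀ {n} → PointedPartition n → ℤ
μΠ x = sumℤ (map sign (fibre x))

∈-fibres⁻ : ∀ {n} (xs : List (PointedPartition n)) {w} → w ∈ concatMap fibre xs → Valid w × run w ∈ xs
∈-fibres⁻ (x ∷ xs) w∈ with ∈-++⁻ (fibre x) w∈
... | inj₁ p = proj₁ (∈-fibre⁻ p) , here (proj₂ (∈-fibre⁻ p))
... | inj₂ p with ∈-fibres⁻ xs p
...   | v , q = v , there q

∈-fibres⁺ : ∀ {n} (xs : List (PointedPartition n)) {w} → Valid w → run w ∈ xs → w ∈ concatMap fibre xs
∈-fibres⁺ (x ∷ xs) v (here refl) = ∈-++⁺ˡ (∈-fibre⁺ v)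
∈-fibres⁺ (x ∷ xs) v (there p) = ∈-++⁺ʳ (fibre x) (∈-fibres⁺ xs v p)

fibres-unique : ∀ {n} {xs : List (PointedPartition n)} → Unique xs → Unique (concatMap fibre xs)
fibres-unique [] = []
fibres-unique {xs = x ∷ xs} (x∉ ∷ u) = UP.++⁺ (fibre-unique x) (fibres-unique u)
  (λ (p , q) → all-lookup x∉ (proj₂ (∈-fibres⁻ xs q)) (sym (proj₂ (∈-fibre⁻ p))))

fibres-enum : ∀ {n} {Q : PointedPartition n → Set} {xs} → EnumOf Q xs → EnumOf (λ w →
    Valid w × Q (run w)) (concatMap fibre xs)
fibres-enum {xs = xs} (u , sound , complete) = fibres-unique u ,
  (λ w w∈ → proj₁ (∈-fibres⁻ xs w∈) , sound _ (proj₂ (∈-fibres⁻ xs w∈))) ,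
  (λ w (v , q) → ∈-fibres⁺ xs v (complete _ q))

μΠ-sum : ∀ {n} (xs : List (PointedPartition n)) → sumℤ (map μΠ xs) ≡ sumℤ (map sign (concatMap fibre xs))
μΠ-sum [] = refl
μΠ-sum (x ∷ xs) = trans (cong (μΠ x +ℤ_) (μΠ-sum xs))
  (sym (trans (cong sumℤ (map-++ sign (fibre x) (concatMap fibre xs))) (sumℤ-++ (map sign (fibre x)) _)))

-- Every pointed partition is the image of a comb word, so the images of the valid words of length
-- `k` exhaust rank `k`.
partitionsOfRank : ∀ n → ℕ → List (PointedPartition n)
partitionsOfRank n k = deduplicate _≟Π_ (map run (words n k))

partitionsOfRank-enum : ∀ n k → EnumOf (λ x → ρΠ x ≡ k) (partitionsOfRank n k)
partitionsOfRank-enum n k = deduplicate-! _≟Π_ (map run (words n k)) , sound , complete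
  where
  sound : ∀ x → x ∈ partitionsOfRank n k → ρΠ x ≡ k
  sound x x∈ with ∈-map⁻ run (∈-deduplicate⁻ _≟Π_ (map run (words n k)) x∈)
  ... | w , w∈ , refl with proj₁ (proj₂ (words-enum n k)) w w∈
  ...   | v , e = trans (ρΠ-run v) e
  complete : ∀ x → ρΠ x ≡ k → x ∈ partitionsOfRank n k
  complete x e with Comb-word x
  ... | w , v , _ , refl = ∈-deduplicate⁺ _≟Π_ (∈-map⁺ run (proj₂ (proj₂ (words-enum n k)) w (v ,
      trans (sym (ρΠ-run v)) e)))

ρΠ≤n : ∀ {n} (x : PointedPartition n) → ρΠ x ≤ n
ρΠ≤n {n} x = ℕP.≤-trans (length-filter _ (allFin n)) (ℕP.≤-reflexive (length-tabulate {n = n} id))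

partitions : ∀ n → List (PointedPartition n)
partitions n = deduplicate _≟Π_ (concatMap (partitionsOfRank n) (upTo (suc n)))

∈-partitions : ∀ {n} (x : PointedPartition n) → x ∈ partitions n
∈-partitions {n} x = ∈-deduplicate⁺ _≟Π_ (concatMap-∈ (upTo (suc n)) (∈-upTo⁺ (s≤s (ρΠ≤n x))))
  where
  concatMap-∈ : ∀ ks → ρΠ x ∈ ks → x ∈ concatMap (partitionsOfRank n) ks
  concatMap-∈ (k ∷ ks) (here refl) = ∈-++⁺ˡ (proj₂ (proj₂ (partitionsOfRank-enum n k)) x refl)
  concatMap-∈ (k ∷ ks) (there p) = ∈-++⁺ʳ (partitionsOfRank n k) (concatMap-∈ ks p)

below-enum : ∀ {n} (x : PointedPartition n) → EnumOf (_⊑ x) (filter (_⊑? x) (partitions n))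
below-enum {n} x = UP.filter⁺ (_⊑? x) (deduplicate-! _≟Π_ (concatMap (partitionsOfRank n) (upTo (suc n)))) ,
  (λ y y∈ → proj₂ (∈-filter⁻ (_⊑? x) {xs = partitions n} y∈)) , (λ y le → ∈-filter⁺ (_⊑? x) (∈-partitions y) le)

-- A sign-reversing involution on words

-- A sign-reversing involution that adds or removes the last letter c w.
module Toggle {n : ℕ} (S : Word n → Set) (c : Word n → Lab n)
  (S-init : ∀ {w ℓ} → S (w ∷ʳ ℓ) → S w)
  (S-toggle : ∀ {w} → S w → (∃ λ w₁ → w ≡ w₁ ∷ʳ c w₁) ⊎ S (w ∷ʳ c w))
  (S-once : ∀ {w} → ¬ S ((w ∷ʳ c w) ∷ʳ c (w ∷ʳ c w))) where

  Removable : Word n → Set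
  Removable w = ∃ λ w₁ → w ≡ w₁ ∷ʳ c w₁

  removable? : ∀ w → Dec (Removable w)
  removable? w = go (reverseView w)
    where
    go : ∀ {w} → Reverse w → Dec (Removable w)
    go [] = no λ { ([] , ()) ; (_ ∷ _ , ()) }
    go (w ∶ _ ∶ʳ ℓ) with ℓ ≟L c w
    ... | yes refl = yes (w , refl)
    ... | no ne = no λ { (w₁ , e) → ne (trans (proj₂ (∷ʳ-injective w w₁ e)) (cong c (sym (proj₁
        (∷ʳ-injective w w₁ e))))) }

  extend : Word n → Word n
  extend w = w ∷ʳ c w

  sum-extend : ∀ ws → sumℤ (map sign ws) +ℤ sumℤ (map sign (map extend ws)) ≡ 0ℤ
  sum-extend [] = refl
  sum-extend (w ∷ ws) = trans (interchange (sign w) _ (sign (extend w)) _)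
    (cong₂ _+ℤ_ (trans (cong (sign w +ℤ_) (sign-∷ʳ w (c w))) (ℤP.+-inverseʳ (sign w))) (sum-extend ws))

  -- `Z` consists of the words without removable last letter and their extensions. By `S-once`,
  -- stripping the letter from a removable word leaves one that is not removable, so the two halves
  -- are in bijection with opposite signs.
  sum≡0 : ∀ {Z} → EnumOf S Z → sumℤ (map sign Z) ≡ 0ℤ
  sum≡0 {Z} (u , sound , complete) = trans (sumℤ-↭ (↭-map⁺ sign Z↭))
    (trans (cong sumℤ (map-++ sign E (map extend E))) (trans (sumℤ-++ (map sign E) _) (sum-extend E)))
    where
    P? = λ w → ¬? (removable? w)
    E = filter P? Z
    E⁻ : ∀ {w} → w ∈ E → w ∈ Z × ¬ Removable w
    E⁻ = ∈-filter⁻ P? {xs = Z}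
    uE : Unique E
    uE = UP.filter⁺ P? u
    disjoint : ∀ {w} → ¬ (w ∈ E × w ∈ map extend E)
    disjoint (p , q) with ∈-map⁻ extend q
    ... | w₁ , _ , e = proj₂ (E⁻ p) (w₁ , e)
    f : ∀ {w} → w ∈ Z → w ∈ E ++ map extend E
    f {w} w∈ with removable? w
    ... | no ¬r = ∈-++⁺ˡ (∈-filter⁺ P? w∈ ¬r)
    ... | yes (w₁ , refl) = ∈-++⁺ʳ E (∈-map⁺ extend (∈-filter⁺ P? (complete w₁ (S-init (sound _ w∈)))
          (λ { (w₂ , refl) → S-once (sound _ w∈) })))
    g : ∀ {w} → w ∈ E ++ map extend E → w ∈ Z
    g w∈ with ∈-++⁻ E w∈
    ... | inj₁ p = proj₁ (E⁻ p)
    ... | inj₂ p with ∈-map⁻ extend p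
    ...   | w₁ , w₁∈ , refl with S-toggle (sound w₁ (proj₁ (E⁻ w₁∈)))
    ...     | inj₁ r = ⊥-elim (proj₂ (E⁻ w₁∈) r)
    ...     | inj₂ s = complete _ s
    Z↭ : Z ↭ E ++ map extend E
    Z↭ = set-↭ u (UP.++⁺ uE (UP.map⁺ (λ {w} {w'} e → proj₁ (∷ʳ-injective w w' e)) uE) disjoint) f g

-- Valid words below a pointed partition

run-joins : ∀ {n} {w : Word n} {ℓ} → ℓ ∈ w → run w ! fst ℓ ≡ run w ! snd ℓ
run-joins {w = w} = go (reverseView w)
  where
  go : ∀ {w ℓ} → Reverse w → ℓ ∈ w → run w ! fst ℓ ≡ run w ! snd ℓ
  go {ℓ = ℓ'} (w ∶ rs ∶ʳ ℓ) ℓ'∈ rewrite run-∷ʳ w ℓ with ∈-∷ʳ⁻ w ℓ'∈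
  ... | inj₂ refl = merge-joins (run w) ℓ
  ... | inj₁ p = merge-coarsens (run w) ℓ (go rs p)

Valid⇒Mergeable : ∀ {n} (w : Word n) ℓ → Valid (w ∷ʳ ℓ) → Mergeable (run w) ℓ
Valid⇒Mergeable w ℓ v = let v₁ , fr , _ = Valid-∷ʳ⁻ w v in to (Fresh⇔Mergeable v₁ {ℓ}) fr

run-∷ʳ-⊒ : ∀ {n} (w : Word n) ℓ → run w ⊑ run (w ∷ʳ ℓ)
run-∷ʳ-⊒ w ℓ = subst (run w ⊑_) (sym (run-∷ʳ w ℓ)) (⊑-merge (run w) ℓ)

-- After the 0-merge the point comes from the block of `b`. Were it `a`, then `a` would have been
-- the point of both merged blocks. A point once lost is never regained.
0-merge-loses : ∀ {n} {w : Word n} {a b} → Valid w → (a , b , fz) ∈ w → run w ! a ≢ a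
0-merge-loses {n} {w} = go (reverseView w)
  where
  go : ∀ {w a b} → Reverse w → Valid w → (a , b , fz) ∈ w → run w ! a ≢ a
  go {a = a} {b} (w ∶ rs ∶ʳ ℓ) v ∈w e with ∈-∷ʳ⁻ w ∈w
  ... | inj₁ p = go rs (proj₁ (Valid-∷ʳ⁻ w v)) p (⊑-fixed (run-∷ʳ-⊒ w ℓ) e)
  ... | inj₂ refl with Valid⇒Mergeable w ℓ v
  ...   | a<b , ma , mb = FP.<⇒≢ a<b (min-injective (run w) ma mb (trans (cong (run w !_) (sym b↦a)) (trans
      (!-idem (run w) b) refl)))
    where
    b↦a : run w ! b ≡ a
    b↦a = trans (sym (trans (cong (_! a) (run-∷ʳ w ℓ)) (trans (merge-! (run w) ℓ a) (relabel-hit fz (inj₁ refl))))) e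

-- As a minimum `c` starts as its own point, and merges with source `c` keep the point of the left
-- block when they have colour 1.
root-fixed : ∀ {n} {w : Word n} {c} → Valid w → c ∉ snds w → (∀ b → (c , b , fz) ∉ w) → run w ! c ≡ c
root-fixed {n} {w} = go (reverseView w)
  where
  go : ∀ {w c} → Reverse w → Valid w → c ∉ snds w → (∀ b → (c , b , fz) ∉ w) → run w ! c ≡ c
  go [] _ _ _ = 𝟘-! _
  go {c = c} (w ∶ rs ∶ʳ ℓ@(a , b , u)) v c∉ no0 = trans (cong (_! c) (run-∷ʳ w ℓ)) (trans (merge-!
      (run w) ℓ c) relabelled)
    where
    y = run w
    v₁ = proj₁ (Valid-∷ʳ⁻ w v)
    m = Valid⇒Mergeable w ℓ v
    snds≡ : snds (w ∷ʳ ℓ) ≡ snds w ∷ʳ b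
    snds≡ = map-++ snd w (ℓ ∷ [])
    c∉w : c ∉ snds w
    c∉w p = c∉ (subst (c ∈_) (sym snds≡) (∈-++⁺ˡ p))
    c≢b : c ≢ b
    c≢b refl = c∉ (subst (c ∈_) (sym snds≡) (∈-∷ʳ⁺ʳ (snds w)))
    yc : y ! c ≡ c
    yc = go rs v₁ c∉w (λ d p → no0 d (∈-++⁺ˡ p))
    mc : IsBlockMin y c
    mc = from (run-mins v₁ c) c∉w
    relabelled : relabel u (y ! a) (y ! b) (y ! c) ≡ c
    relabelled with c ≟F a
    ... | no c≢a = trans (relabel-miss u [ c≢a ∘ min-injective y mc (proj₁ (proj₂ m)) ,
        c≢b ∘ min-injective y mc (proj₂ (proj₂ m)) ]′) yc
    ... | yes refl = by-colour u refl
      where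
      by-colour : ∀ u' → u ≡ u' → relabel u' (y ! a) (y ! b) (y ! a) ≡ a
      by-colour fz refl = ⊥-elim (no0 b (∈-∷ʳ⁺ʳ w))
      by-colour (fs _) _ = trans (relabel-hit _ (inj₁ refl)) yc

-- For x ≢ 𝟘, let a be the least element of a block with at least two elements and p the point of
-- its block.  In a valid word with image below x all sources are ≥ a.  If p = a, the letter
-- (a , b)¹ is toggled, where b is the second least element of the block of a; otherwise the
-- letter (a , m)⁰, where m is the minimum of the block of p in the current partition.
module Interval {n : ℕ} (x : PointedPartition n) (x≢𝟘 : x ≢ Π•-bottom n) where

  Below : Word n → Set
  Below w = Valid w × run w ⊑ x

  Partner : Fin n → Fin n → Set
  Partner i j = j ≢ i × x ! j ≡ x ! i

  partner? : ∀ i j → Dec (Partner i j)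
  partner? i j = ¬? (j ≟F i) ×-dec (x ! j ≟F x ! i)

  nontrivial : ∃ λ i → ∃ (Partner i)
  nontrivial with FP.any? (λ i → ¬? (x ! i ≟F i))
  ... | yes (i , ne) = i , x ! i , ne , !-idem x i
  ... | no all-fixed = ⊥-elim (x≢𝟘 (PP-ext λ i → trans (fixed i) (sym (𝟘-! i))))
    where
    fixed : ∀ i → x ! i ≡ i
    fixed i with x ! i ≟F i
    ... | yes e = e
    ... | no ne = ⊥-elim (all-fixed (i , ne))

  a-least : ∃ λ a → ∃ (Partner a) × (∀ j → ∃ (Partner j) → a ≤F j)
  a-least = least (λ i → FP.any? (partner? i)) nontrivial

  a p : Fin n
  a = proj₁ a-least
  p = x ! a

  a≤ : ∀ {i j} → i ≢ j → x ! i ≡ x ! j → a ≤F i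
  a≤ {i} {j} i≢j e = proj₂ (proj₂ a-least) i (j , i≢j ∘ sym , sym e)

  a-min : IsBlockMin x a
  a-min j e with j ≟F a
  ... | yes refl = ℕP.≤-refl
  ... | no j≢a = a≤ j≢a e

  p-fixed : x ! p ≡ p
  p-fixed = !-idem x a

  letter-block : ∀ {w} → Below w → ∀ {ℓ} → ℓ ∈ w → x ! fst ℓ ≡ x ! snd ℓ
  letter-block (v , le) ℓ∈ = ⊑-coarsens le (run-joins ℓ∈)

  a≤fst : ∀ {w} → Below w → ∀ {ℓ} → ℓ ∈ w → a ≤F fst ℓ
  a≤fst s@(v , _) ℓ∈ = a≤ (FP.<⇒≢ (all-lookup (proper v) ℓ∈)) (letter-block s ℓ∈)

  a∉snds : ∀ {w} → Below w → a ∉ snds w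
  a∉snds s@(v , _) a∈ with ∈-map⁻ snd a∈
  ... | ℓ , ℓ∈ , e = ℕP.<⇒≱ (subst (fst ℓ <F_) (sym e) (all-lookup (proper v) ℓ∈)) (a≤fst s ℓ∈)

  Below-init : ∀ {w ℓ} → Below (w ∷ʳ ℓ) → Below w
  Below-init {w} {ℓ} (v , le) = proj₁ (Valid-∷ʳ⁻ w v) , ⊑-trans (run-∷ʳ-⊒ w ℓ) le

  Below-∷ʳ : ∀ {w ℓ} → Below w → Fresh ℓ w → All (_≥Λ ℓ) w → merge (run w) ℓ ⊑ x → Below (w ∷ʳ ℓ)
  Below-∷ʳ {w} {ℓ} (v , _) fr ge le = Valid-∷ʳ⁺ v fr ge , subst (_⊑ x) (sym (run-∷ʳ w ℓ)) le

  module PointIsMin (p≡a : p ≡ a) where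
    b-least : ∃ λ b → Partner a b × (∀ j → Partner a j → b ≤F j)
    b-least = least (partner? a) (proj₁ (proj₂ a-least))

    b : Fin n
    b = proj₁ b-least

    b-partner : Partner a b
    b-partner = proj₁ (proj₂ b-least)

    b≤ : ∀ j → Partner a j → b ≤F j
    b≤ = proj₂ (proj₂ b-least)

    ℓ : Lab n
    ℓ = a , b , fs fz

    a<b : a <F b
    a<b = FP.≤∧≢⇒< (a-min b (proj₂ b-partner)) (proj₁ b-partner ∘ sym)

    a-fixed : ∀ {w} → Below w → run w ! a ≡ a
    a-fixed (_ , le) = ⊑-fixed le p≡a

    no-0 : ∀ {w d} → Below w → (a , d , fz) ∉ w
    no-0 s@(v , _) ∈w = 0-merge-loses v ∈w (a-fixed s)

    -- A letter behind `ℓ` would have source `a` and, as no 0-letter occurs with that source, colour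
    -- 1. Its target is at most `b` by descent and at least `b` by the choice of `b`, so `b` would
    -- be a target twice.
    ends : ∀ {w} → Reverse w → Below w → ℓ ∈ w → ∃ λ w₁ → w ≡ w₁ ∷ʳ ℓ
    ends (w ∶ _ ∶ʳ e) s@(v , _) ℓ∈ with ∈-∷ʳ⁻ w ℓ∈
    ... | inj₂ refl = w , refl
    ... | inj₁ ℓ∈w with Valid-∷ʳ⁻ w v
    ...   | v₁ , fr , ge with FP.≤-antisym (key≤⇒fst≤ e ℓ (all-lookup ge ℓ∈w)) (a≤fst s (∈-∷ʳ⁺ʳ w))
    ends (w ∶ _ ∶ʳ e@(_ , d , fz)) s ℓ∈ | inj₁ ℓ∈w | v₁ , fr , ge | refl = ⊥-elim (no-0 s (∈-∷ʳ⁺ʳ w))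
    ends (w ∶ _ ∶ʳ e@(_ , d , fs fz)) s ℓ∈ | inj₁ ℓ∈w | v₁ , (a<d , _ , d∉) , ge | refl =
      ⊥-elim (d∉ (subst (_∈ snds w) (FP.≤-antisym (b≤ d (FP.<⇒≢ a<d ∘ sym , sym (letter-block s (∈-∷ʳ⁺ʳ w))))
        (ℕP.≮⇒≥ (≥Λ⇒≮Λ {x = ℓ} {e} (all-lookup ge ℓ∈w) ∘ lt-C))) (∈-map⁺ snd ℓ∈w)))

    -- No letter of a word below `x` is smaller than `ℓ`, so `ℓ` can be appended unless `b` is
    -- already a target. In that case the letter with target `b` is `ℓ`: only `a` precedes `b` in
    -- the block, and colour 0 would destroy the point `a`.
    toggle : ∀ {w} → Below w → (∃ λ w₁ → w ≡ w₁ ∷ʳ ℓ) ⊎ Below (w ∷ʳ ℓ)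
    toggle {w} s@(v , le) with b ∈? snds w
    ... | yes b∈ with ∈-map⁻ snd b∈
    ...   | (c , _ , u) , e∈ , refl = inj₁ (ends (reverseView w) s (is-ℓ u c≡a e∈))
      where
      c<b : c <F b
      c<b = all-lookup (proper v) e∈
      c≡a : c ≡ a
      c≡a with c ≟F a
      ... | yes e = e
      ... | no c≢a = ⊥-elim (ℕP.<⇒≱ c<b (b≤ c (c≢a , trans (letter-block s e∈) (proj₂ b-partner))))
      is-ℓ : ∀ u → c ≡ a → (c , b , u) ∈ w → ℓ ∈ w
      is-ℓ fz refl e∈ = ⊥-elim (no-0 s e∈)
      is-ℓ (fs fz) refl e∈ = e∈
    toggle {w} s@(v , le) | no b∉ = inj₂ (Below-∷ʳ s (a<b , a∉snds s , b∉) (all-tabulate ge)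
      (merge-⊑ ℓ le (sym (proj₂ b-partner)) (inj₁ (trans p≡a (sym (a-fixed s))))))
      where
      not-less : ∀ {e} → e ∈ w → ¬ (e <Λ ℓ)
      not-less e∈ (lt-fst c<a) = ℕP.<⇒≱ c<a (a≤fst s e∈)
      not-less e∈ lt-AC = no-0 s e∈
      not-less {_ , d , _} e∈ (lt-C d<b) = ℕP.<⇒≱ d<b (b≤ d (FP.<⇒≢ (all-lookup (proper v) e∈) ∘ sym ,
          sym (letter-block s e∈)))
      ge : ∀ {e} → e ∈ w → e ≥Λ ℓ
      ge e∈ = ≮Λ⇒≥Λ (not-less e∈)

    once : ∀ {w} → ¬ Below ((w ∷ʳ ℓ) ∷ʳ ℓ)
    once {w} (v , _) with Valid-∷ʳ⁻ (w ∷ʳ ℓ) v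
    ... | _ , (_ , _ , b∉) , _ = b∉ (∈-map⁺ snd (∈-∷ʳ⁺ʳ w))

    sum≡0 : ∀ {Z} → EnumOf Below Z → sumℤ (map sign Z) ≡ 0ℤ
    sum≡0 = Toggle.sum≡0 Below (λ _ → ℓ) Below-init toggle once

  module PointIsNotMin (p≢a : p ≢ a) where
    c : Word n → Lab n
    c w = a , minOf (run w) p , fz

    p-point : ∀ {w} → Below w → run w ! p ≡ p
    p-point (_ , le) = ⊑-fixed le p-fixed

    -- Since the point of `a` has moved, a 0-letter with source `a` occurs. Nothing lies below it
    -- except letters of the same antichain, so the last letter is of this kind. That letter gave
    -- `a` the point `p`, so its target is the minimum of the block that contained `p`.
    ends : ∀ {w} → Reverse w → Below w → run w ! a ≡ p → ∃ λ w₁ → w ≡ w₁ ∷ʳ c w₁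
    ends [] _ e = ⊥-elim (p≢a (trans (sym e) (𝟘-! a)))
    ends (w ∶ _ ∶ʳ e) s@(v , le) ya with Valid-∷ʳ⁻ w v | FP.any? (λ d → any? ((a , d , fz) ≟L_) (w ∷ʳ e))
    ... | v₁ , fr , ge | no none = ⊥-elim (p≢a (trans (sym ya) (root-fixed v (a∉snds s) (λ d ∈w → none (d , ∈w)))))
    ... | v₁ , fr , ge | yes (d , ∈w) = w , cong (w ∷ʳ_) (last e refl (∈-∷ʳ⁻ w ∈w))
      where
      last-0 : ∀ d' → e ≡ (a , d' , fz) → e ≡ c w
      last-0 d' refl = cong (λ z → a , z , fz) (min-injective y₁ md' (minOf-min y₁ p)
          (trans d'↦p (sym (trans (minOf-! y₁ p) (p-point (Below-init s))))))
        where
        y₁ = run w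
        md' : IsBlockMin y₁ d'
        md' = proj₂ (proj₂ (Valid⇒Mergeable w e v))
        d'↦p : y₁ ! d' ≡ p
        d'↦p = trans (sym (trans (cong (_! a) (run-∷ʳ w e)) (trans (merge-! y₁ e a) (relabel-hit fz (inj₁ refl))))) ya
      last : ∀ e' → e ≡ e' → (a , d , fz) ∈ w ⊎ (a , d , fz) ≡ e → e ≡ c w
      last e' _ (inj₂ refl) = last-0 d refl
      last e'@(a' , d' , u') refl (inj₁ ∈w') with FP.≤-antisym (key≤⇒fst≤ e (a , d ,
          fz) (all-lookup ge ∈w')) (a≤fst s (∈-∷ʳ⁺ʳ w))
      last e'@(_ , d' , fz) refl (inj₁ ∈w') | refl = last-0 d' refl
      last e'@(_ , d' , fs fz) refl (inj₁ ∈w') | refl = ⊥-elim (≥Λ⇒≮Λ {x = a , d , fz} {e} (all-lookup ge ∈w') lt-AC)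

    -- All sources are at least `a` and a 0-letter has the least key for its source, so `c w` never
    -- creates an ascent. The merge stays below `x` because `p`, the point of the block in `x`, wins
    -- it.
    toggle : ∀ {w} → Below w → (∃ λ w₁ → w ≡ w₁ ∷ʳ c w₁) ⊎ Below (w ∷ʳ c w)
    toggle {w} s@(v , le) with run w ! a ≟F p
    ... | yes ya = inj₁ (ends (reverseView w) s ya)
    ... | no ya≢p = inj₂ (Below-∷ʳ s (FP.≤∧≢⇒< (a-min m (sym xa)) a≢m , a∉snds s , to (run-mins v m) (minOf-min y p))
            (all-tabulate λ e∈ → ≮Λ⇒≥Λ (not-less e∈)) (merge-⊑ (c w) le xa (inj₁ (sym m↦p))))
      where
      y = run w
      m = minOf y p
      m↦p : y ! m ≡ p
      m↦p = trans (minOf-! y p) (p-point s)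
      a≢m : a ≢ m
      a≢m e = ya≢p (trans (cong (y !_) e) m↦p)
      xa : x ! a ≡ x ! m
      xa = sym (trans (sym (blocks le m)) (trans (cong (x !_) m↦p) p-fixed))
      not-less : ∀ {e} → e ∈ w → ¬ (e <Λ c w)
      not-less e∈ (lt-fst lt) = ℕP.<⇒≱ lt (a≤fst s e∈)

    -- After the first `c w` the elements `a` and `p` share a block, so the minimum of the block of
    -- `p` is `a` itself and cannot be merged with `a`.
    once : ∀ {w} → ¬ Below ((w ∷ʳ c w) ∷ʳ c (w ∷ʳ c w))
    once {w} s@(v , _) with Valid⇒Mergeable (w ∷ʳ c w) (c (w ∷ʳ c w)) v
    ... | a<m' , ma , mm' = FP.<⇒≢ a<m' (min-injective (run (w ∷ʳ c w)) ma mm'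
            (trans ya (sym (trans (minOf-! (run (w ∷ʳ c w)) p) (p-point (Below-init s))))))
      where
      ya : run (w ∷ʳ c w) ! a ≡ p
      ya = trans (cong (_! a) (run-∷ʳ w (c w))) (trans (merge-! (run w) (c w) a) (trans (relabel-hit fz (inj₁ refl))
             (trans (minOf-! (run w) p) (p-point (Below-init (Below-init s))))))

    sum≡0 : ∀ {Z} → EnumOf Below Z → sumℤ (map sign Z) ≡ 0ℤ
    sum≡0 = Toggle.sum≡0 Below c Below-init toggle once

  sum≡0 : ∀ {Z} → EnumOf Below Z → sumℤ (map sign Z) ≡ 0ℤ
  sum≡0 with p ≟F a
  ... | yes e = PointIsMin.sum≡0 e
  ... | no ne = PointIsNotMin.sum≡0 ne

-- The Möbius function of Π• and the Whitney numbers

Π-Möbius : ∀ n → IsMobius (Π• n) μΠ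
Π-Möbius n = bottom , λ x x≢𝟘 → below x , below-interval x ,
  trans (μΠ-sum (below x)) (Interval.sum≡0 x x≢𝟘 (fibres-enum (below-enum x)))
  where
  below : PointedPartition n → List (PointedPartition n)
  below x = filter (_⊑? x) (partitions n)
  below-interval : ∀ x → EnumOf (λ y → Leq (Π• n) (Π•-bottom n) y × Leq (Π• n) y x) (below x)
  below-interval x = let u , sound , complete = below-enum x in u ,
    (λ y y∈ → ⊑⇒Leq (𝟘-⊑ y) , ⊑⇒Leq (sound y y∈)) , (λ y (_ , le) → complete y (Leq⇒⊑ le))
  bottom : μΠ (Π•-bottom n) ≡ 1ℤ
  bottom = cong (λ ws → sumℤ (map sign ws)) (↭-singleton-inv (↭-sym singleton))
    where
    singleton : [] ∷ [] ↭ fibre (Π•-bottom n)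
    singleton = set-↭ ([] ∷ []) (fibre-unique _) (λ { (here refl) → ∈-fibre⁺ Valid-[] }) f
      where
      f : ∀ {w} → w ∈ fibre (Π•-bottom n) → w ∈ [] ∷ []
      f {w} w∈ with ∈-fibre⁻ {x = Π•-bottom n} w∈
      ... | v , e with trans (sym (ρΠ-run v)) (trans (cong ρΠ e) (ρΠ-𝟘 {n}))
      f {[]} w∈ | v , e | _ = here refl

-- Up to sign, the Whitney numbers of the first kind count valid words of length k: all of them
-- for Π•, and the comb words for the forests.
whitney-numbers : ∀ n k → Σ[ Fs ∈ List (PLForest n) ] Σ[ xs ∈ List (PointedPartition n) ]
  EnumOf (λ F → ρFLyn F ≡ k) Fs × EnumOf (λ x → ρΠ x ≡ k) xs ×
  (∣ sumℤ (map μFLyn Fs) ∣ ≡ length xs) × (∣ sumℤ (map μΠ xs) ∣ ≡ length Fs)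
whitney-numbers n k with forests-enum {ws = words n k} (words-enum n k) proj₁
... | Fs , e , (uF , soundF , completeF) = Fs , xs ,
    (uF , (λ F F∈ → proj₂ (soundF F F∈)) , (λ F eq → completeF F (word-valid F , eq))) , xs-enum , combs , chains
  where
  ws = words n k
  xs = partitionsOfRank n k
  xs-enum = partitionsOfRank-enum n k
  ws⁻ : ∀ {w} → w ∈ ws → Valid w × length w ≡ k
  ws⁻ = proj₁ (proj₂ (words-enum n k)) _
  Cs = filter comb? ws
  Cs⁻ : ∀ {w} → w ∈ Cs → (Valid w × length w ≡ k) × Comb w
  Cs⁻ w∈ with ∈-filter⁻ comb? {xs = ws} w∈
  ... | w∈' , c = ws⁻ w∈' , c
  Cs↭ : map run Cs ↭ xs
  Cs↭ = set-↭ (Unique-map (λ p q → let (v , _) , c = Cs⁻ p in let (v' , _) , c' = Cs⁻ q in Comb-injective v c v' c')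
                 (UP.filter⁺ comb? (proj₁ (words-enum n k)))) (proj₁ xs-enum) f g
    where
    f : ∀ {x} → x ∈ map run Cs → x ∈ xs
    f x∈ with ∈-map⁻ run x∈
    ... | w , w∈ , refl = let (v , eq) , _ = Cs⁻ w∈ in proj₂ (proj₂ xs-enum) _ (trans (ρΠ-run v) eq)
    g : ∀ {x} → x ∈ xs → x ∈ map run Cs
    g {x} x∈ with Comb-word x
    ... | w , v , c , refl = ∈-map⁺ run (∈-filter⁺ comb? (proj₂ (proj₂ (words-enum n k)) w (v ,
        trans (sym (ρΠ-run v)) (proj₁ (proj₂ xs-enum) _ x∈))) c)
  combs : ∣ sumℤ (map μFLyn Fs) ∣ ≡ length xs
  combs = trans (cong (λ zs → ∣ sumℤ zs ∣) (trans (map-∘ Fs) (cong (map combSign) e)))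
    (trans (cong ∣_∣ (sum-combSign ws)) (trans (∣sum-sign∣ k Cs (λ w∈ → proj₂ (proj₁ (Cs⁻ w∈))))
      (trans (sym (length-map run Cs)) (↭-length Cs↭))))
  Z = concatMap fibre xs
  Z-enum : EnumOf (λ w → Valid w × ρΠ (run w) ≡ k) Z
  Z-enum = fibres-enum xs-enum
  Z⁻ : ∀ {w} → w ∈ Z → Valid w × length w ≡ k
  Z⁻ w∈ = let v , eq = proj₁ (proj₂ Z-enum) _ w∈ in v , trans (sym (ρΠ-run v)) eq
  -- The rank of the image is the length of the word, so the fibres over rank `k` regroup the valid
  -- words of length `k`.
  Z↭ : Z ↭ ws
  Z↭ = set-↭ (proj₁ Z-enum) (proj₁ (words-enum n k)) (λ w∈ → proj₂ (proj₂ (words-enum n k)) _ (Z⁻ w∈))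
    (λ w∈ → let v , eq = ws⁻ w∈ in proj₂ (proj₂ Z-enum) _ (v , trans (ρΠ-run v) eq))
  chains : ∣ sumℤ (map μΠ xs) ∣ ≡ length Fs
  chains = trans (cong ∣_∣ (μΠ-sum xs)) (trans (∣sum-sign∣ k Z (proj₂ ∘ Z⁻)) (trans (↭-length Z↭)
    (trans (cong length (sym e)) (length-map word Fs))))

theorem3p8 : (n : ℕ) → 1 ≤ n →
    WhitneyDual (FLyn• n) (Π• n) × RΠ.IsoToR n (FLyn• n)
theorem3p8 n _ = (ρFLyn , ρΠ , μFLyn , μΠ , FLyn-graded n , Π-graded n , FLyn-Möbius n , Π-Möbius n ,
    whitney-numbers n) , FLyn≅R n
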